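{- For every $\varepsilon>0$ there is a randomized algorithm without false positives (it never answers yes on a no-instance) that answers yes on every yes-instance with probability at least $1-\varepsilon$, and that solves \textsc{Short Path with Lower and Upper Bounds} in $5.181^{\ell}\cdot\log(1/\varepsilon)\cdot n^{\mathcal{O}(1)}$ time, where $n$ is the number of vertices of the input graph and $\ell$ is the length bound of the instance.
   Context: \textsc{Short Path with Lower and Upper Bounds}: Input: a directed graph $G=(V,A)$, a vertex coloring $\chi\colon V\to\{1,\dots,c\}$, an arc-length function $w\colon A\to\mathbb{N}$ (positive integers, so every arc has length at least $1$), two vertices $s,t\in V$, and integers $\ell,\alpha_1,\dots,\alpha_c,\beta_1,\dots,\beta_c$. Question: is there a path $P$ from $s$ to $t$ in $G$ of total arc length at most $\ell$ such that for each $i\in\{1,\dots,c\}$ the number of vertices of $P$ (including $s$ and $t$) with color $i$ is at least $\alpha_i$ and at most $\beta_i$?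
   Formalization: In the time bound n is replaced by max(n,c), since with more colors than vertices all color bounds must be read and the literal bound fails; log(1/ε) is read as max(1,⌈log₂(1/ε)⌉), since it is ≤ 0 for ε ≥ 1 and tends to 0 near 1. -}

module Defs where

open import Data.Bool using (Bool; true; false; T; T?; if_then_else_)
open import Data.Fin using (Fin; toℕ)
import Data.Fin as Fin
open import Data.Integer as ℤ using (ℤ; +_; -[1+_]; 0ℤ; 1ℤ; ∣_∣)
open import Data.List using (List; []; _∷_; _++_; length; filter; tabulate; concat)
open import Data.List.Relation.Unary.Unique.Propositional using (Unique)
open import Data.Nat as ℕ using (ℕ; zero; suc; _+_; _*_; _^_; _≤_; _⊔_)
open import Data.Nat.Logarithm using (⌈log₂_⌉)
open import Data.Nat.Properties using (m^n≢0)
open import Data.Product using (_×_; _,_; proj₁; ∃-syntax)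
open import Data.Rational as ℚ using (ℚ; 1/_; ceiling)
open import Data.Rational.Properties using (pos⇒nonZero)
open import Data.Vec using (Vec; []; _∷_)
open import Relation.Binary.Construct.Closure.ReflexiveTransitive using (Star; ε; _◅_)
open import Relation.Binary.PropositionalEquality using (_≡_)
open import Relation.Nullary using (¬_; does; yes; no)

record Instance : Set where
  field
    n c   : ℕ
    A     : Fin n → Fin n → Bool
    w     : ∀ {u v} → T (A u v) → ℕ
    w≥1   : ∀ {u v} (a : T (A u v)) → 1 ≤ w a
    χ     : Fin n → Fin c
    s t   : Fin n
    ℓ     : ℤ
    α β   : Fin c → ℤ

module _ (I : Instance) where
  open Instance I

  Walk : Fin n → Fin n → Set
  Walk = Star (λ u v → T (A u v))

  vertices : ∀ {u v} → Walk u v → List (Fin n)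
  vertices {u} ε       = u ∷ []
  vertices {u} (_ ◅ p) = u ∷ vertices p

  pathLength : ∀ {u v} → Walk u v → ℕ
  pathLength ε       = 0
  pathLength (a ◅ p) = w a + pathLength p

  IsPath : ∀ {u v} → Walk u v → Set
  IsPath p = Unique (vertices p)

  colorCount : ∀ {u v} → Fin c → Walk u v → ℕ
  colorCount i p = length (filter (λ v → χ v Fin.≟ i) (vertices p))

  IsYes : Set
  IsYes = ∃[ p ] (IsPath {s} {t} p
                × + pathLength p ℤ.≤ ℓ
                × (∀ i → α i ℤ.≤ + colorCount i p × + colorCount i p ℤ.≤ β i))

-- A probabilistic random access machine with unit-cost operations on
-- integers.  As usual for this cost measure, addition and subtraction are
-- the only arithmetic: with a unit-cost product, repeated squaring would
-- make the measure unreasonable.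

Reg : Set
Reg = ℕ

data Instr : Set where
  const    : Reg → ℤ → Instr
  add sub  : Reg → Reg → Reg → Instr
  load     : Reg → Reg → Instr       -- load x y  is  x := mem[y]
  store    : Reg → Reg → Instr       -- store x y  is  mem[x] := y
  flip     : Reg → Instr             -- x := a fair random bit
  ifPos    : Reg → List Instr → List Instr → Instr
  whilePos : Reg → List Instr → Instr

Program : Set
Program = List Instr

record Store : Set where
  constructor ⟨_,_⟩
  field
    reg : Reg → ℤ
    mem : ℤ → ℤ

open Store public

setReg : Reg → ℤ → Store → Store
setReg x k σ = ⟨ (λ y → if does (y ℕ.≟ x) then k else reg σ y) , mem σ ⟩

setMem : ℤ → ℤ → Store → Store
setMem a k σ = ⟨ reg σ , (λ b → if does (b ℤ.≟ a) then k else mem σ b) ⟩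

positive? : ℤ → Bool
positive? k = does (0ℤ ℤ.<? k)

bit : Bool → ℤ
bit b = if b then 1ℤ else 0ℤ

-- The instructions still to be executed, and the store.
Config : Set
Config = Program × Store

-- Every step is supplied with a fresh coin, which only  flip  looks at.
step : Bool → Config → Config
step b ([]                  , σ) = [] , σ
step b (const x k ∷ κ       , σ) = κ , setReg x k σ
step b (add x y z ∷ κ       , σ) = κ , setReg x (reg σ y ℤ.+ reg σ z) σ
step b (sub x y z ∷ κ       , σ) = κ , setReg x (reg σ y ℤ.- reg σ z) σ
step b (load x y ∷ κ        , σ) = κ , setReg x (mem σ (reg σ y)) σ
step b (store x y ∷ κ       , σ) = κ , setMem (reg σ x) (reg σ y) σ
step b (flip x ∷ κ          , σ) = κ , setReg x (bit b) σ
step b (ifPos x p q ∷ κ     , σ) = (if positive? (reg σ x) then p else q) ++ κ , σ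
step b (whilePos x p ∷ κ    , σ) =
  (if positive? (reg σ x) then p ++ whilePos x p ∷ κ else κ) , σ

run : ∀ {m} → Vec Bool m → Config → Config
run []       γ = γ
run (b ∷ bs) γ = run bs (step b γ)

-- Colors and vertices are numbered from 0.  Arc lengths are at least 1, so
-- the entry 0 of the length matrix unambiguously marks a missing arc.
encode : Instance → List ℤ
encode I = + n ∷ + c ∷ + toℕ s ∷ + toℕ t ∷ ℓ ∷
           tabulate α ++ tabulate β ++ tabulate (λ v → + toℕ (χ v)) ++
           concat (tabulate λ u → tabulate λ v → entry u v)
  where
  open Instance I
  entry : Fin n → Fin n → ℤ
  entry u v with T? (A u v)
  ... | yes a = + w a
  ... | no  _ = 0ℤ

nth : List ℤ → ℕ → ℤ
nth []       _       = 0ℤ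
nth (k ∷ _)  zero    = k
nth (_ ∷ ks) (suc i) = nth ks i

initial : Instance → Store
initial I = ⟨ (λ _ → 0ℤ) , contents ⟩
  where
  contents : ℤ → ℤ
  contents (+ i)    = nth (encode I) i
  contents -[1+ _ ] = 0ℤ

final : ∀ {m} → Program → Instance → Vec Bool m → Config
final P I coins = run coins (P , initial I)

Halted : Config → Set
Halted γ = proj₁ γ ≡ []

-- The answer "yes" is the value 1 in register 0.
saysYes : Config → Bool
saysYes (_ , σ) = does (reg σ 0 ℤ.≟ 1ℤ)

countTrue : ∀ m → (Vec Bool m → Bool) → ℕ
countTrue zero    f = if f [] then 1 else 0
countTrue (suc m) f = countTrue m (λ bs → f (true ∷ bs)) + countTrue m (λ bs → f (false ∷ bs))

-- Probability of an event under m independent fair coins.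
Pr : ∀ m → (Vec Bool m → Bool) → ℚ
Pr m f = ((+ countTrue m f) ℚ./ (2 ^ m)) {{m^n≢0 2 m}}

-- ⌈ log₂ (1/ε) ⌉, using ⌈ log₂ x ⌉ = ⌈ log₂ ⌈ x ⌉ ⌉ for real x ≥ 1, and at
-- least 1, since log (1/ε) vanishes or is negative for ε ≥ 1 and tends to 0
-- as ε tends to 1.
logInv : (δ : ℚ) → .{{ℚ.Positive δ}} → ℕ
logInv δ = 1 ⊔ ⌈log₂ ∣ ceiling ((1/ δ) {{pos⇒nonZero δ}}) ∣ ⌉

-- m ≤ C · 5.181^ℓ · log(1/δ) · n^d, with the denominator 1000^ℓ cleared.
-- A negative ℓ counts as 0, and n is replaced by c when there are more
-- colors than vertices: the 2c color bounds are part of the input and all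
-- of them can matter, so they have to be read.
TimeBound : (C d : ℕ) (δ : ℚ) → .{{ℚ.Positive δ}} → Instance → ℕ → Set
TimeBound C d δ I m =
  m * 1000 ^ ℓ⁺ ≤ C * 5181 ^ ℓ⁺ * logInv δ * (n ⊔ c) ^ d
  where
  open Instance I
  ℓ⁺ : ℕ
  ℓ⁺ = ∣ ℓ ℤ.⊔ 0ℤ ∣

-- For every outcome of the coins P halts within m steps.
HaltsWithin : Program → Instance → ℕ → Set
HaltsWithin P I m = (coins : Vec Bool m) → Halted (final P I coins)

{-# OPTIONS --safe #-}
module Submission where

-- Let K = ℓ + 1.  A walk of length at most ℓ has at most K vertices, and the
-- sets of k vertices that obey the color bounds are the bases of a matroid.
-- It is represented by vectors a(v) in the span of e₀, …, e₍K₋₁₎.  The first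
-- Σ need i generators are reserved, need i of them for color i, and the
-- others are open to all colors; the vectors of color i are random
-- combinations of cap i random vectors b(i , j) without components reserved
-- for other colors.  The sum over all walks v₁ … vₖ of
--   y(1 , v₁) ⋯ y(k , vₖ) · a(v₁) ∧ ⋯ ∧ a(vₖ)
-- is computed by dynamic programming over (k , length , end point) with 2^K
-- coefficients.  Its coefficient at e₀ ∧ ⋯ ∧ e₍k₋₁₎ gets nothing from a walk
-- that repeats a vertex (the product vanishes), has too many vertices of a
-- color (the factors are dependent) or too few (a reserved generator is
-- missing).  If a feasible path exists, then the coefficient is a nonzero
-- polynomial in the random variables: choose y to single out the path, and
-- the other variables to send its vertices to distinct generators.  With
-- B-bit random values it vanishes with probability at most N d / 2^B, for N
-- variables of degree at most d, and B = log (1/ε) + N d suffices.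

open import Defs
open import Data.Bool using (Bool; true; false; T; T?; not; _∧_; _∨_; if_then_else_)
import Data.Bool.Properties as Boolₚ
open import Data.Empty using (⊥-elim)
open import Data.Fin using (Fin; toℕ; fromℕ<)
import Data.Fin as Fin
import Data.Fin.Properties as Finₚ
open import Data.Integer as ℤ using (ℤ; +_; -[1+_]; 0ℤ; 1ℤ; -1ℤ; ∣_∣) renaming (_+_ to _+ℤ_; _*_ to _*ℤ_; _-_ to _-ℤ_; -_ to -ℤ_)
import Data.Integer.DivMod as ℤDivMod
import Data.Integer.Properties as ℤₚ
import Data.Integer.Tactic.RingSolver as ℤ-Ring
open import Data.List using (lookup; List; []; _∷_; _++_; _∷ʳ_; length; filter; tabulate; concat; map)
import Data.List.Properties as Listₚ
open import Data.List.Membership.Propositional using (_∈_)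
open import Data.List.Membership.Propositional.Properties using (∈-lookup)
open import Data.List.Relation.Unary.All using (All; []; _∷_)
import Data.List.Relation.Unary.All as All
import Data.List.Relation.Unary.All.Properties as Allₚ
open import Data.List.Relation.Unary.AllPairs using ([]; _∷_)
open import Data.List.Relation.Unary.Any using (here; there)
open import Data.List.Relation.Unary.Unique.Propositional using (Unique)
import Data.List.Relation.Unary.Unique.Propositional.Properties as Uniqueₚ
open import Data.List.Relation.Binary.Permutation.Propositional using (_↭_; prep; swap; ↭-refl; ↭-trans; ↭-sym)
import Data.List.Relation.Binary.Permutation.Propositional as Perm
import Data.List.Relation.Binary.Permutation.Propositional.Properties as Permₚ
open import Data.Nat as ℕ using (ℕ; zero; suc; _+_; _*_; _^_; _∸_; _≤_; _<_; _⊔_; _≤ᵇ_; _<ᵇ_; _≡ᵇ_; z≤n; s≤s; NonZero)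
open import Data.Nat.Coprimality using (Coprime)
open import Data.List.Relation.Unary.Unique.DecPropositional ℕ._≟_ using (unique?)
open import Data.List.Membership.DecPropositional ℕ._≟_ using (_∈?_)
open import Data.Nat.DivMod using (_%_)
import Data.Nat.DivMod as DivMod
import Data.Nat.Divisibility as Div
import Data.Nat.Induction as ℕInduction
open import Data.Nat.Logarithm using (⌈log₂_⌉)
import Data.Nat.Logarithm as Log
import Data.Nat.Properties as ℕₚ
open import Data.Nat.Properties using (≤-trans; ≤-reflexive; ≤-refl; <-≤-trans; n<1+n; m<n⇒m<1+n; +-comm; m≤m+n; <⇒≢; +-suc; +-identityʳ; m≤n+m; <⇒≤; *-monoˡ-≤; +-mono-≤; *-monoʳ-≤; ≤-pred; ≤-<-trans; m<m+n; +-assoc; *-mono-≤; ≮⇒≥; m^n≢0; m^n>0)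
import Data.Nat.Tactic.RingSolver as ℕ-Ring
open import Data.Product using (_×_; _,_; proj₁; proj₂; ∃-syntax)
open import Data.Rational using (ℚ; 1ℚ; _-_; Positive)
import Data.Rational as ℚ
import Data.Rational.Properties as ℚₚ
import Data.Rational.Unnormalised as ℚᵘ
import Data.Rational.Unnormalised.Properties as ℚᵘₚ
open import Data.Sum using (_⊎_; inj₁; inj₂)
open import Data.Unit using (⊤; tt)
open import Data.Vec using (Vec; []; _∷_)
import Data.Vec as Vec
import Data.Vec.Properties as Vecₚ
open import Function using (_∘_; id; case_of_)
open import Relation.Binary.Construct.Closure.ReflexiveTransitive using (_◅_; _◅◅_) renaming (ε to []ʷ)
open import Relation.Binary.PropositionalEquality using (_≡_; _≢_; _≗_; refl; sym; trans; cong; cong₂; subst; subst₂; module ≡-Reasoning)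
open import Relation.Binary using (tri<; tri≈; tri>)
open import Relation.Nullary using (¬_; does; yes; no; contradiction)
open import Relation.Nullary.Decidable using (dec-true; dec-false; decidable-stable)
import Data.List.Relation.Binary.Permutation.Setoid.Properties (Relation.Binary.PropositionalEquality.setoid ℕ) as PermSₚ

-- Running the machine

-- The machine adds but neither multiplies nor divides, and this shapes the algorithm. Values are
-- exact integers, so no finite field has to be chosen, and a product with a random value is
-- computed by doubling along its bits. The recurrence is therefore arranged so that one factor of
-- every product of coefficients is a single random variable; this is why `a(v)` is never stored as
-- a vector but expanded into the `b(i , j)`. The factors `y` keep walks on the same vertex set from
-- cancelling, since their exterior products agree up to sign. A digit of a monomial is read by
-- repeated subtraction, which costs up to `2 ^ K` for each of the `2 ^ K` coefficients. The
-- resulting `4 ^ K` comes with a polynomial in ℓ, which a power of n cannot absorb when ℓ is large;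
-- both together stay below a constant times `5 ^ ℓ`, so the base 5.181 leaves room. All coins are
-- tossed before the table is filled, at steps fixed by the instance. The rest of the run is a
-- deterministic function of the bits, and the probability becomes a count of bit vectors.

infix 4 _⟶[_]_

_⟶[_]_ : Config → ℕ → Config → Set
γ ⟶[ t ] γ′ = (bs : Vec Bool t) → run bs γ ≡ γ′

run-++ : ∀ {s t} (bs : Vec Bool s) (cs : Vec Bool t) γ →
         run (bs Vec.++ cs) γ ≡ run cs (run bs γ)
run-++ []       cs γ = refl
run-++ (b ∷ bs) cs γ = run-++ bs cs (step b γ)

⟶-trans : ∀ {s t γ₁ γ₂ γ₃} → γ₁ ⟶[ s ] γ₂ → γ₂ ⟶[ t ] γ₃ → γ₁ ⟶[ s + t ] γ₃
⟶-trans {s} {t} {γ₁} p q bs with Vec.splitAt s bs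
... | cs , ds , refl = trans (run-++ cs ds γ₁) (trans (cong (run ds) (p cs)) (q ds))

-- An execution that no coin influences. The exact `time` is kept beside the bound `t`, because the
-- steps at which `toss` flips later must be known in advance. The continuation `κ` makes executions
-- composable.
record Runs (p : Program) (σ : Store) (t : ℕ) (Q : Store → Set) : Set where
  constructor runs
  field
    time   : ℕ
    time≤t : time ≤ t
    out    : Store
    steps  : ∀ κ → (p ++ κ , σ) ⟶[ time ] (κ , out)
    post   : Q out

Runs-done : ∀ {σ Q} → Q σ → Runs [] σ 0 Q
Runs-done q = runs 0 z≤n _ (λ { κ [] → refl }) q

Runs-weaken : ∀ {p σ s t Q Q′} → s ≤ t → (∀ {τ} → Q τ → Q′ τ) → Runs p σ s Q → Runs p σ t Q′
Runs-weaken s≤t f (runs m m≤s τ st q) = runs m (≤-trans m≤s s≤t) τ st (f q)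

Runs-seq : ∀ {p q σ s t Q Q′} → Runs p σ s Q → (∀ {τ} → Q τ → Runs q τ t Q′) →
           Runs (p ++ q) σ (s + t) Q′
Runs-seq {p} {q} {σ} (runs m m≤s τ st x) f with f x
... | runs n n≤t υ st′ y = runs (m + n) (+-mono-≤ m≤s n≤t) υ
  (λ κ → subst (λ l → (l , σ) ⟶[ m + n ] (κ , υ)) (sym (Listₚ.++-assoc p q κ))
    (⟶-trans (st (q ++ κ)) (st′ κ))) y

Runs-step : ∀ {i p σ τ t Q} → (∀ b κ → step b (i ∷ p ++ κ , σ) ≡ (p ++ κ , τ)) →
            Runs p τ t Q → Runs (i ∷ p) σ (suc t) Q
Runs-step e (runs m m≤t υ st q) = runs (suc m) (s≤s m≤t) υ
  (λ { κ (b ∷ bs) → trans (cong (run bs) (e b κ)) (st κ bs) }) q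

Runs-jump : ∀ {i p σ t Q} → (∀ b κ → step b (i ∷ κ , σ) ≡ (p ++ κ , σ)) →
            Runs p σ t Q → Runs (i ∷ []) σ (suc t) Q
Runs-jump e (runs m m≤t υ st q) = runs (suc m) (s≤s m≤t) υ
  (λ { κ (b ∷ bs) → trans (cong (run bs) (e b κ)) (st κ bs) }) q

Runs-if : ∀ {x p q σ t Q} →
          (positive? (reg σ x) ≡ true → Runs p σ t Q) →
          (positive? (reg σ x) ≡ false → Runs q σ t Q) →
          Runs (ifPos x p q ∷ []) σ (suc t) Q
Runs-if {x} {p} {q} {σ} f g with positive? (reg σ x) in eq
... | true  = Runs-jump (λ b κ → cong (λ v → (if v then p else q) ++ κ , σ) eq) (f refl)
... | false = Runs-jump (λ b κ → cong (λ v → (if v then p else q) ++ κ , σ) eq) (g refl)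

-- `Inv` is indexed by the turns left, which is also the value of the loop register. Each turn pays
-- one test and its body, and one more step is the failing test.
Runs-while : ∀ {x p t} (Inv : ℕ → Store → Set) →
             (∀ {m σ} → Inv m σ → reg σ x ≡ + m) →
             (∀ {m σ} → Inv (suc m) σ → Runs p σ t (Inv m)) →
             ∀ m {σ} → Inv m σ → Runs (whilePos x p ∷ []) σ (suc (m * suc t)) (Inv 0)
Runs-while {x} {p} Inv cnt body zero {σ} inv = runs 1 (s≤s z≤n) σ
  (λ { κ (b ∷ []) → cong (λ k → (if positive? k then p ++ whilePos x p ∷ κ else κ) , σ) (cnt inv) })
  inv
Runs-while {x} {p} {t} Inv cnt body (suc m) {σ} inv with body inv
... | runs l l≤t τ st inv′ with Runs-while Inv cnt body m inv′
... | runs l′ l′≤ υ st′ q = runs (suc (l + l′)) bound υ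
  (λ { κ (b ∷ bs) → trans
    (cong (λ k → run bs ((if positive? k then p ++ whilePos x p ∷ κ else κ) , σ)) (cnt inv))
    (⟶-trans (st (whilePos x p ∷ κ)) (st′ κ) bs) }) q
  where
  bound : suc (l + l′) ≤ suc (suc t + m * suc t)
  bound = s≤s (≤-trans (+-mono-≤ l≤t l′≤) (≤-reflexive (+-suc t _)))

infix 4 _≈[_]_

-- Expressions use the registers from `d` on as scratch space and never touch the memory. Memories
-- are compared pointwise for want of extensionality.
record _≈[_]_ (τ : Store) (d : ℕ) (σ : Store) : Set where
  constructor agree
  field
    regs : ∀ x → x < d → reg τ x ≡ reg σ x
    mems : ∀ a → mem τ a ≡ mem σ a

open _≈[_]_ public

≈-refl : ∀ {d σ} → σ ≈[ d ] σ
≈-refl = agree (λ _ _ → refl) (λ _ → refl)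

≈-trans : ∀ {d σ τ υ} → υ ≈[ d ] τ → τ ≈[ d ] σ → υ ≈[ d ] σ
≈-trans p q = agree (λ x x<d → trans (regs p x x<d) (regs q x x<d)) (λ a → trans (mems p a) (mems q a))

≈-down : ∀ {d e σ τ} → d ≤ e → τ ≈[ e ] σ → τ ≈[ d ] σ
≈-down d≤e p = agree (λ x x<d → regs p x (<-≤-trans x<d d≤e)) (mems p)

setReg-same : ∀ x k σ → reg (setReg x k σ) x ≡ k
setReg-same x k σ = cong (λ b → if b then k else reg σ x) (dec-true (x ℕ.≟ x) refl)

setReg-other : ∀ {x y} k σ → y ≢ x → reg (setReg x k σ) y ≡ reg σ y
setReg-other {x} {y} k σ y≢x = cong (λ b → if b then k else reg σ y) (dec-false (y ℕ.≟ x) y≢x)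

≈-setReg : ∀ {d x} k σ → d ≤ x → setReg x k σ ≈[ d ] σ
≈-setReg k σ d≤x = agree
  (λ y y<d → setReg-other k σ (λ { refl → ℕₚ.<-irrefl refl (<-≤-trans y<d d≤x) }))
  (λ _ → refl)

-- Expressions

-- The bound  coef · W ^ deg · r ^ rep · E ^ exp ; the program runs in time
-- linear in r and quadratic in E, which is why these are kept apart from W.
record Bound : Set where
  constructor bound
  field
    coef deg rep exp : ℕ

infixl 6 _⊞_
infixl 7 _⊠_

-- Taking the larger exponents in a sum is sound because all three bases are at least 1. It keeps
-- every bound a single monomial, whose degree is found by evaluation.
_⊞_ _⊠_ : Bound → Bound → Bound
bound c e ρ h ⊞ bound c′ e′ ρ′ h′ = bound (c + c′) (e ⊔ e′) (ρ ⊔ ρ′) (h ⊔ h′)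
bound c e ρ h ⊠ bound c′ e′ ρ′ h′ = bound (c * c′) (e + e′) (ρ + ρ′) (h + h′)

# : ℕ → Bound
# c = bound c 0 0 0

record Scale : Set where
  field
    W r E : ℕ
    {{W≢0}} : NonZero W
    {{r≢0}} : NonZero r
    {{E≢0}} : NonZero E

module _ (sc : Scale) where
  open Scale sc

  ⟦_⟧ : Bound → ℕ
  ⟦ bound c e ρ h ⟧ = W ^ e * (r ^ ρ * E ^ h) * c

  #≤ : ∀ c → c ≤ ⟦ # c ⟧
  #≤ c = ≤-reflexive (sym (ℕₚ.*-identityˡ c))

  ⟦⊞⟧ : ∀ a b → ⟦ a ⟧ + ⟦ b ⟧ ≤ ⟦ a ⊞ b ⟧
  ⟦⊞⟧ (bound c e ρ h) (bound c′ e′ ρ′ h′) = ≤-trans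
    (+-mono-≤
      (*-monoˡ-≤ c (*-mono-≤ (ℕₚ.^-monoʳ-≤ W (ℕₚ.m≤m⊔n e e′))
        (*-mono-≤ (ℕₚ.^-monoʳ-≤ r (ℕₚ.m≤m⊔n ρ ρ′)) (ℕₚ.^-monoʳ-≤ E (ℕₚ.m≤m⊔n h h′)))))
      (*-monoˡ-≤ c′ (*-mono-≤ (ℕₚ.^-monoʳ-≤ W (ℕₚ.m≤n⊔m e e′))
        (*-mono-≤ (ℕₚ.^-monoʳ-≤ r (ℕₚ.m≤n⊔m ρ ρ′)) (ℕₚ.^-monoʳ-≤ E (ℕₚ.m≤n⊔m h h′))))))
    (≤-reflexive (sym (ℕₚ.*-distribˡ-+ (W ^ (e ⊔ e′) * (r ^ (ρ ⊔ ρ′) * E ^ (h ⊔ h′))) c c′)))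

  ⟦⊠⟧ : ∀ a b → ⟦ a ⟧ * ⟦ b ⟧ ≡ ⟦ a ⊠ b ⟧
  ⟦⊠⟧ (bound c e ρ h) (bound c′ e′ ρ′ h′)
    rewrite ℕₚ.^-distribˡ-+-* W e e′ | ℕₚ.^-distribˡ-+-* r ρ ρ′ | ℕₚ.^-distribˡ-+-* E h h′
    = shuffle c (W ^ e) (r ^ ρ) (E ^ h) c′ (W ^ e′) (r ^ ρ′) (E ^ h′)
    where
    shuffle : ∀ a b c d a′ b′ c′ d′ →
              b * (c * d) * a * (b′ * (c′ * d′) * a′) ≡ b * b′ * (c * c′ * (d * d′)) * (a * a′)
    shuffle = ℕ-Ring.solve-∀

  ⟦⊞⟧-≤ : ∀ {m n} a b → m ≤ ⟦ a ⟧ → n ≤ ⟦ b ⟧ → m + n ≤ ⟦ a ⊞ b ⟧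
  ⟦⊞⟧-≤ a b p q = ≤-trans (+-mono-≤ p q) (⟦⊞⟧ a b)

  ⟦⊠⟧-≤ : ∀ {m n} a b → m ≤ ⟦ a ⟧ → n ≤ ⟦ b ⟧ → m * n ≤ ⟦ a ⊠ b ⟧
  ⟦⊠⟧-≤ a b p q = ≤-trans (*-mono-≤ p q) (≤-reflexive (⟦⊠⟧ a b))

infixl 6 _⊕_ _⊖_

data Expr : Set where
  lit     : ℤ → Expr
  var     : Reg → Expr
  _⊕_ _⊖_ : Expr → Expr → Expr
  at      : Expr → Expr
  ifp     : Expr → Expr → Expr → Expr
  -- iter b n e f  starts with e and performs  acc := f acc j  for j < n ;
  -- b is a promised bound on n.
  iter    : Bound → Expr → Expr → (Reg → Reg → Expr) → Expr

-- A loop at depth `d` keeps its accumulator in `d`, the turns left in `1 + d` and the index in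
-- `2 + d`. The new accumulator arrives in `3 + d`, which then serves for the constant 1.
advance : ℕ → Program
advance d = const d 0ℤ ∷ add d d (3 + d) ∷ const (3 + d) 1ℤ ∷
  add (2 + d) (2 + d) (3 + d) ∷ sub (1 + d) (1 + d) (3 + d) ∷ []

-- code e d  leaves the value of e in register d and writes to no register below d.
code : Expr → ℕ → Program
code (lit k)         d = const d k ∷ []
code (var x)         d = const d 0ℤ ∷ add d d x ∷ []
code (a ⊕ b)         d = code a d ++ code b (suc d) ++ add d d (suc d) ∷ []
code (a ⊖ b)         d = code a d ++ code b (suc d) ++ sub d d (suc d) ∷ []
code (at a)          d = code a d ++ load d d ∷ []
code (ifp c a b)     d = code c d ++ ifPos d (code a d) (code b d) ∷ []
code (iter _ n e f)  d = code e d ++ code n (1 + d) ++ const (2 + d) 0ℤ ∷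
  whilePos (1 + d) (code (f d (2 + d)) (3 + d) ++ advance d) ∷ []

-- In `iter`, 6 is one test and the five instructions of `advance`, while 2 pays for clearing the
-- index and for the failing test. The promised bound replaces the number of turns, so the cost
-- depends on the expression alone. A conditional is charged for both branches.
cost : Expr → ℕ → Bound
cost (lit _)        d = # 1
cost (var _)        d = # 2
cost (a ⊕ b)        d = cost a d ⊞ (cost b (suc d) ⊞ # 1)
cost (a ⊖ b)        d = cost a d ⊞ (cost b (suc d) ⊞ # 1)
cost (at a)         d = cost a d ⊞ # 1
cost (ifp c a b)    d = cost c d ⊞ (# 1 ⊞ (cost a d ⊞ cost b d))
cost (iter b n e f) d = cost e d ⊞ (cost n (1 + d) ⊞ (# 2 ⊞ b ⊠ (# 6 ⊞ cost (f d (2 + d)) (3 + d))))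

-- A loop with a single turn: its accumulator starts as `e`, which is thus evaluated once and
-- afterwards read from a register.
letE : Expr → (Reg → Expr) → Expr
letE e f = iter (# 1) (lit 1ℤ) e (λ x _ → f x)

World : Set
World = ℕ × Store

infix 4 _⊑_

_⊑_ : World → World → Set
(d , σ) ⊑ (e , τ) = d ≤ e × τ ≈[ d ] σ

⊑-trans : ∀ {u v w} → u ⊑ v → v ⊑ w → u ⊑ w
⊑-trans (d≤e , p) (e≤f , q) = ≤-trans d≤e e≤f , ≈-trans (≈-down d≤e q) p

⊑-refl : ∀ {w} → w ⊑ w
⊑-refl = ≤-refl , ≈-refl

module Eval (sc : Scale) where

  infix 4 _⊢_⇓_

  -- A Kripke semantics: the value must come out at every greater depth and in every store that
  -- agrees with `w`. A fact about a subexpression then survives all changes to scratch registers,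
  -- which is `⇓-up`.
  record _⊢_⇓_ (w : World) (e : Expr) (k : ℤ) : Set where
    constructor eval
    field
      exec : ∀ {d σ} → w ⊑ (d , σ) →
             Runs (code e d) σ (⟦ sc ⟧ (cost e d)) (λ τ → reg τ d ≡ k × τ ≈[ d ] σ)

  open _⊢_⇓_ public

  private
    variable
      w : World
      a b c e n : Expr
      x y k : ℤ

  ⇓-up : ∀ {v} → v ⊑ w → v ⊢ e ⇓ k → w ⊢ e ⇓ k
  ⇓-up v⊑w p = eval λ w⊑u → exec p (⊑-trans v⊑w w⊑u)

  ⇓-lit : w ⊢ lit k ⇓ k
  ⇓-lit {k = k} = eval λ { {d} {σ} _ → Runs-weaken (#≤ sc 1) id
    (Runs-step (λ _ _ → refl) (Runs-done (setReg-same d k σ , ≈-setReg k σ ≤-refl))) }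

  ⇓-var : ∀ {d σ i} → i < d → reg σ i ≡ k → (d , σ) ⊢ var i ⇓ k
  ⇓-var {k} {i = i} i<d p = eval λ { {e} {τ} (d≤e , q) → Runs-weaken (#≤ sc 2) id
    (Runs-step (λ _ _ → refl) (Runs-step (λ _ _ → refl) (Runs-done
      ( trans (setReg-same e _ (setReg e 0ℤ τ)) (trans (cong₂ _+ℤ_ (setReg-same e 0ℤ τ)
          (setReg-other 0ℤ τ (<⇒≢ (<-≤-trans i<d d≤e))))
          (trans (ℤₚ.+-identityˡ _) (trans (regs q i i<d) p)))
      , ≈-trans (≈-setReg _ (setReg e 0ℤ τ) ≤-refl) (≈-setReg 0ℤ τ ≤-refl))))) }

  private
    binary : (f : ℤ → ℤ → ℤ) (i : ℕ → Instr) →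
      (∀ {d σ b κ} → step b (i d ∷ κ , σ) ≡ (κ , setReg d (f (reg σ d) (reg σ (suc d))) σ)) →
      ∀ a b → w ⊢ a ⇓ x → w ⊢ b ⇓ y → ∀ {d σ} → w ⊑ (d , σ) →
      Runs (code a d ++ code b (suc d) ++ i d ∷ []) σ (⟦ sc ⟧ (cost a d ⊞ (cost b (suc d) ⊞ # 1)))
        (λ τ → reg τ d ≡ f x y × τ ≈[ d ] σ)
    binary {x = x} {y} f i st a b p q {d} {σ} v = Runs-weaken
      (⟦⊞⟧-≤ sc (cost a d) (cost b (suc d) ⊞ # 1) ≤-refl (⟦⊞⟧-≤ sc (cost b (suc d)) (# 1) ≤-refl
        (#≤ sc 1))) id
      (Runs-seq (exec p v) (λ { {τ} (τd , τ≈) →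
        Runs-seq (exec q (⊑-trans v (ℕₚ.n≤1+n d , τ≈)))
          (λ { {υ} (υd , υ≈) → Runs-step (λ _ _ → st)
            (Runs-done ( trans (setReg-same d _ υ) (cong₂ f (trans (regs υ≈ d ≤-refl) τd) υd)
                       , ≈-trans (≈-setReg _ υ ≤-refl) (≈-trans (≈-down (ℕₚ.n≤1+n d) υ≈) τ≈))) }) }))

  ⇓-⊕ : w ⊢ a ⇓ x → w ⊢ b ⇓ y → w ⊢ a ⊕ b ⇓ x +ℤ y
  ⇓-⊕ {a = a} {b = b} p q = eval (binary _+ℤ_ (λ d → add d d (suc d)) refl a b p q)

  ⇓-⊖ : w ⊢ a ⇓ x → w ⊢ b ⇓ y → w ⊢ a ⊖ b ⇓ x -ℤ y
  ⇓-⊖ {a = a} {b = b} p q = eval (binary _-ℤ_ (λ d → sub d d (suc d)) refl a b p q)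

  ⇓-at : ∀ {d σ} → (d , σ) ⊢ a ⇓ x → mem σ x ≡ k → (d , σ) ⊢ at a ⇓ k
  ⇓-at {a} p m = eval λ { {e} v@(d≤e , v≈) → Runs-weaken
    (⟦⊞⟧-≤ sc (cost a e) (# 1) ≤-refl (#≤ sc 1)) id
    (Runs-seq (exec p v) (λ { {τ} (τe , τ≈) → Runs-step (λ _ _ → refl) (Runs-done
      ( trans (setReg-same e _ τ) (trans (cong (mem τ) τe) (trans (mems τ≈ _) (trans (mems v≈ _) m)))
      , ≈-trans (≈-setReg _ τ ≤-refl) τ≈)) })) }

  ⇓-ifp : w ⊢ c ⇓ x → (positive? x ≡ true → w ⊢ a ⇓ k) → (positive? x ≡ false → w ⊢ b ⇓ k) →
          w ⊢ ifp c a b ⇓ k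
  ⇓-ifp {c = c} {a = a} {b = b} p q r = eval λ { {d} v → Runs-weaken
    (⟦⊞⟧-≤ sc (cost c d) (# 1 ⊞ (cost a d ⊞ cost b d)) ≤-refl
      (⟦⊞⟧-≤ sc (# 1) (cost a d ⊞ cost b d) (#≤ sc 1) (⟦⊞⟧ sc (cost a d) (cost b d)))) id
    (Runs-seq (exec p v) (λ { {τ} (τd , τ≈) →
      let u = ⊑-trans v (≤-refl , τ≈)
      in Runs-if
        (λ t → Runs-weaken (m≤m+n _ _) (λ z → proj₁ z , ≈-trans (proj₂ z) τ≈) (exec (q (trans (cong positive? (sym τd)) t)) u))
        (λ t → Runs-weaken (m≤n+m _ _) (λ z → proj₁ z , ≈-trans (proj₂ z) τ≈) (exec (r (trans (cong positive? (sym τd)) t)) u)) })) }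

  module _ {count : Bound} {init : Expr} {body : Reg → Reg → Expr} {N : ℕ} (N≤ : N ≤ ⟦ sc ⟧ count) (f : ℕ → ℤ) where

    ⇓-iter : w ⊢ n ⇓ + N → w ⊢ init ⇓ f 0 →
             (∀ {i} → i < N → ∀ {v} → w ⊑ v → ∀ {a j} → v ⊢ var a ⇓ f i → v ⊢ var j ⇓ + i → v ⊢ body a j ⇓ f (suc i)) →
             w ⊢ iter count n init body ⇓ f N
    exec (⇓-iter {n = n} pn pi pb) {d} {σ} v = Runs-weaken total id
      (Runs-seq (exec pi v) (λ { {τ} (τd , τ≈) →
       Runs-seq (exec pn (⊑-trans v (ℕₚ.n≤1+n d , τ≈))) (λ { {υ} (υd , υ≈) →
       Runs-step (λ _ _ → refl)
         (Runs-weaken ≤-refl (λ { (i , refl , acc , _ , _ , ≈) →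
             trans acc (cong f (sym (+-identityʳ i))) , ≈ })
           (Runs-while Inv (λ { (_ , _ , _ , rem , _) → rem }) turn N
             ( 0 , refl
             , trans (setReg-other 0ℤ υ (<⇒≢ (m<n⇒m<1+n (n<1+n d))))
                 (trans (regs υ≈ d (n<1+n d)) τd)
             , trans (setReg-other 0ℤ υ (<⇒≢ (n<1+n (suc d)))) υd
             , setReg-same (2 + d) 0ℤ υ
             , ≈-trans (≈-setReg 0ℤ υ (m≤n+m d 2)) (≈-trans (≈-down (ℕₚ.n≤1+n d) υ≈) τ≈)))) }) }))
      where
      Inv : ℕ → Store → Set
      Inv m τ = ∃[ i ] (i + m ≡ N × reg τ d ≡ f i × reg τ (1 + d) ≡ + m × reg τ (2 + d) ≡ + i × τ ≈[ d ] σ)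

      B : Bound
      B = cost (body d (2 + d)) (3 + d)

      total : ⟦ sc ⟧ (cost init d) + (⟦ sc ⟧ (cost n (suc d)) + suc (suc (N * suc (⟦ sc ⟧ B + 5)))) ≤
              ⟦ sc ⟧ (cost init d ⊞ (cost n (suc d) ⊞ (# 2 ⊞ count ⊠ (# 6 ⊞ B))))
      total = ⟦⊞⟧-≤ sc (cost init d) (cost n (suc d) ⊞ (# 2 ⊞ count ⊠ (# 6 ⊞ B))) ≤-refl
        (⟦⊞⟧-≤ sc (cost n (suc d)) (# 2 ⊞ count ⊠ (# 6 ⊞ B)) ≤-refl
          (⟦⊞⟧-≤ sc (# 2) (count ⊠ (# 6 ⊞ B)) (#≤ sc 2)
            (⟦⊠⟧-≤ sc count (# 6 ⊞ B) N≤
              (≤-trans (≤-reflexive (cong suc (+-comm _ 5)))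
                (⟦⊞⟧-≤ sc (# 6) B (#≤ sc 6) ≤-refl)))))

      turn : ∀ {m τ} → Inv (suc m) τ → Runs _ τ (⟦ sc ⟧ B + 5) (Inv m)
      turn {m} {τ} (i , i+m , acc , rem , idx , τ≈) = Runs-seq
        (exec (pb (subst (i <_) i+m (m<m+n i (s≤s z≤n))) (⊑-trans v (m≤n+m d 3 , τ≈))
          (⇓-var (ℕₚ.m<n+m d {3} (s≤s z≤n)) acc) (⇓-var ≤-refl idx)) ⊑-refl)
        (λ { {υ} (υd , υ≈) → Runs-step (λ _ _ → refl) (Runs-step (λ _ _ → refl)
          (Runs-step (λ _ _ → refl) (Runs-step (λ _ _ → refl) (Runs-step (λ _ _ → refl)
            (Runs-done (suc i , trans (sym (+-suc i m)) i+m , after υ υd υ≈)))))) })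
        where
        after : ∀ υ → reg υ (3 + d) ≡ f (suc i) → υ ≈[ 3 + d ] τ → _
        after υ υd υ≈ =
            trans (setReg-other _ σ₄ d≢1) (trans (setReg-other _ σ₃ d≢2)
              (trans (setReg-other _ σ₂ d≢3) new-acc))
          , trans (setReg-same (1 + d) _ σ₄) (trans (cong₂ _-ℤ_ rem₄ one₄) refl)
          , trans (setReg-other _ σ₄ 2≢1) (trans (setReg-same (2 + d) _ σ₃)
              (trans (cong₂ _+ℤ_ idx₃ one₃) (cong +_ (+-comm i 1))))
          , ≈-trans (≈-setReg _ σ₄ (ℕₚ.n≤1+n d)) (≈-trans (≈-setReg _ σ₃ (m≤n+m d 2))
              (≈-trans (≈-setReg _ σ₂ (m≤n+m d 3)) (≈-trans (≈-setReg _ σ₁ ≤-refl)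
              (≈-trans (≈-setReg _ υ ≤-refl) (≈-trans (≈-down (m≤n+m d 3) υ≈) τ≈)))))
          where
          σ₁ = setReg d 0ℤ υ
          σ₂ = setReg d (reg σ₁ d +ℤ reg σ₁ (3 + d)) σ₁
          σ₃ = setReg (3 + d) 1ℤ σ₂
          σ₄ = setReg (2 + d) (reg σ₃ (2 + d) +ℤ reg σ₃ (3 + d)) σ₃
          d<1 = n<1+n d
          d<2 = ℕₚ.m<n+m d {2} (s≤s z≤n)
          d<3 = ℕₚ.m<n+m d {3} (s≤s z≤n)
          d≢1 = <⇒≢ d<1
          d≢2 = <⇒≢ d<2
          d≢3 = <⇒≢ d<3
          1≢d = ℕₚ.>⇒≢ d<1
          2≢d = ℕₚ.>⇒≢ d<2
          3≢d = ℕₚ.>⇒≢ d<3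
          2≢1 = ℕₚ.>⇒≢ (n<1+n (1 + d))
          3≢2 = ℕₚ.>⇒≢ (n<1+n (2 + d))
          2≢3 = <⇒≢ (n<1+n (2 + d))
          1≢2 = <⇒≢ (n<1+n (1 + d))
          1≢3 = <⇒≢ (ℕₚ.m<n+m (1 + d) {2} (s≤s z≤n))
          new-acc : reg σ₂ d ≡ f (suc i)
          new-acc = trans (setReg-same d _ σ₁) (trans (cong₂ _+ℤ_ (setReg-same d 0ℤ υ)
            (trans (setReg-other 0ℤ υ 3≢d) υd)) (ℤₚ.+-identityˡ _))
          one₃ : reg σ₃ (3 + d) ≡ 1ℤ
          one₃ = setReg-same (3 + d) 1ℤ σ₂
          idx₃ : reg σ₃ (2 + d) ≡ + i
          idx₃ = trans (setReg-other _ σ₂ 2≢3) (trans (setReg-other _ σ₁ 2≢d) (trans (setReg-other _ υ 2≢d)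
            (trans (regs υ≈ (2 + d) (n<1+n (2 + d))) idx)))
          one₄ : reg σ₄ (3 + d) ≡ 1ℤ
          one₄ = trans (setReg-other _ σ₃ 3≢2) one₃
          rem₄ : reg σ₄ (1 + d) ≡ + suc m
          rem₄ = trans (setReg-other _ σ₃ 1≢2) (trans (setReg-other _ σ₂ 1≢3) (trans (setReg-other _ σ₁ 1≢d)
            (trans (setReg-other _ υ 1≢d) (trans (regs υ≈ (1 + d) (ℕₚ.m<n+m (1 + d) {2} (s≤s z≤n))) rem))))

  ⇓-let : {body : Reg → Expr} → w ⊢ e ⇓ x →
          (∀ {v} → w ⊑ v → ∀ {a} → v ⊢ var a ⇓ x → v ⊢ body a ⇓ y) → w ⊢ letE e body ⇓ y
  ⇓-let {x = x} {y} p q = ⇓-iter {count = # 1} {N = 1} (#≤ sc 1) f ⇓-lit p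
    (λ { (s≤s z≤n) v a _ → q v a })
    where
    f : ℕ → ℤ
    f zero    = x
    f (suc _) = y

-- Commands and coin tosses

-- Writing to memory is kept out of `Expr`, since later worlds must have the same memory for values
-- to persist.
data Cmd : Set where
  assign : Expr → Expr → Cmd
  for    : Bound → Expr → (Reg → Cmd) → Cmd

prog : Cmd → ℕ → Program
prog (assign a e) d = code a d ++ code e (suc d) ++ store d (suc d) ∷ []
prog (for _ n f)  d = code n d ++ const (1 + d) 0ℤ ∷ whilePos d (prog (f (1 + d)) (2 + d) ++
  const (2 + d) 1ℤ ∷ add (1 + d) (1 + d) (2 + d) ∷ sub d d (2 + d) ∷ []) ∷ []

time : Cmd → ℕ → Bound
time (assign a e) d = cost a d ⊞ (cost e (suc d) ⊞ # 1)
time (for b n f)  d = cost n d ⊞ (# 2 ⊞ b ⊠ (# 4 ⊞ time (f (1 + d)) (2 + d)))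

Keeps : ℕ → Store → Store → Set
Keeps d σ τ = ∀ x → x < d → reg τ x ≡ reg σ x

module Commands (sc : Scale) where
  open Eval sc

  record Executes (c : Cmd) (d : ℕ) (σ : Store) (Q : Store → Set) : Set where
    constructor executes
    field
      result : Runs (prog c d) σ (⟦ sc ⟧ (time c d)) (λ τ → Keeps d σ τ × Q τ)

  open Executes public

  Executes-assign : ∀ {a e d σ A V} → (d , σ) ⊢ a ⇓ A → (d , σ) ⊢ e ⇓ V →
    Executes (assign a e) d σ (λ τ → mem τ A ≡ V × (∀ b → b ≢ A → mem τ b ≡ mem σ b))
  Executes-assign {a} {e} {d} {σ} {A} {V} pa pe = executes (Runs-weaken
    (⟦⊞⟧-≤ sc (cost a d) (cost e (suc d) ⊞ # 1) ≤-refl (⟦⊞⟧-≤ sc (cost e (suc d)) (# 1) ≤-refl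
      (#≤ sc 1))) id
    (Runs-seq (exec pa ⊑-refl) (λ { {τ} (τd , τ≈) →
     Runs-seq (exec pe (ℕₚ.n≤1+n d , τ≈)) (λ { {υ} (υd , υ≈) →
     Runs-step (λ _ _ → refl) (Runs-done
       ( (λ x x<d → trans (regs υ≈ x (m<n⇒m<1+n x<d)) (regs τ≈ x x<d))
       , trans (cong (λ b → if b then reg υ (suc d) else mem υ A)
           (dec-true (A ℤ.≟ reg υ d) (sym (trans (regs υ≈ d ≤-refl) τd)))) υd
       , (λ b b≢A → trans (cong (λ c → if c then reg υ (suc d) else mem υ b)
           (dec-false (b ℤ.≟ reg υ d) (λ eq → b≢A (trans eq (trans (regs υ≈ d ≤-refl) τd)))))
           (trans (mems υ≈ b) (mems τ≈ b))))) }) })))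

  module _ {count : Bound} {body : Reg → Cmd} {n : Expr} {d : ℕ} {σ : Store}
           {N : ℕ} (N≤ : N ≤ ⟦ sc ⟧ count) (pn : (d , σ) ⊢ n ⇓ + N)
           (Inv : ℕ → (ℤ → ℤ) → Set) (resp : ∀ {i M M′} → (∀ a → M′ a ≡ M a) → Inv i M → Inv i M′) where

    Executes-for : Inv 0 (mem σ) →
      (∀ {i τ} → i < N → Keeps d σ τ → reg τ (1 + d) ≡ + i → Inv i (mem τ) →
        Executes (body (1 + d)) (2 + d) τ (λ υ → Inv (suc i) (mem υ))) →
      Executes (for count n body) d σ (λ τ → Inv N (mem τ))
    result (Executes-for inv₀ pb) = Runs-weaken total id
      (Runs-seq (exec pn ⊑-refl) (λ { {τ} (τd , τ≈) →
       Runs-step (λ _ _ → refl)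
         (Runs-weaken ≤-refl (λ { (i , refl , _ , _ , keep , inv) →
             keep , subst (λ j → Inv j _) (sym (+-identityʳ i)) inv })
           (Runs-while Loop (λ { (_ , _ , rem , _) → rem }) turn N
             ( 0 , refl
             , trans (setReg-other 0ℤ τ (<⇒≢ (n<1+n d))) τd
             , setReg-same (1 + d) 0ℤ τ
             , (λ x x<d → trans (setReg-other 0ℤ τ (<⇒≢ (m<n⇒m<1+n x<d))) (regs τ≈ x x<d))
             , resp (mems τ≈) inv₀))) }))
      where
      Loop : ℕ → Store → Set
      Loop m τ = ∃[ i ] (i + m ≡ N × reg τ d ≡ + m × reg τ (1 + d) ≡ + i × Keeps d σ τ × Inv i (mem τ))

      B : Bound
      B = time (body (1 + d)) (2 + d)

      total : ⟦ sc ⟧ (cost n d) + suc (suc (N * suc (⟦ sc ⟧ B + 3))) ≤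
              ⟦ sc ⟧ (cost n d ⊞ (# 2 ⊞ count ⊠ (# 4 ⊞ B)))
      total = ⟦⊞⟧-≤ sc (cost n d) (# 2 ⊞ count ⊠ (# 4 ⊞ B)) ≤-refl
          (⟦⊞⟧-≤ sc (# 2) (count ⊠ (# 4 ⊞ B)) (#≤ sc 2)
            (⟦⊠⟧-≤ sc count (# 4 ⊞ B) N≤
              (≤-trans (≤-reflexive (cong suc (+-comm _ 3)))
                (⟦⊞⟧-≤ sc (# 4) B (#≤ sc 4) ≤-refl))))

      turn : ∀ {m τ} → Loop (suc m) τ → Runs _ τ (⟦ sc ⟧ B + 3) (Loop m)
      turn {m} {τ} (i , i+m , rem , idx , keep , inv) = Runs-seq
        (result (pb (subst (i <_) i+m (m<m+n i (s≤s z≤n))) keep idx inv))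
        (λ { {υ} (keep′ , inv′) → Runs-step (λ _ _ → refl) (Runs-step (λ _ _ → refl)
          (Runs-step (λ _ _ → refl) (Runs-done
            (suc i , trans (sym (+-suc i m)) i+m , after υ keep′ inv′)))) })
        where
        after : ∀ υ → Keeps (2 + d) τ υ → Inv (suc i) (mem υ) → _
        after υ keep′ inv′ =
            trans (setReg-same d _ σ₂) (trans (cong₂ _-ℤ_ rem₂ one₂) refl)
          , trans (setReg-other _ σ₂ (ℕₚ.>⇒≢ (n<1+n d))) (trans (setReg-same (1 + d) _ σ₁)
              (trans (cong₂ _+ℤ_ idx₁ (setReg-same (2 + d) 1ℤ υ)) (cong +_ (+-comm i 1))))
          , (λ x x<d → trans (setReg-other _ σ₂ (<⇒≢ x<d))
              (trans (setReg-other _ σ₁ (<⇒≢ (m<n⇒m<1+n x<d)))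
              (trans (setReg-other _ υ (<⇒≢ (m<n⇒m<1+n (m<n⇒m<1+n x<d))))
              (trans (keep′ x (m<n⇒m<1+n (m<n⇒m<1+n x<d))) (keep x x<d)))))
          , inv′
          where
          σ₁ = setReg (2 + d) 1ℤ υ
          σ₂ = setReg (1 + d) (reg σ₁ (1 + d) +ℤ reg σ₁ (2 + d)) σ₁
          idx₁ : reg σ₁ (1 + d) ≡ + i
          idx₁ = trans (setReg-other 1ℤ υ (<⇒≢ (n<1+n (1 + d)))) (trans (keep′ (1 + d) ≤-refl) idx)
          one₂ : reg σ₂ (2 + d) ≡ 1ℤ
          one₂ = trans (setReg-other _ σ₁ (ℕₚ.>⇒≢ (n<1+n (1 + d)))) (setReg-same (2 + d) 1ℤ υ)
          rem₂ : reg σ₂ d ≡ + suc m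
          rem₂ = trans (setReg-other _ σ₁ (<⇒≢ (n<1+n d))) (trans (setReg-other 1ℤ υ
            (<⇒≢ (ℕₚ.m<n+m d {2} (s≤s z≤n)))) (trans (keep′ d (ℕₚ.m<n+m d {2} (s≤s z≤n))) rem))

-- Register 0 counts the bits left, register 1 holds the next address, and register 2 holds first
-- the bit and then the constant 1.
toss : Instr
toss = whilePos 0 (flip 2 ∷ store 1 2 ∷ const 2 1ℤ ∷ sub 1 1 2 ∷ sub 0 0 2 ∷ [])

-- The bits go to the addresses -1, -2, …, so that they never collide with the input.
randomize : Expr → Program
randomize n = code n 0 ++ const 1 -1ℤ ∷ toss ∷ []

nthBit : ∀ {N} → Vec Bool N → ℕ → Bool
nthBit []       _       = false
nthBit (b ∷ _)  zero    = b
nthBit (_ ∷ bs) (suc q) = nthBit bs q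

-- One round of  toss  takes six steps, of which the second flips.
tossed : ∀ N {M} → Vec Bool (N * 6 + M) → Vec Bool N
tossed zero    _                           = []
tossed (suc N) (_ ∷ b ∷ _ ∷ _ ∷ _ ∷ _ ∷ bs) = b ∷ tossed N bs

after-toss : ∀ N {M} → Vec Bool (N * 6 + M) → Vec Bool M
after-toss zero    bs                          = bs
after-toss (suc N) (_ ∷ _ ∷ _ ∷ _ ∷ _ ∷ _ ∷ bs) = after-toss N bs

-- The clause for `q < i` carries a stored bit through the later rounds. The coin beyond `N * 6`
-- belongs to the failing test of the loop.
run-toss : ∀ N {M} (bs : Vec Bool (N * 6 + suc M)) κ {σ} i → reg σ 0 ≡ + N → reg σ 1 ≡ -[1+ i ] →
  ∃[ τ ] ( run bs (toss ∷ κ , σ) ≡ run (Vec.tail (after-toss N bs)) (κ , τ)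
         × (∀ a → mem τ (+ a) ≡ mem σ (+ a))
         × (∀ q → q < i → mem τ -[1+ q ] ≡ mem σ -[1+ q ])
         × (∀ q → q < N → mem τ -[1+ i + q ] ≡ bit (nthBit (tossed N bs) q)))
run-toss zero (b ∷ bs) κ {σ} i r0 r1 = σ
  , cong (λ k → run bs ((if positive? k then _ else κ) , σ)) r0
  , (λ _ → refl) , (λ _ _ → refl) , λ _ ()
run-toss (suc N) bs@(b₀ ∷ b ∷ _ ∷ _ ∷ _ ∷ _ ∷ cs) κ {σ} i r0 r1
  with run-toss N cs κ {σ′} (suc i) (trans (cong (_-ℤ 1ℤ) r0) refl)
         (trans (cong (_-ℤ 1ℤ) r1) (cong (λ j → -[1+ suc j ]) (+-identityʳ i)))
  where
  σ₁ = setReg 2 (bit b) σ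
  σ₂ = setMem (reg σ 1) (bit b) σ₁
  σ₃ = setReg 2 1ℤ σ₂
  σ₄ = setReg 1 (reg σ 1 -ℤ 1ℤ) σ₃
  σ′ = setReg 0 (reg σ 0 -ℤ 1ℤ) σ₄
... | τ , eq , pos , old , new = τ
  , trans (cong (λ k → run cs′ ((if positive? k then body ++ toss ∷ κ else κ) , σ)) r0) eq
  , (λ a → trans (pos a) (cong (λ k → if does (+ a ℤ.≟ k) then bit b else mem σ (+ a)) r1))
  , (λ q q<i → trans (old q (m<n⇒m<1+n q<i)) (trans
      (cong (λ k → if does (-[1+ q ] ℤ.≟ k) then bit b else mem σ -[1+ q ]) r1)
      (cong (λ c → if c then bit b else mem σ -[1+ q ])
        (dec-false (-[1+ q ] ℤ.≟ -[1+ i ]) (λ { refl → ℕₚ.<-irrefl refl q<i })))))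
  , fresh
  where
  cs′ = b ∷ _ ∷ _ ∷ _ ∷ _ ∷ cs
  body = flip 2 ∷ store 1 2 ∷ const 2 1ℤ ∷ sub 1 1 2 ∷ sub 0 0 2 ∷ []
  fresh : ∀ q → q < suc N → mem τ -[1+ i + q ] ≡ bit (nthBit (tossed (suc N) bs) q)
  fresh zero q<N rewrite +-identityʳ i = trans (old i ≤-refl) (trans
    (cong (λ k → if does (-[1+ i ] ℤ.≟ k) then bit b else mem σ -[1+ i ]) r1)
    (cong (λ c → if c then bit b else mem σ -[1+ i ]) (dec-true (-[1+ i ] ℤ.≟ -[1+ i ]) refl)))
  fresh (suc q) (s≤s q<N) rewrite +-suc i q = new q q<N

countTrue-cong : ∀ m {f g : Vec Bool m → Bool} → (∀ bs → f bs ≡ g bs) → countTrue m f ≡ countTrue m g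
countTrue-cong zero    e = cong (λ b → if b then 1 else 0) (e [])
countTrue-cong (suc m) e = cong₂ _+_ (countTrue-cong m (λ bs → e (true ∷ bs))) (countTrue-cong m (λ bs → e (false ∷ bs)))

double : ∀ x → x + x ≡ 2 * x
double = ℕ-Ring.solve-∀

countTrue-drop : ∀ s {m} (f : Vec Bool m → Bool) →
                 countTrue (s + m) (λ bs → f (Vec.drop s bs)) ≡ 2 ^ s * countTrue m f
countTrue-drop zero    f = sym (ℕₚ.*-identityˡ _)
countTrue-drop (suc s) {m} f = trans (double (countTrue (s + m) _)) (trans (cong (2 *_) (countTrue-drop s f)) (sym (ℕₚ.*-assoc 2 (2 ^ s) _)))

-- Five coins of each round and the last `M` do not influence the event, and each of them doubles
-- the count.
countTrue-tossed : ∀ N {M} (f : Vec Bool N → Bool) →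
                   countTrue (N * 6 + M) (λ bs → f (tossed N bs)) ≡ 2 ^ (N * 5 + M) * countTrue N f
countTrue-tossed zero {M} f = go M
  where
  go : ∀ M → countTrue M (λ _ → f []) ≡ 2 ^ M * (if f [] then 1 else 0)
  go zero    = sym (ℕₚ.*-identityˡ _)
  go (suc M) = trans (double (countTrue M _)) (trans (cong (2 *_) (go M)) (sym (ℕₚ.*-assoc 2 (2 ^ M) _)))
countTrue-tossed (suc N) {M} f
  rewrite countTrue-tossed N {M} (λ bs → f (true ∷ bs)) | countTrue-tossed N {M} (λ bs → f (false ∷ bs))
  = trans (cong (λ k → k + k) (cong₂ _+_ (sixteen (p * x)) (sixteen (p * y)))) (collect p x y)
  where
  p = 2 ^ (N * 5 + M)
  x = countTrue N (λ bs → f (true ∷ bs))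
  y = countTrue N (λ bs → f (false ∷ bs))
  sixteen : ∀ u → ((u + u) + (u + u)) + ((u + u) + (u + u)) + (((u + u) + (u + u)) + ((u + u) + (u + u))) ≡ 16 * u
  sixteen = ℕ-Ring.solve-∀
  collect : ∀ p x y → (16 * (p * x) + 16 * (p * y)) + (16 * (p * x) + 16 * (p * y)) ≡ 2 * (2 * (2 * (2 * (2 * p)))) * (x + y)
  collect = ℕ-Ring.solve-∀

-- Exterior algebra

sumTo : ℕ → (ℕ → ℤ) → ℤ
sumTo zero    f = 0ℤ
sumTo (suc n) f = sumTo n f +ℤ f n

sumTo-zero : ∀ n {f} → (∀ i → i < n → f i ≡ 0ℤ) → sumTo n f ≡ 0ℤ
sumTo-zero zero    e = refl
sumTo-zero (suc n) e = cong₂ _+ℤ_ (sumTo-zero n (λ i i<n → e i (m<n⇒m<1+n i<n))) (e n (n<1+n n))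

sumTo-single : ∀ n {f} j → j < n → (∀ i → i < n → i ≢ j → f i ≡ 0ℤ) → sumTo n f ≡ f j
sumTo-single (suc n) {f} j j<1+n e with j ℕ.≟ n
... | yes refl = trans (cong (_+ℤ f n) (sumTo-zero n (λ i i<n → e i (m<n⇒m<1+n i<n) (<⇒≢ i<n)))) (ℤₚ.+-identityˡ _)
... | no  j≢n  = trans (cong₂ _+ℤ_
  (sumTo-single n j (ℕₚ.≤∧≢⇒< (≤-pred j<1+n) j≢n) (λ i i<n → e i (m<n⇒m<1+n i<n)))
  (e n (n<1+n n) (λ n≡j → j≢n (sym n≡j)))) (ℤₚ.+-identityʳ _)

i≡-i⇒i≡0 : ∀ i → i ≡ -ℤ i → i ≡ 0ℤ
i≡-i⇒i≡0 (+ zero) _ = refl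

-- The exterior algebra on generators e₀, …, e₍K₋₁₎; the head of a vector
-- says whether e₍K₋₁₎ occurs in the monomial.
Ext : ℕ → Set
Ext K = Vec Bool K → ℤ

-- With `T = T₀ + e ∧ T₁` for the highest generator `e`, the product `a ∧ e ∧ T₁` equals
-- `- e ∧ a ∧ T₁`, which gives the minus sign.
wedge : ∀ {K} → (ℕ → ℤ) → Ext K → Ext K
wedge         a T []          = 0ℤ
wedge         a T (false ∷ X) = wedge a (T ∘ (false ∷_)) X
wedge {suc K} a T (true ∷ X)  = a K *ℤ T (false ∷ X) -ℤ wedge a (T ∘ (true ∷_)) X

one : ∀ {K} → Ext K
one []          = 1ℤ
one (false ∷ X) = one X
one (true ∷ X)  = 0ℤ

wedge-cong : ∀ {K a b} {T U : Ext K} → (∀ p → p < K → a p ≡ b p) → T ≗ U → wedge a T ≗ wedge b U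
wedge-cong         e f []          = refl
wedge-cong {suc K} e f (false ∷ X) = wedge-cong (λ p p<K → e p (m<n⇒m<1+n p<K)) (λ Y → f (false ∷ Y)) X
wedge-cong {suc K} e f (true ∷ X)  = cong₂ _-ℤ_ (cong₂ _*ℤ_ (e K (n<1+n K)) (f (false ∷ X)))
  (wedge-cong (λ p p<K → e p (m<n⇒m<1+n p<K)) (λ Y → f (true ∷ Y)) X)

wedge-congʳ : ∀ {K} a {T U : Ext K} → T ≗ U → wedge a T ≗ wedge a U
wedge-congʳ a = wedge-cong (λ _ _ → refl)

wedge-axpy : ∀ {K} a x (T U : Ext K) X →
             wedge a (λ Y → x *ℤ T Y +ℤ U Y) X ≡ x *ℤ wedge a T X +ℤ wedge a U X
wedge-axpy a x T U []          = sym (trans (ℤₚ.+-identityʳ _) (ℤₚ.*-zeroʳ x))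
wedge-axpy a x T U (false ∷ X) = wedge-axpy a x _ _ X
wedge-axpy {suc K} a x T U (true ∷ X)
  rewrite wedge-axpy a x (T ∘ (true ∷_)) (U ∘ (true ∷_)) X = expand (a K) x _ _ _ _
  where
  expand : ∀ a x t u t′ u′ → a *ℤ (x *ℤ t +ℤ u) -ℤ (x *ℤ t′ +ℤ u′) ≡ x *ℤ (a *ℤ t -ℤ t′) +ℤ (a *ℤ u -ℤ u′)
  expand = ℤ-Ring.solve-∀

wedge-zero : ∀ {K} a {T : Ext K} → (∀ X → T X ≡ 0ℤ) → ∀ X → wedge a T X ≡ 0ℤ
wedge-zero a z []          = refl
wedge-zero a z (false ∷ X) = wedge-zero a (λ Y → z (false ∷ Y)) X
wedge-zero {suc K} a z (true ∷ X)
  rewrite z (false ∷ X) | wedge-zero a (λ Y → z (true ∷ Y)) X = cong (_-ℤ 0ℤ) (ℤₚ.*-zeroʳ (a K))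

wedge-* : ∀ {K} a x (T : Ext K) X → wedge a (λ Y → x *ℤ T Y) X ≡ x *ℤ wedge a T X
wedge-* a x T X = begin
  wedge a (λ Y → x *ℤ T Y) X             ≡⟨ wedge-congʳ a (λ Y → sym (ℤₚ.+-identityʳ _)) X ⟩
  wedge a (λ Y → x *ℤ T Y +ℤ 0ℤ) X       ≡⟨ wedge-axpy a x T (λ _ → 0ℤ) X ⟩
  x *ℤ wedge a T X +ℤ wedge a (λ _ → 0ℤ) X ≡⟨ cong (x *ℤ wedge a T X +ℤ_) (wedge-zero a (λ _ → refl) X) ⟩
  x *ℤ wedge a T X +ℤ 0ℤ                 ≡⟨ ℤₚ.+-identityʳ _ ⟩
  x *ℤ wedge a T X                       ∎
  where open ≡-Reasoning

wedge-sum : ∀ {K} a n (T : ℕ → Ext K) X →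
            wedge a (λ Y → sumTo n (λ i → T i Y)) X ≡ sumTo n (λ i → wedge a (T i) X)
wedge-sum a zero    T X = wedge-zero a (λ _ → refl) X
wedge-sum a (suc n) T X = begin
  wedge a (λ Y → sumTo n (λ i → T i Y) +ℤ T n Y) X
    ≡⟨ wedge-congʳ a (λ Y → trans (ℤₚ.+-comm _ (T n Y)) (cong (_+ℤ sumTo n (λ i → T i Y)) (sym (ℤₚ.*-identityˡ (T n Y))))) X ⟩
  wedge a (λ Y → 1ℤ *ℤ T n Y +ℤ sumTo n (λ i → T i Y)) X
    ≡⟨ wedge-axpy a 1ℤ (T n) _ X ⟩
  1ℤ *ℤ wedge a (T n) X +ℤ wedge a (λ Y → sumTo n (λ i → T i Y)) X
    ≡⟨ cong₂ _+ℤ_ (ℤₚ.*-identityˡ (wedge a (T n) X)) (wedge-sum a n T X) ⟩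
  wedge a (T n) X +ℤ sumTo n (λ i → wedge a (T i) X)
    ≡⟨ ℤₚ.+-comm (wedge a (T n) X) _ ⟩
  sumTo n (λ i → wedge a (T i) X) +ℤ wedge a (T n) X ∎
  where open ≡-Reasoning

wedge-zeroˡ : ∀ {K a} (T : Ext K) → (∀ p → p < K → a p ≡ 0ℤ) → ∀ X → wedge a T X ≡ 0ℤ
wedge-zeroˡ T z []          = refl
wedge-zeroˡ T z (false ∷ X) = wedge-zeroˡ _ (λ p p<K → z p (m<n⇒m<1+n p<K)) X
wedge-zeroˡ {suc K} T z (true ∷ X)
  rewrite z K (n<1+n K) | wedge-zeroˡ (T ∘ (true ∷_)) (λ p p<K → z p (m<n⇒m<1+n p<K)) X = refl

wedge-axpyˡ : ∀ {K} x a b (T : Ext K) X →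
              wedge (λ p → a p +ℤ x *ℤ b p) T X ≡ wedge a T X +ℤ x *ℤ wedge b T X
wedge-axpyˡ x a b T []          = sym (trans (ℤₚ.+-identityˡ _) (ℤₚ.*-zeroʳ x))
wedge-axpyˡ x a b T (false ∷ X) = wedge-axpyˡ x a b _ X
wedge-axpyˡ {suc K} x a b T (true ∷ X)
  rewrite wedge-axpyˡ x a b (T ∘ (true ∷_)) X = expand x (a K) (b K) _ _ _
  where
  expand : ∀ x a b t u v → (a +ℤ x *ℤ b) *ℤ t -ℤ (u +ℤ x *ℤ v) ≡ (a *ℤ t -ℤ u) +ℤ x *ℤ (b *ℤ t -ℤ v)
  expand = ℤ-Ring.solve-∀

wedge-sumˡ : ∀ {K} n (x : ℕ → ℤ) (b : ℕ → ℕ → ℤ) (T : Ext K) X →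
             wedge (λ p → sumTo n (λ j → x j *ℤ b j p)) T X ≡ sumTo n (λ j → x j *ℤ wedge (b j) T X)
wedge-sumˡ zero    x b T X = wedge-zeroˡ T (λ _ _ → refl) X
wedge-sumˡ (suc n) x b T X = trans (wedge-axpyˡ (x n) _ (b n) T X)
  (cong (_+ℤ x n *ℤ wedge (b n) T X) (wedge-sumˡ n x b T X))

wedge-anti : ∀ {K} a b (T : Ext K) X → wedge a (wedge b T) X ≡ -ℤ wedge b (wedge a T) X
wedge-anti a b T []          = refl
wedge-anti a b T (false ∷ X) = wedge-anti a b _ X
wedge-anti {suc K} a b T (true ∷ X) = begin
  a K *ℤ B₀ -ℤ wedge a (λ Y → b K *ℤ T₀ Y -ℤ wedge b T₁ Y) X
    ≡⟨ cong (λ z → a K *ℤ B₀ -ℤ z) (split a b) ⟩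
  a K *ℤ B₀ -ℤ (b K *ℤ A₀ -ℤ wedge a (wedge b T₁) X)
    ≡⟨ cong (λ z → a K *ℤ B₀ -ℤ (b K *ℤ A₀ -ℤ z)) (wedge-anti a b T₁ X) ⟩
  a K *ℤ B₀ -ℤ (b K *ℤ A₀ -ℤ -ℤ wedge b (wedge a T₁) X)
    ≡⟨ flip-sign (a K) (b K) A₀ B₀ _ ⟩
  -ℤ (b K *ℤ A₀ -ℤ (a K *ℤ B₀ -ℤ wedge b (wedge a T₁) X))
    ≡⟨ cong (λ z → -ℤ (b K *ℤ A₀ -ℤ z)) (sym (split b a)) ⟩
  -ℤ (b K *ℤ A₀ -ℤ wedge b (λ Y → a K *ℤ T₀ Y -ℤ wedge a T₁ Y) X) ∎
  where
  open ≡-Reasoning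
  T₀ = T ∘ (false ∷_)
  T₁ = T ∘ (true ∷_)
  A₀ = wedge a T₀ X
  B₀ = wedge b T₀ X
  split : ∀ a b → wedge a (λ Y → b K *ℤ T₀ Y -ℤ wedge b T₁ Y) X ≡ b K *ℤ wedge a T₀ X -ℤ wedge a (wedge b T₁) X
  split a b = trans
    (wedge-congʳ a (λ Y → cong (b K *ℤ T₀ Y +ℤ_) (sym (ℤₚ.-1*i≡-i (wedge b T₁ Y)))) X)
    (trans (wedge-axpy a (b K) T₀ (λ Y → -1ℤ *ℤ wedge b T₁ Y) X)
      (cong (b K *ℤ wedge a T₀ X +ℤ_) (trans (wedge-* a -1ℤ (wedge b T₁) X) (ℤₚ.-1*i≡-i _))))
  flip-sign : ∀ a b x y z → a *ℤ y -ℤ (b *ℤ x -ℤ -ℤ z) ≡ -ℤ (b *ℤ x -ℤ (a *ℤ y -ℤ z))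
  flip-sign = ℤ-Ring.solve-∀

-- Anticommutativity makes the value its own negative, and ℤ has no 2-torsion.
wedge-square : ∀ {K} a (T : Ext K) X → wedge a (wedge a T) X ≡ 0ℤ
wedge-square a T X = i≡-i⇒i≡0 _ (wedge-anti a a T X)

wedges : ∀ {K} → (ℕ → ℕ → ℤ) → List ℕ → Ext K → Ext K
wedges a []       T = T
wedges a (v ∷ vs) T = wedge (a v) (wedges a vs T)

wedges-congʳ : ∀ {K} a vs {T U : Ext K} → T ≗ U → wedges a vs T ≗ wedges a vs U
wedges-congʳ a []       e = e
wedges-congʳ a (v ∷ vs) e = wedge-congʳ (a v) (wedges-congʳ a vs e)

wedges-* : ∀ {K} a vs x (T : Ext K) X → wedges a vs (λ Y → x *ℤ T Y) X ≡ x *ℤ wedges a vs T X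
wedges-* a []       x T X = refl
wedges-* a (v ∷ vs) x T X = trans (wedge-congʳ (a v) (wedges-* a vs x T) X) (wedge-* (a v) x _ X)

wedges-sum : ∀ {K} a vs n (T : ℕ → Ext K) X →
             wedges a vs (λ Y → sumTo n (λ i → T i Y)) X ≡ sumTo n (λ i → wedges a vs (T i) X)
wedges-sum a []       n T X = refl
wedges-sum a (v ∷ vs) n T X = trans (wedge-congʳ (a v) (wedges-sum a vs n T) X) (wedge-sum (a v) n _ X)

wedges-∷ʳ : ∀ {K} a vs v (T : Ext K) X → wedges a (vs ∷ʳ v) T X ≡ wedges a vs (wedge (a v) T) X
wedges-∷ʳ a []       v T X = refl
wedges-∷ʳ a (u ∷ us) v T X = wedge-congʳ (a u) (wedges-∷ʳ a us v T) X

-- Moving a factor past the others changes at most the sign.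
wedges-past : ∀ {K} a vs c {T : Ext K} → (∀ X → wedges a vs T X ≡ 0ℤ) → ∀ X → wedges a vs (wedge c T) X ≡ 0ℤ
wedges-past a vs c {T} z X = trans (move a vs c T X)
  (trans (cong (sign vs *ℤ_) (wedge-zero c z X)) (ℤₚ.*-zeroʳ (sign vs)))
  where
  sign : List ℕ → ℤ
  sign []       = 1ℤ
  sign (_ ∷ vs) = -1ℤ *ℤ sign vs
  move : ∀ {K} a vs c (T : Ext K) X → wedges a vs (wedge c T) X ≡ sign vs *ℤ wedge c (wedges a vs T) X
  move a []       c T X = sym (ℤₚ.*-identityˡ _)
  move a (v ∷ vs) c T X = begin
    wedge (a v) (wedges a vs (wedge c T)) X                 ≡⟨ wedge-congʳ (a v) (move a vs c T) X ⟩
    wedge (a v) (λ Y → sign vs *ℤ wedge c (wedges a vs T) Y) X ≡⟨ wedge-* (a v) (sign vs) _ X ⟩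
    sign vs *ℤ wedge (a v) (wedge c (wedges a vs T)) X      ≡⟨ cong (sign vs *ℤ_) (wedge-anti (a v) c _ X) ⟩
    sign vs *ℤ -ℤ wedge c (wedge (a v) (wedges a vs T)) X   ≡⟨ regroup (sign vs) _ ⟩
    -1ℤ *ℤ sign vs *ℤ wedge c (wedge (a v) (wedges a vs T)) X ∎
    where
    open ≡-Reasoning
    regroup : ∀ s w → s *ℤ -ℤ w ≡ -1ℤ *ℤ s *ℤ w
    regroup = ℤ-Ring.solve-∀

wedges-repeat : ∀ {K} a {v vs} (T : Ext K) → v ∈ vs → ∀ X → wedge (a v) (wedges a vs T) X ≡ 0ℤ
wedges-repeat a {v} T (here {xs = vs} refl) X = wedge-square (a v) (wedges a vs T) X
wedges-repeat a {v} T (there {x = u} {xs = vs} v∈vs) X = trans (wedge-anti (a v) (a u) _ X)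
  (cong (-ℤ_) (wedge-zero (a u) (wedges-repeat a T v∈vs) X))

wedges-¬Unique : ∀ {K} a vs (T : Ext K) → ¬ Unique vs → ∀ X → wedges a vs T X ≡ 0ℤ
wedges-¬Unique a []       T dup X = contradiction [] dup
wedges-¬Unique a (v ∷ vs) T dup X with v ∈? vs
... | yes v∈vs = wedges-repeat a T v∈vs X
... | no  v∉vs = wedge-zero (a v) (wedges-¬Unique a vs T (λ u → dup (Allₚ.¬Any⇒All¬ vs v∉vs ∷ u))) X

-- Only vanishing matters later, so the sign of the permutation is not computed. It has to be the
-- same for all `X` to be pulled through further factors.
wedges-↭ : ∀ {K} a {us vs} (T : Ext K) → us ↭ vs →
           (∀ X → wedges a us T X ≡ wedges a vs T X) ⊎ (∀ X → wedges a us T X ≡ -ℤ wedges a vs T X)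
wedges-↭ a T Perm.refl       = inj₁ (λ _ → refl)
wedges-↭ a T (prep v p) with wedges-↭ a T p
... | inj₁ e = inj₁ (wedge-congʳ (a v) e)
... | inj₂ e = inj₂ (λ X → trans (wedge-congʳ (a v) (λ Y → trans (e Y) (sym (ℤₚ.-1*i≡-i _))) X)
                       (trans (wedge-* (a v) -1ℤ _ X) (ℤₚ.-1*i≡-i _)))
wedges-↭ a T (swap u v p) with wedges-↭ a T p
... | inj₁ e = inj₂ (λ X → trans (wedge-congʳ (a u) (wedge-congʳ (a v) e) X) (wedge-anti (a u) (a v) _ X))
... | inj₂ e = inj₁ (λ X → trans (wedge-congʳ (a u) (wedge-congʳ (a v) (λ Y → trans (e Y) (sym (ℤₚ.-1*i≡-i _)))) X)
  (trans (wedge-congʳ (a u) (wedge-* (a v) -1ℤ _) X) (trans (wedge-* (a u) -1ℤ _ X)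
    (trans (ℤₚ.-1*i≡-i _) (trans (cong -ℤ_ (wedge-anti (a u) (a v) _ X)) (ℤₚ.neg-involutive _))))))
wedges-↭ a T (Perm.trans p q) with wedges-↭ a T p | wedges-↭ a T q
... | inj₁ e | inj₁ f = inj₁ (λ X → trans (e X) (f X))
... | inj₁ e | inj₂ f = inj₂ (λ X → trans (e X) (f X))
... | inj₂ e | inj₁ f = inj₂ (λ X → trans (e X) (cong -ℤ_ (f X)))
... | inj₂ e | inj₂ f = inj₁ (λ X → trans (e X) (trans (cong -ℤ_ (f X)) (ℤₚ.neg-involutive _)))

weight : ∀ {K} → (ℕ → Bool) → Vec Bool K → ℕ
weight         mark []      = 0
weight {suc K} mark (b ∷ X) = (if b ∧ mark K then 1 else 0) + weight mark X

-- Degree below `θ` in the marked generators. A factor without marked components preserves this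
-- degree bound, and any other factor raises it by at most one.
VanishesFrom : ∀ {K} → (ℕ → Bool) → ℕ → Ext K → Set
VanishesFrom mark θ T = ∀ X → θ ≤ weight mark X → T X ≡ 0ℤ

≤-suc-pred : ∀ m → m ≤ suc (ℕ.pred m)
≤-suc-pred zero    = z≤n
≤-suc-pred (suc m) = ≤-refl

wedge-vanishes : ∀ {K} mark θ {a} {T : Ext K} → (∀ p → p < K → mark p ≡ true → a p ≡ 0ℤ) →
                 VanishesFrom mark θ T → VanishesFrom mark θ (wedge a T)
wedge-vanishes mark θ z van [] θ≤ = refl
wedge-vanishes {suc K} mark θ z van (false ∷ X) θ≤ =
  wedge-vanishes mark θ (λ p p<K → z p (m<n⇒m<1+n p<K)) (λ Y → van (false ∷ Y)) X θ≤
wedge-vanishes {suc K} mark θ {a} {T} z van (true ∷ X) θ≤ with mark K in eq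
... | true = cong₂ (λ s t → s *ℤ T (false ∷ X) -ℤ t) (z K (n<1+n K) eq)
  -- The marked head accounts for one of the `θ` generators; `pred` also covers `θ = 0`.
  (wedge-vanishes mark (ℕ.pred θ) (λ p p<K → z p (m<n⇒m<1+n p<K))
    (λ Y h → van (true ∷ Y) (subst (λ b → θ ≤ (if b then 1 else 0) + weight mark Y) (sym eq)
      (≤-trans (≤-suc-pred θ) (s≤s h)))) X (ℕₚ.pred-mono-≤ θ≤))
... | false = cong₂ _-ℤ_ (trans (cong (a K *ℤ_) (van (false ∷ X) θ≤)) (ℤₚ.*-zeroʳ (a K)))
  (wedge-vanishes mark θ (λ p p<K → z p (m<n⇒m<1+n p<K))
    (λ Y h → van (true ∷ Y) (subst (λ b → θ ≤ (if b then 1 else 0) + weight mark Y) (sym eq) h)) X θ≤)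

wedge-vanishes-suc : ∀ {K} mark θ {a} {T : Ext K} →
                     VanishesFrom mark θ T → VanishesFrom mark (suc θ) (wedge a T)
wedge-vanishes-suc mark zero    {a} van X _ = wedge-zero a (λ Y → van Y z≤n) X
wedge-vanishes-suc mark (suc θ) van [] θ≤ = refl
wedge-vanishes-suc {suc K} mark (suc θ) van (false ∷ X) θ≤ =
  wedge-vanishes-suc mark (suc θ) (λ Y → van (false ∷ Y)) X θ≤
wedge-vanishes-suc {suc K} mark (suc θ) {a} {T} van (true ∷ X) θ≤ with mark K in eq
... | true = cong₂ _-ℤ_ (trans (cong (a K *ℤ_) (van (false ∷ X) (≤-pred θ≤))) (ℤₚ.*-zeroʳ (a K)))
  (wedge-vanishes-suc mark θ (λ Y h → van (true ∷ Y)
    (subst (λ b → suc θ ≤ (if b then 1 else 0) + weight mark Y) (sym eq) (s≤s h))) X (≤-pred θ≤))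
... | false = cong₂ _-ℤ_ (trans (cong (a K *ℤ_) (van (false ∷ X) (≤-trans (ℕₚ.n≤1+n _) θ≤))) (ℤₚ.*-zeroʳ (a K)))
  (wedge-vanishes-suc mark (suc θ) (λ Y h → van (true ∷ Y)
    (subst (λ b → suc θ ≤ (if b then 1 else 0) + weight mark Y) (sym eq) h)) X θ≤)

monomial : ∀ K → (ℕ → Bool) → Vec Bool K
monomial zero    f = []
monomial (suc K) f = f K ∷ monomial K f

monomial-cong : ∀ K {f g} → (∀ p → p < K → f p ≡ g p) → monomial K f ≡ monomial K g
monomial-cong zero    e = refl
monomial-cong (suc K) e = cong₂ _∷_ (e K (n<1+n K)) (monomial-cong K (λ p p<K → e p (m<n⇒m<1+n p<K)))

basis : ℕ → ℕ → ℤ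
basis q p = bit (p ≡ᵇ q)

without : ℕ → (ℕ → Bool) → ℕ → Bool
without q f p = f p ∧ not (p ≡ᵇ q)

≡ᵇ-refl : ∀ p → (p ≡ᵇ p) ≡ true
≡ᵇ-refl p = dec-true (p ℕ.≟ p) refl

≢⇒≡ᵇ : ∀ {p q} → p ≢ q → (p ≡ᵇ q) ≡ false
≢⇒≡ᵇ {p} {q} = dec-false (p ℕ.≟ q)

-- The coefficient is that of `T` at the monomial without `q`, up to one sign change for each
-- generator of the monomial above `q`. Speaking of nonvanishing leaves the sign aside.
wedge-basis : ∀ K q f {T : Ext K} → q < K → f q ≡ true →
              T (monomial K (without q f)) ≢ 0ℤ → wedge (basis q) T (monomial K f) ≢ 0ℤ
wedge-basis (suc K) q f {T} q<1+K fq nz with q ℕ.≟ K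
... | yes refl rewrite fq | ≡ᵇ-refl q
  | wedge-zeroˡ (T ∘ (true ∷_)) (λ p p<K → cong bit (≢⇒≡ᵇ (<⇒≢ p<K))) (monomial q f)
  = λ eq → nz (trans (cong (λ m → T (false ∷ m)) (monomial-cong q (λ p p<q →
      trans (cong (λ b → f p ∧ not b) (≢⇒≡ᵇ (<⇒≢ p<q))) (Boolₚ.∧-identityʳ (f p)))))
      (trans (sym (trans (ℤₚ.+-identityʳ _) (ℤₚ.*-identityˡ _))) eq))
... | no q≢K with f K
... | false = wedge-basis K q f {T ∘ (false ∷_)} q<K fq nz
  where q<K = ℕₚ.≤∧≢⇒< (≤-pred q<1+K) q≢K
... | true  = λ eq → wedge-basis K q f {T ∘ (true ∷_)} q<K fq
    (subst (λ b → T (not b ∷ monomial K (without q f)) ≢ 0ℤ) K≢q nz)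
    (cancel (cong bit K≢q) eq)
  where
  q<K = ℕₚ.≤∧≢⇒< (≤-pred q<1+K) q≢K
  K≢q = ≢⇒≡ᵇ (q≢K ∘ sym)
  cancel : ∀ {b t w} → b ≡ 0ℤ → b *ℤ t -ℤ w ≡ 0ℤ → w ≡ 0ℤ
  cancel refl eq = ℤₚ.neg-injective (trans (sym (ℤₚ.+-identityˡ _)) eq)

-- The walk polynomial: soundness

lookup-injective : ∀ {A : Set} {xs : List A} → Unique xs → ∀ i j → lookup xs i ≡ lookup xs j → i ≡ j
lookup-injective (_ ∷ _)  Fin.zero    Fin.zero    _  = refl
lookup-injective (x∉ ∷ _) Fin.zero    (Fin.suc j) eq = contradiction eq (All.lookup x∉ (∈-lookup j))
lookup-injective (x∉ ∷ _) (Fin.suc i) Fin.zero    eq = contradiction (sym eq) (All.lookup x∉ (∈-lookup i))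
lookup-injective (_ ∷ u)  (Fin.suc i) (Fin.suc j) eq = cong Fin.suc (lookup-injective u i j eq)

-- Pigeonhole principle: the entries define an injection from positions into `Fin J`.
Unique-length : ∀ {J js} → Unique js → All (_< J) js → length js ≤ J
Unique-length {J} {js} u js<J = Finₚ.injective⇒≤ {f = f} (λ {i} {j} eq →
  lookup-injective u i j (trans (sym (Finₚ.toℕ-fromℕ< (All.lookup js<J (∈-lookup i))))
    (trans (cong toℕ eq) (Finₚ.toℕ-fromℕ< (All.lookup js<J (∈-lookup j))))))
  where
  f : Fin (length js) → Fin J
  f i = fromℕ< (All.lookup js<J (∈-lookup i))

≤ᵇ-true : ∀ {m n} → m ≤ n → (m ≤ᵇ n) ≡ true
≤ᵇ-true {m} {n} m≤n = dec-true (m ℕ.≤? n) m≤n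

≤ᵇ-false : ∀ {m n} → n < m → (m ≤ᵇ n) ≡ false
≤ᵇ-false {m} {n} n<m = dec-false (m ℕ.≤? n) (ℕₚ.<⇒≱ n<m)

<ᵇ-true : ∀ {m n} → m < n → (m <ᵇ n) ≡ true
<ᵇ-true {zero}  (s≤s _)   = refl
<ᵇ-true {suc m} (s≤s m<n) = <ᵇ-true m<n

<ᵇ-false : ∀ {m n} → n ≤ m → (m <ᵇ n) ≡ false
<ᵇ-false {n = zero}  _         = refl
<ᵇ-false {suc m} {suc n} (s≤s n≤m) = <ᵇ-false n≤m

≤ᵇ⁻ : ∀ {m n} → (m ≤ᵇ n) ≡ true → m ≤ n
≤ᵇ⁻ {m} {n} e = ℕₚ.≤ᵇ⇒≤ m n (subst T (sym e) tt)

<ᵇ⁻ : ∀ {m n} → (m <ᵇ n) ≡ true → m < n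
<ᵇ⁻ {m} {n} e = ℕₚ.<ᵇ⇒< m n (subst T (sym e) tt)

≡ᵇ⁻ : ∀ {m n} → (m ≡ᵇ n) ≡ true → m ≡ n
≡ᵇ⁻ {m} {n} e = ℕₚ.≡ᵇ⇒≡ m n (subst T (sym e) tt)

∧-split : ∀ {a b} → a ∧ b ≡ true → a ≡ true × b ≡ true
∧-split {true} {true} _ = refl , refl

weight-interval : ∀ K mark f lo d → lo + d ≤ K → (∀ p → lo ≤ p → p < lo + d → f p ∧ mark p ≡ true) →
                  d ≤ weight mark (monomial K f)
weight-interval zero    mark f lo d h e = subst (d ≤_) (ℕₚ.n≤0⇒n≡0 h) (m≤n+m d lo)
weight-interval (suc K) mark f lo zero h e = z≤n
weight-interval (suc K) mark f lo (suc d) h e with lo + suc d ℕ.≤? K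
... | yes h′ = ≤-trans (weight-interval K mark f lo (suc d) h′ e) (m≤n+m _ _)
... | no ¬h′ = subst (λ x → suc d ≤ (if x then 1 else 0) + weight mark (monomial K f)) (sym (e K lo≤K K<)) (s≤s (weight-interval K mark f lo d lo+d≤K
  (λ p lo≤p p< → e p lo≤p (ℕₚ.<-trans p< (ℕₚ.+-monoʳ-< lo (n<1+n d))))))
  where
  lo+d≤K = ≤-pred (subst (_≤ suc K) (+-suc lo d) h)
  lo≤K = ≤-trans (m≤m+n lo d) lo+d≤K
  K< = ℕₚ.≰⇒> ¬h′

one-vanishes : ∀ {K} mark → VanishesFrom {K} mark 1 one
one-vanishes mark (false ∷ X) h = one-vanishes mark X h
one-vanishes mark (true ∷ X)  h = refl

module Sieve (n c K s : ℕ) (ent : ℕ → ℕ → ℕ) (chi need cap : ℕ → ℕ) where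

  pre : ℕ → ℕ
  pre zero    = 0
  pre (suc i) = pre i + need i

  pre-mono : ∀ {i j} → i ≤ j → pre i ≤ pre j
  pre-mono {i} {j} i≤j with ℕₚ.≤⇒≤′ i≤j
  ... | ℕ.≤′-refl = ≤-refl
  ... | ℕ.≤′-step h = ≤-trans (pre-mono (ℕₚ.≤′⇒≤ h)) (m≤m+n _ _)

  reserved : ℕ → ℕ → Bool
  reserved i p = (pre i ≤ᵇ p) ∧ (p <ᵇ pre (suc i))

  allowed : ℕ → ℕ → Bool
  allowed i p = (pre c ≤ᵇ p) ∨ reserved i p

  Wd : ℕ
  Wd = K + n + c

  -- The number of a random variable: tags 0, 1, 2 are for y, g and b.
  key : ℕ → ℕ → ℕ → ℕ → ℕ
  key tag p q r = ((tag * Wd + p) * Wd + q) * Wd + r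

  -- The walk read backwards, as the dynamic programming extends it at its end. The condition
  -- `0 < ent u v` excludes missing arcs, which the input marks by 0.
  data Route : ℕ → List ℕ → Set where
    start  : Route 0 (s ∷ [])
    extend : ∀ {L u us v} → Route L (u ∷ us) → u < n → v < n → 0 < ent u v →
             Route (L + ent u v) (v ∷ u ∷ us)

  count : ℕ → List ℕ → ℕ
  count i []       = 0
  count i (v ∷ vs) = (if chi v ≡ᵇ i then 1 else 0) + count i vs

  Fair : List ℕ → Set
  Fair vs = ∀ i → i < c → need i ≤ count i vs × count i vs ≤ cap i

  module Weighted (z : ℕ → ℤ) where

    y : ℕ → ℕ → ℤ
    y k v = z (key 0 k v 0)

    g : ℕ → ℕ → ℤ
    g v j = if j <ᵇ cap (chi v) then z (key 1 v j 0) else 0ℤ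

    b : ℕ → ℕ → ℕ → ℤ
    b i j p = if allowed i p then z (key 2 i j p) else 0ℤ

    a : ℕ → ℕ → ℤ
    a v p = sumTo K (λ j → g v j *ℤ b (chi v) j p)

    -- F k L v: the walks with k arcs and length L from s to v; S k L v: the
    -- same before the factor of v is multiplied in.
    mutual
      F : ℕ → ℕ → ℕ → Ext K
      F k L v X = y k v *ℤ wedge (a v) (S k L v) X

      S : ℕ → ℕ → ℕ → Ext K
      S zero    L v X = if (L ≡ᵇ 0) ∧ (v ≡ᵇ s) then one X else 0ℤ
      S (suc k) L v X = sumTo n (λ u → if (0 <ᵇ ent u v) ∧ (ent u v ≤ᵇ L) then F k (L ∸ ent u v) u X else 0ℤ)

    wedge-a : ∀ v (T : Ext K) X → wedge (a v) T X ≡ sumTo K (λ j → g v j *ℤ wedge (b (chi v) j) T X)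
    wedge-a v = wedge-sumˡ K (g v) (b (chi v))

    -- By linearity `F` is a sum over walks, and it vanishes when each walk contributes zero. The
    -- list `us` holds the vertices already split off from the end: their factors must stay in
    -- place, since the product along a walk may vanish only as a whole.
    F-zero : ∀ k L v us X → v < n →
      (∀ vs → Route L (v ∷ vs) → length vs ≡ k → wedges a us (wedges a (v ∷ vs) one) X ≡ 0ℤ) →
      wedges a us (F k L v) X ≡ 0ℤ
    F-zero k L v us X v<n h = trans (wedges-* a us (y k v) _ X)
      (trans (cong (y k v *ℤ_) (prefix k L h)) (ℤₚ.*-zeroʳ (y k v)))
      where
      vanish : ∀ us {T : Ext K} → (∀ Y → T Y ≡ 0ℤ) → wedges a us T X ≡ 0ℤ
      -- The zero tensor is treated as an empty sum.
      vanish us z = trans (wedges-congʳ a us z X) (wedges-sum a us 0 (λ _ _ → 0ℤ) X)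

      prefix : ∀ k L → (∀ vs → Route L (v ∷ vs) → length vs ≡ k → wedges a us (wedges a (v ∷ vs) one) X ≡ 0ℤ) →
               wedges a us (wedge (a v) (S k L v)) X ≡ 0ℤ
      prefix zero L h with (L ≡ᵇ 0) ∧ (v ≡ᵇ s) in eq
      ... | true  = h [] (subst (λ m → Route m (v ∷ [])) (sym (≡ᵇ⁻ {L} {0} (proj₁ (∧-split eq))))
        (subst (λ u → Route 0 (u ∷ [])) (sym (≡ᵇ⁻ {v} {s} (proj₂ (∧-split {L ≡ᵇ 0} eq)))) start)) refl
      ... | false = vanish us (wedge-zero (a v) (λ _ → refl))
      prefix (suc k) L h = trans (sym (wedges-∷ʳ a us v _ X))
        (trans (wedges-sum a (us ∷ʳ v) n _ X) (sumTo-zero n step′))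
        where
        step′ : ∀ u → u < n → wedges a (us ∷ʳ v)
          (λ Y → if (0 <ᵇ ent u v) ∧ (ent u v ≤ᵇ L) then F k (L ∸ ent u v) u Y else 0ℤ) X ≡ 0ℤ
        step′ u u<n with (0 <ᵇ ent u v) ∧ (ent u v ≤ᵇ L) in eq
        ... | false = vanish (us ∷ʳ v) (λ _ → refl)
        ... | true  = F-zero k (L ∸ ent u v) u (us ∷ʳ v) X u<n (λ vs r len →
          trans (wedges-∷ʳ a us v _ X) (h (u ∷ vs)
            (subst (λ m → Route m (v ∷ u ∷ vs)) (ℕₚ.m∸n+n≡m (≤ᵇ⁻ {ent u v} {L} (proj₂ (∧-split {0 <ᵇ ent u v} eq))))
              (extend r u<n v<n (<ᵇ⁻ (proj₁ (∧-split {0 <ᵇ ent u v} eq))))) (cong suc len)))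

    -- Each factor of color i is a combination of the vectors  b i j  with
    -- j < cap i, so more than  cap i  of them are linearly dependent.
    wedges-over : ∀ i vs js → All (_< cap i) js → cap i < length js + count i vs →
                  ∀ (X : Vec Bool K) → wedges (b i) js (wedges a vs one) X ≡ 0ℤ
    -- All factors of color `i` are expanded now, and more than `cap i` indices below `cap i`
    -- contain a repetition.
    wedges-over i [] js js< over = wedges-¬Unique (b i) js one
      (λ u → ℕₚ.<⇒≱ over (≤-trans (≤-reflexive (+-identityʳ _)) (Unique-length u js<)))
    wedges-over i (v ∷ vs) js js< over X with chi v ℕ.≟ i
    ... | no  chi≢ = wedges-past (b i) js (a v) (wedges-over i vs js js<
      (subst (λ d → cap i < length js + ((if d then 1 else 0) + count i vs)) (≢⇒≡ᵇ chi≢) over)) X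
    ... | yes refl = trans (wedges-congʳ (b i) js (wedge-a v (wedges a vs one)) X)
      (trans (wedges-sum (b i) js K _ X) (sumTo-zero K term))
      where
      over′ : ∀ j → cap i < length (js ∷ʳ j) + count i vs
      over′ j = subst (cap i <_) (trans (+-suc (length js) _)
        (cong (_+ count i vs) (sym (trans (Listₚ.length-++ js) (+-comm (length js) 1)))))
        (subst (λ d → cap i < length js + ((if d then 1 else 0) + count i vs)) (≡ᵇ-refl i) over)
      term : ∀ j → j < K → wedges (b i) js (λ Y → g v j *ℤ wedge (b i j) (wedges a vs one) Y) X ≡ 0ℤ
      term j _ = trans (wedges-* (b i) js (g v j) _ X) zero-product
        where
        zero-product : g v j *ℤ wedges (b i) js (wedge (b i j) (wedges a vs one)) X ≡ 0ℤ
        zero-product with j <ᵇ cap i in eq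
        ... | false = refl
        ... | true  = trans (cong (z (key 1 v j 0) *ℤ_) (trans (sym (wedges-∷ʳ (b i) js j _ X))
          (wedges-over i vs (js ∷ʳ j) (Allₚ.∷ʳ⁺ js< (<ᵇ⁻ eq)) (over′ j) X)))
          (ℤₚ.*-zeroʳ (z (key 1 v j 0)))

    -- Monotonicity of `pre` makes the blocks of different colors disjoint and puts all of them
    -- below `pre c`, where the open generators begin.
    a-reserved : ∀ {i v p} → i < c → chi v ≢ i → reserved i p ≡ true → a v p ≡ 0ℤ
    a-reserved {i} {v} {p} i<c chi≢i res = sumTo-zero K (λ j _ →
      trans (cong (λ d → g v j *ℤ (if d then z (key 2 (chi v) j p) else 0ℤ)) forbidden) (ℤₚ.*-zeroʳ (g v j)))
      where
      lo = ≤ᵇ⁻ {pre i} (proj₁ (∧-split {pre i ≤ᵇ p} res))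
      hi = <ᵇ⁻ {p} (proj₂ (∧-split {pre i ≤ᵇ p} res))
      forbidden : allowed (chi v) p ≡ false
      forbidden rewrite ≤ᵇ-false {pre c} {p} (<-≤-trans hi (pre-mono i<c)) with ℕₚ.<-cmp (chi v) i
      ... | tri≈ _ eq _ = contradiction eq chi≢i
      ... | tri> _ _ i<chi
        rewrite ≤ᵇ-false {pre (chi v)} {p} (<-≤-trans hi (pre-mono i<chi)) = refl
      ... | tri< chi<i _ _
        rewrite <ᵇ-false {p} {pre (suc (chi v))} (≤-trans (pre-mono chi<i) lo) = Boolₚ.∧-zeroʳ _

    -- A vertex of color `i` supplies at most one generator reserved for `i`, and a vertex of
    -- another color supplies none.
    wedges-under : ∀ i vs → i < c → VanishesFrom {K} (reserved i) (suc (count i vs)) (wedges a vs one)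
    wedges-under i []       i<c = one-vanishes (reserved i)
    wedges-under i (v ∷ vs) i<c with chi v ℕ.≟ i
    ... | yes refl rewrite ≡ᵇ-refl (chi v) = wedge-vanishes-suc (reserved i) _ (wedges-under i vs i<c)
    ... | no chi≢i rewrite ≢⇒≡ᵇ chi≢i =
      wedge-vanishes (reserved i) _ (λ p _ → a-reserved {v = v} {p} i<c chi≢i) (wedges-under i vs i<c)

    -- If every walk had a defect, each term of the sum would vanish. The double negation avoids
    -- searching for the walk behind a nonzero term; it suffices because the result is only set
    -- against the absence of a feasible path. The condition on `pre c` puts all reserved generators
    -- into the monomial, so that a missing one is noticed.
    sound : ∀ k L v → v < n → suc k ≤ K → pre c ≤ suc k →
            F k L v (monomial K (_<ᵇ suc k)) ≢ 0ℤ →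
            ¬ ¬ (∃[ vs ] (Route L (v ∷ vs) × Unique (v ∷ vs) × Fair (v ∷ vs)))
    sound k L v v<n k<K pre≤ nz none = nz (F-zero k L v [] X v<n (λ vs r _ → decidable-stable (_ ℤ.≟ 0ℤ)
      (λ w≢0 → none (vs , r
        , decidable-stable (unique? (v ∷ vs)) (λ ¬u → w≢0 (wedges-¬Unique a (v ∷ vs) one ¬u X))
        , λ i i<c →
            ≮⇒≥ (λ under → w≢0 (wedges-under i (v ∷ vs) i<c X
              (≤-trans under (weight-interval K (reserved i) (_<ᵇ suc k) (pre i) (need i)
                (≤-trans (pre-mono i<c) (≤-trans pre≤ k<K))
                (λ p lo hi → cong₂ _∧_ (<ᵇ-true (<-≤-trans hi (≤-trans (pre-mono i<c) pre≤)))
                  (cong₂ _∧_ (≤ᵇ-true lo) (<ᵇ-true hi)))))))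
          , ≮⇒≥ (λ over → w≢0 (wedges-over i (v ∷ vs) [] [] over X))))))
      where
      X = monomial K (_<ᵇ suc k)

-- The walk polynomial: completeness

wedges-cong : ∀ {K} a a′ vs (T : Ext K) → All (λ v → ∀ p → p < K → a v p ≡ a′ v p) vs → wedges a vs T ≗ wedges a′ vs T
wedges-cong a a′ []       T []       X = refl
wedges-cong a a′ (v ∷ vs) T (e ∷ es) = wedge-cong e (wedges-cong a a′ vs T es)

one-empty : ∀ K f → (∀ p → p < K → f p ≡ false) → one (monomial K f) ≡ 1ℤ
one-empty zero    f e = refl
one-empty (suc K) f e rewrite e K (n<1+n K) = one-empty K f (λ p p<K → e p (m<n⇒m<1+n p<K))

Numbered : (ℕ → ℕ) → ℕ → List ℕ → Set
Numbered ι p []       = ⊤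
Numbered ι p (v ∷ vs) = ι v ≡ p × Numbered ι (suc p) vs

-- Every factor removes the lowest generator of an interval, and `wedge-basis` passes nonvanishing
-- on until only the empty monomial is left.
wedges-basis : ∀ {K} ι p vs f → Numbered ι p vs → p + length vs ≤ K →
               (∀ q → q < K → f q ≡ (p ≤ᵇ q) ∧ (q <ᵇ p + length vs)) →
               wedges (basis ∘ ι) vs one (monomial K f) ≢ 0ℤ
wedges-basis {K} ι p [] f _ _ fe eq with trans (sym eq) (one-empty K f empty)
  where
  empty : ∀ q → q < K → f q ≡ false
  empty q q<K rewrite fe q q<K | +-identityʳ p with p ℕ.≤? q
  ... | yes p≤q rewrite <ᵇ-false p≤q | ≤ᵇ-true p≤q = refl
  ... | no  p≰q rewrite ≤ᵇ-false (ℕₚ.≰⇒> p≰q) = refl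
... | ()
wedges-basis {K} ι p (v ∷ vs) f (refl , num) len fe = wedge-basis K (ι v) f p<K
  (trans (fe p p<K) (cong₂ _∧_ (≤ᵇ-true (≤-refl {p})) (<ᵇ-true p<)))
  (wedges-basis ι (suc (ι v)) vs _ num (subst (_≤ K) (+-suc (ι v) _) len) rest)
  where
  p< = m<m+n p {suc (length vs)} (s≤s z≤n)
  p<K = <-≤-trans p< len
  rest : ∀ q → q < K → without (ι v) f q ≡ (suc (ι v) ≤ᵇ q) ∧ (q <ᵇ suc (ι v) + length vs)
  rest q q<K rewrite fe q q<K | +-suc (ι v) (length vs) with ℕₚ.<-cmp q (ι v)
  ... | tri< q<p _ _ rewrite ≤ᵇ-false q<p | ≤ᵇ-false (m<n⇒m<1+n q<p) = refl
  ... | tri≈ _ refl _ rewrite ≡ᵇ-refl q | ≤ᵇ-false (n<1+n q) = Boolₚ.∧-zeroʳ _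
  ... | tri> _ q≢p p<q rewrite ≤ᵇ-true (<⇒≤ p<q) | ≤ᵇ-true p<q | ≢⇒≡ᵇ q≢p = Boolₚ.∧-identityʳ _

index : List ℕ → ℕ → ℕ
index []       v = 0
index (u ∷ us) v = if u ≡ᵇ v then 0 else suc (index us v)

Numbered-cong : ∀ {ι ι′} p vs → All (λ v → ι v ≡ ι′ v) vs → Numbered ι p vs → Numbered ι′ p vs
Numbered-cong p []       []       _       = tt
Numbered-cong p (v ∷ vs) (e ∷ es) (h , t) = trans (sym e) h , Numbered-cong (suc p) vs es t

Numbered-index : ∀ p vs → Unique vs → Numbered (λ v → p + index vs v) p vs
Numbered-index p []       _        = tt
Numbered-index p (v ∷ vs) (v∉ ∷ u) rewrite ≡ᵇ-refl v = +-identityʳ p ,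
  Numbered-cong (suc p) vs (All.map (λ {w} v≢w → trans (sym (+-suc p _))
    (cong (λ d → p + (if d then 0 else suc (index vs w))) (sym (≢⇒≡ᵇ v≢w)))) v∉)
  (Numbered-index (suc p) vs u)

module _ (W : ℕ) {{_ : NonZero W}} where

  quotient : ∀ x {r} → r < W → (x * W + r) DivMod./ W ≡ x
  quotient x {r} r<W = trans (DivMod.+-distrib-/-∣ˡ r (Div.divides x refl))
    (trans (cong₂ _+_ (DivMod.m*n/n≡m x W) (DivMod.m<n⇒m/n≡0 r<W)) (+-identityʳ x))

  remainder : ∀ x {r} → r < W → (x * W + r) % W ≡ r
  remainder x {r} r<W = trans (cong (_% W) (+-comm (x * W) r))
    (trans (DivMod.[m+kn]%n≡m%n r x W) (DivMod.m<n⇒m%n≡m r<W))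

module Witness (n c K s : ℕ) (ent : ℕ → ℕ → ℕ) (chi need cap : ℕ → ℕ)
  (chi<c : ∀ {v} → v < n → chi v < c) {{W≢0 : NonZero (K + n + c)}}
  (rs : List ℕ) (rs<n : All (_< n) rs) (uniq : Unique rs) (len≤K : length rs ≤ K)
  (fair : Sieve.Fair n c K s ent chi need cap rs) where

  open Sieve n c K s ent chi need cap

  -- The last component says that taking vertices of color `i` leaves enough of the later colors.
  extract : ∀ i q R → q ≤ count i R → ∃[ D ] ∃[ R′ ]
    (R ↭ D ++ R′ × length D ≡ q × All (λ v → chi v ≡ i) D × (∀ i′ → i < i′ → count i′ R′ ≡ count i′ R))
  extract i zero R h = [] , R , ↭-refl , refl , [] , λ _ _ → refl
  extract i (suc q) (v ∷ R) h with chi v ℕ.≟ i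
  ... | yes refl rewrite ≡ᵇ-refl (chi v) with extract i q R (≤-pred h)
  ...   | D , R′ , p , len , all , eq = v ∷ D , R′ , prep v p , cong suc len , refl ∷ all ,
    λ i′ i<i′ → trans (eq i′ i<i′)
      (cong (λ d → (if d then 1 else 0) + count i′ R) (sym (≢⇒≡ᵇ (<⇒≢ i<i′))))
  extract i (suc q) (v ∷ R) h | no chi≢ rewrite ≢⇒≡ᵇ chi≢ with extract i (suc q) R h
  ...   | D , R′ , p , len , all , eq = D , v ∷ R′ , ↭-trans (prep v p) (↭-sym (Permₚ.shift v D R′)) , len , all ,
    λ i′ i<i′ → cong (λ m → (if chi v ≡ᵇ i′ then 1 else 0) + m) (eq i′ i<i′)

  Placed : ℕ → List ℕ → Set
  Placed p []       = ⊤
  Placed p (v ∷ vs) = allowed (chi v) p ≡ true × Placed (suc p) vs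

  Placed-++ : ∀ p us {vs} → Placed p us → Placed (p + length us) vs → Placed p (us ++ vs)
  Placed-++ p []       {vs} _       h′ = subst (λ q → Placed q vs) (+-identityʳ p) h′
  Placed-++ p (u ∷ us) {vs} (a , h) h′ = a , Placed-++ (suc p) us h (subst (λ q → Placed q vs) (+-suc p _) h′)

  Placed-reserved : ∀ i p D → All (λ v → chi v ≡ i) D → pre i ≤ p → p + length D ≤ pre (suc i) → Placed p D
  Placed-reserved i p []      _            lo hi = tt
  Placed-reserved i p (v ∷ D) (refl ∷ all) lo hi =
      trans (cong ((pre c ≤ᵇ p) ∨_) (cong₂ _∧_ (≤ᵇ-true lo)
        (<ᵇ-true (<-≤-trans (m<m+n p {suc (length D)} (s≤s z≤n)) hi)))) (Boolₚ.∨-zeroʳ _)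
    , Placed-reserved i (suc p) D all (ℕₚ.m≤n⇒m≤1+n lo) (subst (_≤ pre (suc i)) (+-suc p _) hi)

  Placed-free : ∀ p R → pre c ≤ p → Placed p R
  Placed-free p []      h = tt
  Placed-free p (v ∷ R) h = cong (_∨ reserved (chi v) p) (≤ᵇ-true h) , Placed-free (suc p) R (ℕₚ.m≤n⇒m≤1+n h)

  -- The reserved blocks are filled color by color, each exactly, so that the position in `E` is the
  -- number of the generator. What is left over at the end goes to the open generators.
  arrange : ∀ i → i ≤ c → ∃[ E ] ∃[ R ]
    (rs ↭ E ++ R × length E ≡ pre i × Placed 0 E × (∀ i′ → i ≤ i′ → count i′ R ≡ count i′ rs))
  arrange zero    _     = [] , rs , ↭-refl , refl , tt , λ _ _ → refl
  arrange (suc i) i<c with arrange i (<⇒≤ i<c)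
  ... | E , R , p , len , placed , eq
    with extract i (need i) R (subst (need i ≤_) (sym (eq i ≤-refl)) (proj₁ (fair i i<c)))
  ... | D , R′ , p′ , len′ , all , eq′ = E ++ D , R′
    , ↭-trans p (↭-trans (Permₚ.++⁺ˡ E p′) (Perm.↭-reflexive (sym (Listₚ.++-assoc E D R′))))
    , trans (Listₚ.length-++ E) (cong₂ _+_ len len′)
    , Placed-++ 0 E placed (Placed-reserved i (length E) D all (≤-reflexive (sym len))
        (≤-reflexive (cong₂ _+_ len len′)))
    , λ i′ i<i′ → trans (eq′ i′ i<i′) (eq i′ (<⇒≤ i<i′))

  private
    front back full : List ℕ
    front = proj₁ (arrange c ≤-refl)
    back  = proj₁ (proj₂ (arrange c ≤-refl))
    full  = front ++ back

    rs↭full : rs ↭ full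
    rs↭full = proj₁ (proj₂ (proj₂ (arrange c ≤-refl)))

    length-front : length front ≡ pre c
    length-front = proj₁ (proj₂ (proj₂ (proj₂ (arrange c ≤-refl))))

    full-unique : Unique full
    full-unique = PermSₚ.Unique-resp-↭ (Perm.↭⇒↭ₛ rs↭full) uniq

    full-placed : Placed 0 full
    full-placed = Placed-++ 0 front (proj₁ (proj₂ (proj₂ (proj₂ (proj₂ (arrange c ≤-refl))))))
      (Placed-free (length front) back (≤-reflexive (sym length-front)))

    full-length : length full ≡ length rs
    full-length = sym (Permₚ.↭-length rs↭full)

  pre≤length : pre c ≤ length rs
  pre≤length = subst (pre c ≤_) (trans (sym (Listₚ.length-++ front)) full-length)
    (≤-trans (≤-reflexive (sym length-front)) (m≤m+n _ _))

  placed-index : ∀ p vs → Placed p vs → ∀ {v} → v ∈ vs → allowed (chi v) (p + index vs v) ≡ true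
  placed-index p (u ∷ us) (a , h) {v} v∈ with u ℕ.≟ v
  ... | yes refl rewrite ≡ᵇ-refl u | +-identityʳ p = a
  placed-index p (u ∷ us) (a , h) (here refl) | no u≢v = contradiction refl u≢v
  placed-index p (u ∷ us) (a , h) {v} (there v∈) | no u≢v rewrite ≢⇒≡ᵇ u≢v | +-suc p (index us v) =
    placed-index (suc p) us h v∈

  stepAt : List ℕ → ℕ → ℕ → Bool
  stepAt []       k v = false
  stepAt (u ∷ us) k v = if k ≡ᵇ length us then v ≡ᵇ u else stepAt us k v

  -- The rank of a vertex among the walk vertices of its color. It chooses the vector `b(i , j)`
  -- that the vertex gets, and its being below the color count, hence below `cap i`, is where the
  -- upper bounds enter. `holder` is its inverse.
  slot : List ℕ → ℕ → ℕ
  slot []       v = 0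
  slot (u ∷ us) v = if u ≡ᵇ v then count (chi u) us else slot us v

  holder : List ℕ → ℕ → ℕ → ℕ
  holder []       i j = 0
  holder (u ∷ us) i j = if (chi u ≡ᵇ i) ∧ (count (chi u) us ≡ᵇ j) then u else holder us i j

  slot<count : ∀ {v} vs → v ∈ vs → slot vs v < count (chi v) vs
  slot<count {v} (u ∷ us) v∈ with u ℕ.≟ v
  ... | yes refl rewrite ≡ᵇ-refl u | ≡ᵇ-refl (chi u) = ≤-refl
  slot<count {v} (u ∷ us) (here refl) | no u≢v = contradiction refl u≢v
  slot<count {v} (u ∷ us) (there v∈)  | no u≢v rewrite ≢⇒≡ᵇ u≢v = <-≤-trans (slot<count us v∈) (m≤n+m _ _)

  holder-slot : ∀ {v} vs → v ∈ vs → holder vs (chi v) (slot vs v) ≡ v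
  holder-slot {v} (u ∷ us) v∈ with u ℕ.≟ v
  ... | yes refl rewrite ≡ᵇ-refl u | ≡ᵇ-refl (chi u) | ≡ᵇ-refl (count (chi u) us) = refl
  holder-slot {v} (u ∷ us) (here refl) | no u≢v = contradiction refl u≢v
  holder-slot {v} (u ∷ us) (there v∈)  | no u≢v rewrite ≢⇒≡ᵇ u≢v with chi u ℕ.≟ chi v
  ... | no  chi≢ rewrite ≢⇒≡ᵇ chi≢ = holder-slot us v∈
  ... | yes chi≡ rewrite chi≡ | ≡ᵇ-refl (chi v) | ≢⇒≡ᵇ (ℕₚ.>⇒≢ (slot<count us v∈)) = holder-slot us v∈

  count≤length : ∀ i vs → count i vs ≤ length vs
  count≤length i []       = z≤n
  count≤length i (v ∷ vs) with chi v ≡ᵇ i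
  ... | true  = s≤s (count≤length i vs)
  ... | false = ℕₚ.m≤n⇒m≤1+n (count≤length i vs)

  -- By tag: `y` singles out the vertex at each step of the walk, `g` makes `a(v)` equal to one
  -- `b(i , j)`, and `b` sends this vector to the generator where the vertex stands in `full`.
  pick : ℕ → ℕ → ℕ → ℕ → ℤ
  pick 0 k v _ = bit (stepAt rs k v)
  pick 1 v j _ = bit (j ≡ᵇ slot rs v)
  pick 2 i j p = bit (p ≡ᵇ index full (holder rs i j))
  pick _ _ _ _ = 0ℤ

  witness : ℕ → ℤ
  witness x = pick (x DivMod./ Wd DivMod./ Wd DivMod./ Wd) (x DivMod./ Wd DivMod./ Wd % Wd) (x DivMod./ Wd % Wd) (x % Wd)

  witness-key : ∀ tag {p q r} → p < Wd → q < Wd → r < Wd → witness (key tag p q r) ≡ pick tag p q r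
  witness-key tag {p} {q} {r} p< q< r<
    rewrite quotient Wd ((tag * Wd + p) * Wd + q) r< | quotient Wd (tag * Wd + p) q< | quotient Wd tag p<
          | remainder Wd ((tag * Wd + p) * Wd + q) r< | remainder Wd (tag * Wd + p) q< | remainder Wd tag p< = refl

  -- Only the first `3 * Wd * Wd * Wd` variables are drawn at random, and the others are 0 in every
  -- assignment that is compared with the witness.
  witness-outside : ∀ x → 3 * Wd * Wd * Wd ≤ x → witness x ≡ 0ℤ
  witness-outside x h = beyond (divide 3 (divide (3 * Wd) (divide (3 * Wd * Wd) h)))
    where
    divide : ∀ m {x} → m * Wd ≤ x → m ≤ x DivMod./ Wd
    divide m {x} h = subst (_≤ x DivMod./ Wd) (DivMod.m*n/n≡m m Wd) (DivMod./-monoˡ-≤ Wd h)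
    beyond : ∀ {t p q r} → 3 ≤ t → pick t p q r ≡ 0ℤ
    beyond (s≤s (s≤s (s≤s _))) = refl

  open Weighted witness

  private
    K≤W : K ≤ Wd
    K≤W = ≤-trans (m≤m+n K n) (m≤m+n _ c)
    n≤W : n ≤ Wd
    n≤W = ≤-trans (m≤n+m n K) (m≤m+n _ c)
    c≤W : c ≤ Wd
    c≤W = m≤n+m c _

  a-basis : All (λ v → ∀ p → p < K → a v p ≡ basis (index full v) p) rs
  a-basis = All.tabulate (λ {v} v∈ p p<K → at-vertex v v∈ p p<K)
    where
    at-vertex : ∀ v → v ∈ rs → ∀ p → p < K → a v p ≡ basis (index full v) p
    at-vertex v v∈ p p<K = trans (sumTo-single K j j<K other) (trans (cong₂ _*ℤ_ g-on b-on) (ℤₚ.*-identityˡ _))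
      where
      v<n = All.lookup rs<n v∈
      j = slot rs v
      j<count = slot<count rs v∈
      j<K = <-≤-trans j<count (≤-trans (count≤length _ rs) len≤K)
      j<cap = <-≤-trans j<count (proj₂ (fair (chi v) (chi<c v<n)))
      0<W = <-≤-trans (≤-<-trans z≤n p<K) K≤W
      key-g : ∀ {j} → j < K → witness (key 1 v j 0) ≡ bit (j ≡ᵇ slot rs v)
      key-g j<K = witness-key 1 (<-≤-trans v<n n≤W) (<-≤-trans j<K K≤W) 0<W
      g-on : g v j ≡ 1ℤ
      g-on rewrite <ᵇ-true j<cap = trans (key-g j<K) (cong bit (≡ᵇ-refl j))
      other : ∀ i → i < K → i ≢ j → g v i *ℤ b (chi v) i p ≡ 0ℤ
      other i i<K i≢j = cong (_*ℤ b (chi v) i p) g-off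
        where
        g-off : g v i ≡ 0ℤ
        g-off with i <ᵇ cap (chi v)
        ... | false = refl
        ... | true  = trans (key-g i<K) (cong bit (≢⇒≡ᵇ i≢j))
      key-b : witness (key 2 (chi v) j p) ≡ basis (index full v) p
      key-b = trans (witness-key 2 (<-≤-trans (chi<c v<n) c≤W) (<-≤-trans j<K K≤W) (<-≤-trans p<K K≤W))
        (cong (λ u → basis (index full u) p) (holder-slot rs v∈))
      b-on : b (chi v) j p ≡ basis (index full v) p
      -- At the generator of `v` the gate is open by the placement; everywhere else the value is 0
      -- whether it is open or not.
      b-on with p ℕ.≟ index full v
      ... | yes refl rewrite placed-index 0 full full-placed (Permₚ.∈-resp-↭ rs↭full v∈) = key-b
      ... | no  p≢ with allowed (chi v) p
      ...   | true  = key-b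
      ...   | false = sym (cong bit (≢⇒≡ᵇ p≢))

  wedges-nonzero : wedges a rs one (monomial K (_<ᵇ length rs)) ≢ 0ℤ
  wedges-nonzero eq = wedges-basis {K} (index full) 0 full (_<ᵇ length rs)
    (Numbered-index 0 full full-unique) (≤-trans (≤-reflexive full-length) len≤K)
    (λ q _ → cong (q <ᵇ_) (sym full-length)) full-zero
    where
    X = monomial K (_<ᵇ length rs)
    rs-zero : wedges (basis ∘ index full) rs one X ≡ 0ℤ
    rs-zero = trans (sym (wedges-cong a _ rs one a-basis X)) eq
    full-zero : wedges (basis ∘ index full) full one X ≡ 0ℤ
    full-zero with wedges-↭ (basis ∘ index full) one rs↭full
    ... | inj₁ e = trans (sym (e X)) rs-zero
    ... | inj₂ e = ℤₚ.neg-injective (trans (sym (e X)) rs-zero)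

  Follows : List ℕ → Set
  Follows l = ∀ k v → k < length l → v < n → y k v ≡ bit (stepAt l k v)

  Follows-tail : ∀ {u l} → Follows (u ∷ l) → Follows l
  Follows-tail {u} {l} f k v k< v<n = trans (f k v (m<n⇒m<1+n k<) v<n)
    (cong (λ d → bit (if d then v ≡ᵇ u else stepAt l k v)) (≢⇒≡ᵇ (<⇒≢ k<)))

  Follows-rs : Follows rs
  Follows-rs k v k< v<n = witness-key 0 (<-≤-trans (<-≤-trans k< len≤K) K≤W) (<-≤-trans v<n n≤W)
    (<-≤-trans (≤-<-trans z≤n v<n) n≤W)

  Follows-head : ∀ {u l v} → Follows (u ∷ l) → v < n → y (length l) v ≡ bit (v ≡ᵇ u)
  Follows-head {u} {l} {v} f v<n = trans (f (length l) v ≤-refl v<n)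
    (cong (λ d → bit (if d then v ≡ᵇ u else stepAt l (length l) v)) (≡ᵇ-refl (length l)))

  on-route : ∀ v vs L X {w} → Follows (v ∷ vs) → v < n →
             wedge (a v) (S (length vs) L v) X ≡ w → F (length vs) L v X ≡ w
  on-route v vs L X f v<n e = trans (cong₂ _*ℤ_
    (trans (Follows-head {v} {vs} f v<n) (cong bit (≡ᵇ-refl v))) e) (ℤₚ.*-identityˡ _)

  -- At each step `y` is 1 at the vertex of the walk and 0 at all others, so only the predecessor on
  -- the walk survives in the sum.
  F-route : s < n → ∀ {L v vs} → Route L (v ∷ vs) → Follows (v ∷ vs) → F (length vs) L v ≗ wedges a (v ∷ vs) one
  F-route s<n start f X = on-route s [] 0 X f s<n (wedge-congʳ (a s) first X)
    where
    first : S 0 0 s ≗ one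
    first Y rewrite ≡ᵇ-refl s = refl
  F-route s<n (extend {L} {u} {us} {v} route u<n v<n pos) f X =
    on-route v (u ∷ us) (L + ent u v) X f v<n (wedge-congʳ (a v) prefix X)
    where
    e = ent u v
    term : ∀ Y → (if (0 <ᵇ e) ∧ (e ≤ᵇ L + e) then F (length us) (L + e ∸ e) u Y else 0ℤ) ≡ wedges a (u ∷ us) one Y
    term Y rewrite <ᵇ-true pos | ≤ᵇ-true (m≤n+m e L) | ℕₚ.m+n∸n≡m L e = F-route s<n route (Follows-tail {v} {u ∷ us} f) Y
    prefix : S (suc (length us)) (L + e) v ≗ wedges a (u ∷ us) one
    prefix Y = trans (sumTo-single n u u<n other) (term Y)
      where
      other : ∀ i → i < n → i ≢ u → (if (0 <ᵇ ent i v) ∧ (ent i v ≤ᵇ L + e) then F (length us) (L + e ∸ ent i v) i Y else 0ℤ) ≡ 0ℤ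
      other i i<n i≢u with (0 <ᵇ ent i v) ∧ (ent i v ≤ᵇ L + e)
      ... | false = refl
      ... | true  = cong (_*ℤ wedge (a i) (S (length us) (L + e ∸ ent i v) i) Y)
        (trans (Follows-head {u} {us} (Follows-tail {v} {u ∷ us} f) i<n) (cong bit (≢⇒≡ᵇ i≢u)))

complete : ∀ n c K s ent chi need cap → let open Sieve n c K s ent chi need cap in
  s < n → (∀ {v} → v < n → chi v < c) →
  ∀ {L v vs} → Route L (v ∷ vs) → All (_< n) (v ∷ vs) → Unique (v ∷ vs) → suc (length vs) ≤ K → Fair (v ∷ vs) →
  pre c ≤ suc (length vs) ×
  ∃[ z ] ((∀ x → 3 * Wd * Wd * Wd ≤ x → z x ≡ 0ℤ) × Weighted.F z (length vs) L v (monomial K (_<ᵇ suc (length vs))) ≢ 0ℤ)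
complete n c K s ent chi need cap s<n chi<c {L} {v} {vs} route rs<n uniq len fair =
  pre≤length , witness , witness-outside ,
  λ eq → wedges-nonzero (trans (sym (F-route s<n route Follows-rs (monomial K (_<ᵇ suc (length vs))))) eq)
  where
  open Witness n c K s ent chi need cap chi<c
    {{ℕ.>-nonZero (<-≤-trans (≤-<-trans z≤n s<n) (≤-trans (m≤n+m n K) (m≤m+n _ c)))}}
    (v ∷ vs) rs<n uniq len fair

-- The Schwartz–Zippel lemma

-- Horner's form `c + x * g x`, as a property of functions: no syntax of polynomials has to be
-- evaluated.
PolyDeg : ℕ → (ℤ → ℤ) → Set
PolyDeg zero    f = ∃[ c ] (∀ x → f x ≡ c)
PolyDeg (suc d) f = ∃[ c ] ∃[ g ] (PolyDeg d g × (∀ x → f x ≡ c +ℤ x *ℤ g x))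

PolyDeg-ext : ∀ d {f g} → (∀ x → g x ≡ f x) → PolyDeg d f → PolyDeg d g
PolyDeg-ext zero    e (c , p)         = c , λ x → trans (e x) (p x)
PolyDeg-ext (suc d) e (c , h , q , p) = c , h , q , λ x → trans (e x) (p x)

PolyDeg-suc : ∀ d {f} → PolyDeg d f → PolyDeg (suc d) f
PolyDeg-suc zero    (c , p)         = c , (λ _ → 0ℤ) , (0ℤ , λ _ → refl) , λ x →
  trans (p x) (sym (trans (cong (c +ℤ_) (ℤₚ.*-zeroʳ x)) (ℤₚ.+-identityʳ c)))
PolyDeg-suc (suc d) (c , g , q , p) = c , g , PolyDeg-suc d q , p

PolyDeg-const : ∀ d c → PolyDeg d (λ _ → c)
PolyDeg-const zero    c = c , λ _ → refl
PolyDeg-const (suc d) c = PolyDeg-suc d (PolyDeg-const d c)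

PolyDeg-+ : ∀ d {f g} → PolyDeg d f → PolyDeg d g → PolyDeg d (λ x → f x +ℤ g x)
PolyDeg-+ zero    (c , p) (c′ , p′) = c +ℤ c′ , λ x → cong₂ _+ℤ_ (p x) (p′ x)
PolyDeg-+ (suc d) (c , h , q , p) (c′ , h′ , q′ , p′) = c +ℤ c′ , _ , PolyDeg-+ d q q′ ,
  λ x → trans (cong₂ _+ℤ_ (p x) (p′ x)) (collect c x (h x) c′ (h′ x))
  where
  collect : ∀ c x h c′ h′ → (c +ℤ x *ℤ h) +ℤ (c′ +ℤ x *ℤ h′) ≡ (c +ℤ c′) +ℤ x *ℤ (h +ℤ h′)
  collect = ℤ-Ring.solve-∀

PolyDeg-* : ∀ d k {f} → PolyDeg d f → PolyDeg d (λ x → k *ℤ f x)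
PolyDeg-* zero    k (c , p)         = k *ℤ c , λ x → cong (k *ℤ_) (p x)
PolyDeg-* (suc d) k (c , h , q , p) = k *ℤ c , _ , PolyDeg-* d k q ,
  λ x → trans (cong (k *ℤ_) (p x)) (collect k c x (h x))
  where
  collect : ∀ k c x h → k *ℤ (c +ℤ x *ℤ h) ≡ k *ℤ c +ℤ x *ℤ (k *ℤ h)
  collect = ℤ-Ring.solve-∀

-- The factor theorem, from `x * g x - r * g r = (x - r) * g x + r * (g x - g r)` and induction on
-- the degree.
difference : ∀ d {f} r → PolyDeg (suc d) f → ∃[ q ] (PolyDeg d q × (∀ x → f x -ℤ f r ≡ (x -ℤ r) *ℤ q x))
difference zero r (c , g , (k , gk) , p) = (λ _ → k) , (k , λ _ → refl) ,
  λ x → trans (cong₂ _-ℤ_ (trans (p x) (cong (λ u → c +ℤ x *ℤ u) (gk x))) (trans (p r) (cong (λ u → c +ℤ r *ℤ u) (gk r))))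
    (collect c x r k)
  where
  collect : ∀ c x r k → (c +ℤ x *ℤ k) -ℤ (c +ℤ r *ℤ k) ≡ (x -ℤ r) *ℤ k
  collect = ℤ-Ring.solve-∀
difference (suc d) r (c , g , gd , p) with difference d r gd
... | q , qd , e = (λ x → g x +ℤ r *ℤ q x) , PolyDeg-+ (suc d) gd (PolyDeg-* (suc d) r (PolyDeg-suc d qd)) ,
  λ x → trans (cong₂ _-ℤ_ (p x) (p r)) (trans (separate c x r (g x) (g r))
    (trans (cong (λ u → (x -ℤ r) *ℤ g x +ℤ r *ℤ u) (e x)) (collect x r (g x) (q x))))
  where
  separate : ∀ c x r a b → (c +ℤ x *ℤ a) -ℤ (c +ℤ r *ℤ b) ≡ (x -ℤ r) *ℤ a +ℤ r *ℤ (a -ℤ b)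
  separate = ℤ-Ring.solve-∀
  collect : ∀ x r a q → (x -ℤ r) *ℤ a +ℤ r *ℤ ((x -ℤ r) *ℤ q) ≡ (x -ℤ r) *ℤ (a +ℤ r *ℤ q)
  collect = ℤ-Ring.solve-∀

countTrue-false : ∀ m {f : Vec Bool m → Bool} → (∀ bs → f bs ≡ false) → countTrue m f ≡ 0
countTrue-false zero    e rewrite e [] = refl
countTrue-false (suc m) e = cong₂ _+_ (countTrue-false m (λ bs → e (true ∷ bs))) (countTrue-false m (λ bs → e (false ∷ bs)))

countTrue-≤ : ∀ m (f : Vec Bool m → Bool) → countTrue m f ≤ 2 ^ m
countTrue-≤ zero f with f []
... | true  = ≤-refl
... | false = z≤n
countTrue-≤ (suc m) f = ≤-trans (+-mono-≤ (countTrue-≤ m _) (countTrue-≤ m _)) (≤-reflexive (double (2 ^ m)))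

countTrue-⊎ : ∀ m {f g h : Vec Bool m → Bool} → (∀ bs → f bs ≡ true → g bs ≡ true ⊎ h bs ≡ true) →
              countTrue m f ≤ countTrue m g + countTrue m h
countTrue-⊎ zero {f} {g} {h} e with f [] in eq
... | false = z≤n
... | true with e [] eq
...   | inj₁ p rewrite p = s≤s z≤n
...   | inj₂ p rewrite p = m≤n+m 1 (if g [] then 1 else 0)
countTrue-⊎ (suc m) {f} {g} {h} e = ≤-trans
  (+-mono-≤ (countTrue-⊎ m (λ bs → e (true ∷ bs))) (countTrue-⊎ m (λ bs → e (false ∷ bs))))
  (≤-reflexive (interchange (countTrue m (g ∘ (true ∷_))) _ (countTrue m (g ∘ (false ∷_))) _))
  where
  interchange : ∀ a b c d → (a + b) + (c + d) ≡ (a + c) + (b + d)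
  interchange = ℕ-Ring.solve-∀

countTrue-unique : ∀ m {f : Vec Bool m → Bool} b → (∀ bs → f bs ≡ true → bs ≡ b) → countTrue m f ≤ 1
countTrue-unique zero {f} b e with f []
... | true  = ≤-refl
... | false = z≤n
countTrue-unique (suc m) {f} (true ∷ b) e = subst (_≤ 1)
  (sym (trans (cong (λ k → countTrue m (f ∘ (true ∷_)) + k) (countTrue-false m none)) (+-identityʳ _)))
  (countTrue-unique m b (λ bs p → cong Vec.tail (e (true ∷ bs) p)))
  where
  none : ∀ bs → f (false ∷ bs) ≡ false
  none bs with f (false ∷ bs) in eq
  ... | false = refl
  ... | true  = case e (false ∷ bs) eq of λ ()
countTrue-unique (suc m) {f} (false ∷ b) e = subst (_≤ 1)
  (sym (cong (_+ countTrue m (f ∘ (false ∷_))) (countTrue-false m none)))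
  (countTrue-unique m b (λ bs p → cong Vec.tail (e (false ∷ bs) p)))
  where
  none : ∀ bs → f (true ∷ bs) ≡ false
  none bs with f (true ∷ bs) in eq
  ... | false = refl
  ... | true  = case e (true ∷ bs) eq of λ ()

search : ∀ m (f : Vec Bool m → Bool) → (∃[ bs ] f bs ≡ true) ⊎ (∀ bs → f bs ≡ false)
search zero f with f [] in eq
... | true  = inj₁ ([] , eq)
... | false = inj₂ λ { [] → eq }
search (suc m) f with search m (f ∘ (true ∷_)) | search m (f ∘ (false ∷_))
... | inj₁ (bs , p) | _             = inj₁ (true ∷ bs , p)
... | inj₂ _        | inj₁ (bs , p) = inj₁ (false ∷ bs , p)
... | inj₂ p        | inj₂ q        = inj₂ λ { (true ∷ bs) → p bs ; (false ∷ bs) → q bs }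

isZero : ℤ → Bool
isZero k = does (k ℤ.≟ 0ℤ)

isZero⁻ : ∀ {k} → isZero k ≡ true → k ≡ 0ℤ
isZero⁻ {k} e with k ℤ.≟ 0ℤ
... | yes p = p

isZero⁺ : ∀ {k} → k ≡ 0ℤ → isZero k ≡ true
isZero⁺ {k} p = dec-true (k ℤ.≟ 0ℤ) p

isZero-no : ∀ {k} → k ≢ 0ℤ → isZero k ≡ false
isZero-no {k} = dec-false (k ℤ.≟ 0ℤ)

-- A root splits off a linear factor, which has just one zero among the samples by injectivity. The
-- quotient has smaller degree and is still nonzero at `x`, a point that may lie outside the
-- samples.
roots : ∀ m (val : Vec Bool m → ℤ) → (∀ {bs cs} → val bs ≡ val cs → bs ≡ cs) →
        ∀ d {f x} → PolyDeg d f → f x ≢ 0ℤ → countTrue m (isZero ∘ f ∘ val) ≤ d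
roots m val inj zero {f} {x} (c , p) nz = ≤-reflexive
  (countTrue-false m (λ bs → isZero-no (λ e → nz (trans (p x) (trans (sym (p (val bs))) e)))))
roots m val inj (suc d) {f} {x} fd nz with search m (isZero ∘ f ∘ val)
... | inj₂ none = ≤-trans (≤-reflexive (countTrue-false m none)) z≤n
... | inj₁ (r , root) with difference d (val r) fd
...   | q , qd , e = ≤-trans
  (countTrue-⊎ m {g = λ bs → isZero (val bs -ℤ val r)} {h = isZero ∘ q ∘ val} split)
  (+-mono-≤ (countTrue-unique m r (λ bs p → inj (ℤₚ.i-j≡0⇒i≡j _ _ (isZero⁻ p))))
    (roots m val inj d {x = x} qd (λ qx → nz (trans (factor x) (trans (cong ((x -ℤ val r) *ℤ_) qx) (ℤₚ.*-zeroʳ (x -ℤ val r)))))))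
  where
  factor : ∀ y → f y ≡ (y -ℤ val r) *ℤ q y
  factor y = trans (sym (ℤₚ.+-identityʳ _)) (trans (cong (λ u → f y -ℤ u) (sym (isZero⁻ root))) (e y))
  split : ∀ bs → isZero (f (val bs)) ≡ true → isZero (val bs -ℤ val r) ≡ true ⊎ isZero (q (val bs)) ≡ true
  split bs p with ℤₚ.i*j≡0⇒i≡0∨j≡0 (val bs -ℤ val r) (trans (sym (factor (val bs))) (isZero⁻ p))
  ... | inj₁ h = inj₁ (isZero⁺ h)
  ... | inj₂ h = inj₂ (isZero⁺ h)

Assignment : Set
Assignment = ℕ → ℤ

_[_≔_] : Assignment → ℕ → ℤ → Assignment
(z [ i ≔ x ]) j = if j ≡ᵇ i then x else z j

-- Polynomial functions whose degree in each single variable is at most d.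
record MPoly (d : ℕ) (f : Assignment → ℤ) : Set where
  constructor mpoly
  field
    resp : ∀ {z z′} → z ≗ z′ → f z ≡ f z′
    poly : ∀ i z → PolyDeg d (λ x → f (z [ i ≔ x ]))

open MPoly

MPoly-ext : ∀ {d f g} → (∀ z → g z ≡ f z) → MPoly d f → MPoly d g
MPoly-ext {d} e p = mpoly (λ h → trans (e _) (trans (resp p h) (sym (e _))))
  (λ i z → PolyDeg-ext d (λ x → e _) (poly p i z))

MPoly-const : ∀ d c → MPoly d (λ _ → c)
MPoly-const d c = mpoly (λ _ → refl) (λ _ _ → PolyDeg-const d c)

MPoly-+ : ∀ {d f g} → MPoly d f → MPoly d g → MPoly d (λ z → f z +ℤ g z)
MPoly-+ {d} p q = mpoly (λ h → cong₂ _+ℤ_ (resp p h) (resp q h)) (λ i z → PolyDeg-+ d (poly p i z) (poly q i z))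

MPoly-sub : ∀ {d f g} → MPoly d f → MPoly d g → MPoly d (λ z → f z -ℤ g z)
MPoly-sub {d} p q = mpoly (λ h → cong₂ _-ℤ_ (resp p h) (resp q h))
  (λ i z → PolyDeg-+ d (poly p i z) (PolyDeg-ext d (λ _ → sym (ℤₚ.-1*i≡-i _)) (PolyDeg-* d -1ℤ (poly q i z))))

MPoly-var* : ∀ {d f} i → MPoly d f → MPoly (suc d) (λ z → z i *ℤ f z)
MPoly-var* {d} {f} i p = mpoly (λ h → cong₂ _*ℤ_ (h i) (resp p h)) at-coordinate
  where
  at-coordinate : ∀ k z → PolyDeg (suc d) (λ x → (z [ k ≔ x ]) i *ℤ f (z [ k ≔ x ]))
  at-coordinate k z with i ≡ᵇ k
  ... | true  = 0ℤ , _ , poly p k z , λ x → sym (ℤₚ.+-identityˡ _)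
  ... | false = PolyDeg-suc d (PolyDeg-* d (z i) (poly p k z))

MPoly-suc : ∀ {d f} → MPoly d f → MPoly (suc d) f
MPoly-suc {d} p = mpoly (resp p) (λ i z → PolyDeg-suc d (poly p i z))

MPoly-≤ : ∀ {d e f} → d ≤ e → MPoly d f → MPoly e f
MPoly-≤ {d} d≤e p with ℕₚ.≤⇒≤′ d≤e
... | ℕ.≤′-refl   = p
... | ℕ.≤′-step h = MPoly-suc (MPoly-≤ (ℕₚ.≤′⇒≤ h) p)

gate : Bool → ℤ → ℤ
gate on x = if on then x else 0ℤ

MPoly-gate* : ∀ {d f} on i → MPoly d f → MPoly (suc d) (λ z → gate on (z i) *ℤ f z)
MPoly-gate* {d} true  i p = MPoly-var* i p
MPoly-gate* {d} false i p = MPoly-const (suc d) 0ℤ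

MPoly-gate : ∀ {d f} on → MPoly d f → MPoly d (λ z → gate on (f z))
MPoly-gate     true  p = p
MPoly-gate {d} false p = MPoly-const d 0ℤ

MPoly-sum : ∀ {d} n {f : Assignment → ℕ → ℤ} → (∀ i → MPoly d (λ z → f z i)) → MPoly d (λ z → sumTo n (f z))
MPoly-sum {d} zero    p = MPoly-const d 0ℤ
MPoly-sum     (suc n) p = MPoly-+ (MPoly-sum n p) (p n)

MPoly-wedge : ∀ {d K} (on : ℕ → Bool) (κ : ℕ → ℕ) (T : Assignment → Ext K) → (∀ Y → MPoly d (λ z → T z Y)) →
              ∀ X → MPoly (suc d) (λ z → wedge (λ p → gate (on p) (z (κ p))) (T z) X)
MPoly-wedge {d} on κ T p []          = MPoly-const (suc d) 0ℤ
MPoly-wedge     on κ T p (false ∷ X) = MPoly-wedge on κ _ (λ Y → p (false ∷ Y)) X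
MPoly-wedge {K = suc K} on κ T p (true ∷ X) =
  MPoly-sub (MPoly-gate* (on K) (κ K) (p (false ∷ X))) (MPoly-wedge on κ _ (λ Y → p (true ∷ Y)) X)

module SievePoly (n c K s : ℕ) (ent : ℕ → ℕ → ℕ) (chi need cap : ℕ → ℕ) where
  open Sieve n c K s ent chi need cap
  open Weighted using (F; S)

  mutual
    -- Each of the `suc k` vertices multiplies in one `y`, one `g` and one `b`, which bounds the
    -- total degree and thus that in each variable.
    F-MPoly : ∀ k L v X → MPoly (3 * suc k) (λ z → F z k L v X)
    F-MPoly k L v X = subst (λ d → MPoly d (λ z → F z k L v X)) (sym (ℕₚ.*-suc 3 k))
      (MPoly-var* (key 0 k v 0) (MPoly-ext (λ z → Weighted.wedge-a z v (S z k L v) X)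
        (MPoly-sum K (λ j → MPoly-gate* (j <ᵇ cap (chi v)) (key 1 v j 0)
          (MPoly-wedge (allowed (chi v)) (key 2 (chi v) j) (λ z → S z k L v) (S-MPoly k L v) X)))))

    S-MPoly : ∀ k L v X → MPoly (3 * k) (λ z → S z k L v X)
    S-MPoly zero    L v X = MPoly-const 0 (gate ((L ≡ᵇ 0) ∧ (v ≡ᵇ s)) (one X))
    S-MPoly (suc k) L v X = MPoly-sum n (λ u →
      MPoly-gate ((0 <ᵇ ent u v) ∧ (ent u v ≤ᵇ L)) (F-MPoly k (L ∸ ent u v) u X))

horner : ℕ → (ℕ → ℤ) → ℤ
horner zero    h = 0ℤ
horner (suc q) h = (horner q h +ℤ horner q h) +ℤ h q

horner-cong : ∀ q {h h′} → (∀ i → i < q → h i ≡ h′ i) → horner q h ≡ horner q h′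
horner-cong zero    e = refl
horner-cong (suc q) e = cong₂ _+ℤ_ (cong (λ x → x +ℤ x) ih) (e q ≤-refl)
  where ih = horner-cong q (λ i i<q → e i (m<n⇒m<1+n i<q))

-- Twice `x - y` equals a difference of two bits, and 0 is the only even one.
parity : ∀ x y b c → (x +ℤ x) +ℤ bit b ≡ (y +ℤ y) +ℤ bit c → x ≡ y × b ≡ c
parity x y b c e = finish b c (x -ℤ y) (ℤₚ.i-j≡0⇒i≡j x y)
  (trans (rearrange x y (bit b)) (trans (cong (_-ℤ (y +ℤ y +ℤ bit b)) e) (cancel y (bit b) (bit c))))
  where
  rearrange : ∀ x y b → (x -ℤ y) +ℤ (x -ℤ y) ≡ (x +ℤ x +ℤ b) -ℤ (y +ℤ y +ℤ b)
  rearrange = ℤ-Ring.solve-∀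
  cancel : ∀ y b c → (y +ℤ y +ℤ c) -ℤ (y +ℤ y +ℤ b) ≡ c -ℤ b
  cancel = ℤ-Ring.solve-∀
  even-zero : ∀ d → d +ℤ d ≡ 0ℤ → d ≡ 0ℤ
  even-zero (+ zero) _ = refl
  not-one : ∀ d → d +ℤ d ≢ 1ℤ
  not-one (+ suc m) p rewrite +-suc m m = case p of λ ()
  not-minus-one : ∀ d → d +ℤ d ≢ -1ℤ
  not-minus-one -[1+ m ] ()
  finish : ∀ b c d → (d ≡ 0ℤ → x ≡ y) → d +ℤ d ≡ bit c -ℤ bit b → x ≡ y × b ≡ c
  finish true  true  d k p = k (even-zero d p) , refl
  finish false false d k p = k (even-zero d p) , refl
  finish true  false d k p = ⊥-elim (not-minus-one d p)
  finish false true  d k p = ⊥-elim (not-one d p)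

horner-injective : ∀ q (h h′ : ℕ → Bool) → horner q (bit ∘ h) ≡ horner q (bit ∘ h′) → ∀ i → i < q → h i ≡ h′ i
horner-injective (suc q) h h′ e i i<1+q with parity _ _ (h q) (h′ q) e | i ℕ.≟ q
... | _ , p | yes refl = p
... | p , _ | no  i≢q  = horner-injective q h h′ p i (ℕₚ.≤∧≢⇒< (≤-pred i<1+q) i≢q)

nthBit-injective : ∀ {N} (bs cs : Vec Bool N) → (∀ i → i < N → nthBit bs i ≡ nthBit cs i) → bs ≡ cs
nthBit-injective []       []       e = refl
nthBit-injective (b ∷ bs) (c ∷ cs) e = cong₂ _∷_ (e 0 (s≤s z≤n)) (nthBit-injective bs cs (λ i i<N → e (suc i) (s≤s i<N)))

nthBit-++ˡ : ∀ {M N} (bs : Vec Bool M) (cs : Vec Bool N) i → i < M → nthBit (bs Vec.++ cs) i ≡ nthBit bs i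
nthBit-++ˡ (b ∷ bs) cs zero    _         = refl
nthBit-++ˡ (b ∷ bs) cs (suc i) (s≤s i<M) = nthBit-++ˡ bs cs i i<M

nthBit-++ʳ : ∀ {M N} (bs : Vec Bool M) (cs : Vec Bool N) i → nthBit (bs Vec.++ cs) (M + i) ≡ nthBit cs i
nthBit-++ʳ []       cs i = refl
nthBit-++ʳ (b ∷ bs) cs i = nthBit-++ʳ bs cs i

module _ (B : ℕ) where

  number : Vec Bool B → ℤ
  number bs = horner B (bit ∘ nthBit bs)

  numbers : ∀ {M} → Vec Bool M → Assignment
  numbers bs i = horner B (λ q → bit (nthBit bs (i * B + q)))

  infixr 5 _◂_

  _◂_ : ℤ → Assignment → Assignment
  (x ◂ z) zero    = x
  (x ◂ z) (suc i) = z i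

  numbers-++ : ∀ {M} (bs : Vec Bool B) (cs : Vec Bool M) → numbers (bs Vec.++ cs) ≗ number bs ◂ numbers cs
  numbers-++ bs cs zero    = horner-cong B (λ i i<B → cong bit (nthBit-++ˡ bs cs i i<B))
  numbers-++ bs cs (suc i) = horner-cong B (λ q _ → cong bit
    (trans (cong (nthBit (bs Vec.++ cs)) (+-assoc B (i * B) q)) (nthBit-++ʳ bs cs (i * B + q))))

  numbers-[] : ∀ i → numbers [] i ≡ 0ℤ
  numbers-[] i = zeros B
    where
    zeros : ∀ q → horner q (λ _ → 0ℤ) ≡ 0ℤ
    zeros zero    = refl
    zeros (suc q) = cong (λ x → x +ℤ x +ℤ 0ℤ) (zeros q)

  MPoly-◂ : ∀ {d f} x → MPoly d f → MPoly d (λ z → f (x ◂ z))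
  MPoly-◂ {d} x p = mpoly (λ e → resp p (λ { zero → refl ; (suc i) → e i }))
    (λ i z → PolyDeg-ext d (λ y → resp p (λ { zero → refl ; (suc j) → refl })) (poly p (suc i) (x ◂ z)))

  MPoly-first : ∀ {d f} z → MPoly d f → PolyDeg d (λ x → f (x ◂ z))
  MPoly-first {d} z p = PolyDeg-ext d (λ y → resp p (λ { zero → refl ; (suc j) → refl })) (poly p 0 (0ℤ ◂ z))

  -- A bad first block is charged for all its continuations, a good one only for those that `h`
  -- admits.
  countTrue-split : ∀ s {t m X} (p : Vec Bool (s + t) → Bool) (bad : Vec Bool s → Bool) →
    (∀ bs → bad bs ≡ false → countTrue t (λ cs → p (bs Vec.++ cs)) * m ≤ X) →
    countTrue (s + t) p * m ≤ countTrue s bad * (2 ^ t * m) + 2 ^ s * X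
  countTrue-split zero {t} {m} {X} p bad h with bad [] in eq
  ... | true  = ≤-trans (*-monoˡ-≤ m (countTrue-≤ t p))
    (≤-trans (≤-reflexive (sym (ℕₚ.*-identityˡ _))) (m≤m+n _ _))
  ... | false = ≤-trans (h [] eq) (≤-reflexive (sym (ℕₚ.*-identityˡ X)))
  countTrue-split (suc s) {t} {m} {X} p bad h = subst₂ _≤_ (sym (ℕₚ.*-distribʳ-+ m (countTrue (s + t) _) _))
    (collect (countTrue s (bad ∘ (true ∷_))) (countTrue s (bad ∘ (false ∷_))) (2 ^ t * m) (2 ^ s) X)
    (+-mono-≤ (countTrue-split s (p ∘ (true ∷_)) (bad ∘ (true ∷_)) (λ bs → h (true ∷ bs)))
      (countTrue-split s (p ∘ (false ∷_)) (bad ∘ (false ∷_)) (λ bs → h (false ∷ bs))))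
    where
    collect : ∀ a b t s x → (a * t + s * x) + (b * t + s * x) ≡ (a + b) * t + 2 * s * x
    collect = ℕ-Ring.solve-∀

  -- That the polynomial is nonzero is expressed by a point `z`. With the other coordinates taken
  -- from `z`, the first variable has at most `d` bad values; for any other value the tail of `z` is
  -- such a point for the remaining variables.
  schwartz-zippel : ∀ N {d f z} → MPoly d f → (∀ i → N ≤ i → z i ≡ 0ℤ) → f z ≢ 0ℤ →
    countTrue (N * B) (isZero ∘ f ∘ numbers) * 2 ^ B ≤ N * d * 2 ^ (N * B)
  schwartz-zippel zero {f = f} {z} p outside nz
    rewrite isZero-no {f (numbers [])} (λ e → nz (trans (resp p (λ i → trans (outside i z≤n) (sym (numbers-[] i)))) e)) = z≤n
  schwartz-zippel (suc N) {d} {f} {z} p outside nz = ≤-trans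
    (countTrue-split B {N * B} {2 ^ B} {N * d * 2 ^ (N * B)} (isZero ∘ f ∘ numbers) bad inner)
    (≤-trans (ℕₚ.+-monoˡ-≤ _ (*-monoˡ-≤ (2 ^ (N * B) * 2 ^ B) few))
      (≤-reflexive (trans (collect d N (2 ^ (N * B)) (2 ^ B))
        (cong ((d + N * d) *_) (sym (ℕₚ.^-distribˡ-+-* 2 B (N * B)))))))
    where
    z′ = z ∘ suc
    bad : Vec Bool B → Bool
    bad bs = isZero (f (number bs ◂ z′))
    few : countTrue B bad ≤ d
    few = roots B number (λ {bs} {cs} e → nthBit-injective bs cs (horner-injective B (nthBit bs) (nthBit cs) e))
      d {x = z 0} (MPoly-first z′ p) (λ e → nz (trans (resp p (λ { zero → refl ; (suc i) → refl })) e))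
    inner : ∀ bs → bad bs ≡ false →
            countTrue (N * B) (λ cs → isZero (f (numbers (bs Vec.++ cs)))) * 2 ^ B ≤ N * d * 2 ^ (N * B)
    inner bs good = subst (λ m → m * 2 ^ B ≤ N * d * 2 ^ (N * B))
      (countTrue-cong (N * B) (λ cs → cong isZero (sym (resp p (numbers-++ bs cs)))))
      (schwartz-zippel N (MPoly-◂ (number bs) p) (λ i N≤i → outside (suc i) (s≤s N≤i))
        (λ e → case trans (sym good) (isZero⁺ e) of λ ()))
    collect : ∀ d n t b → d * (t * b) + b * (n * d * t) ≡ (d + n * d) * (b * t)
    collect = ℕ-Ring.solve-∀

n≤2^n : ∀ n → n ≤ 2 ^ n
n≤2^n zero    = z≤n
n≤2^n (suc n) = subst (suc n ≤_) (double (2 ^ n)) (+-mono-≤ (m^n>0 2 n) (n≤2^n n))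

-- The `N * d` additional bits outweigh the factor `N * d` by the crude `N * d ≤ 2 ^ (N * d)`, and
-- `r` bits are left for the error.
few-failures : ∀ N d r {f z} → let B = r + N * d in MPoly d f → (∀ i → N ≤ i → z i ≡ 0ℤ) → f z ≢ 0ℤ →
  countTrue (N * B) (isZero ∘ f ∘ numbers B) * 2 ^ r ≤ 2 ^ (N * B)
few-failures N d r {f} p outside nz = ℕₚ.*-cancelʳ-≤ _ _ (2 ^ (N * d)) {{m^n≢0 2 (N * d)}} (begin
  Z * 2 ^ r * 2 ^ (N * d)        ≡⟨ ℕₚ.*-assoc Z (2 ^ r) _ ⟩
  Z * (2 ^ r * 2 ^ (N * d))      ≡⟨ cong (Z *_) (sym (ℕₚ.^-distribˡ-+-* 2 r (N * d))) ⟩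
  Z * 2 ^ B                      ≤⟨ schwartz-zippel B N p outside nz ⟩
  N * d * 2 ^ (N * B)            ≤⟨ *-monoˡ-≤ _ (n≤2^n (N * d)) ⟩
  2 ^ (N * d) * 2 ^ (N * B)      ≡⟨ ℕₚ.*-comm (2 ^ (N * d)) _ ⟩
  2 ^ (N * B) * 2 ^ (N * d)      ∎)
  where
  open ℕₚ.≤-Reasoning
  B = r + N * d
  Z = countTrue (N * B) (isZero ∘ f ∘ numbers B)

-- The program

-- Repeated addition; `y` is evaluated anew in every turn, which adds to the degrees in `cost`. The
-- bound is one on the value of `x`.
mulE : Bound → Expr → Expr → Expr
mulE b x y = iter b x (lit 0ℤ) (λ acc _ → var acc ⊕ y)

ltE : Expr → Expr → Expr → Expr → Expr
ltE x y a b = ifp (y ⊖ x) a b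

W¹ : Bound
W¹ = bound 1 1 0 0

-- A negative ℓ makes `KE` zero: the table is then empty and the answer is no.
nE cE sE tE ℓE KE WE : Expr
nE = at (lit (+ 0))
cE = at (lit (+ 1))
sE = at (lit (+ 2))
tE = at (lit (+ 3))
ℓE = at (lit (+ 4))
KE = ifp (ℓE ⊕ lit (+ 1)) (ℓE ⊕ lit (+ 1)) (lit 0ℤ)
WE = KE ⊕ nE ⊕ cE

αE βE χE needE preE powE : Expr → Expr
αE i    = at (lit (+ 5) ⊕ i)
βE i    = at (lit (+ 5) ⊕ cE ⊕ i)
χE v    = at (lit (+ 5) ⊕ cE ⊕ cE ⊕ v)
needE i = ifp (lit 0ℤ ⊖ βE i) (lit 1ℤ) (ifp (αE i) (αE i) (lit 0ℤ))
preE i  = iter W¹ i (lit 0ℤ) (λ acc j → var acc ⊕ needE (var j))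
powE p  = iter W¹ p (lit 1ℤ) (λ acc _ → var acc ⊕ var acc)

entE : Expr → Expr → Expr
entE u v = at (lit (+ 5) ⊕ cE ⊕ cE ⊕ nE ⊕ mulE W¹ u nE ⊕ v)

allowedE : Expr → Expr → Expr → Expr → Expr
allowedE i p a b =
  ltE (preE cE) (p ⊕ lit 1ℤ) a (ltE (preE i) (p ⊕ lit 1ℤ) (ltE p (preE (i ⊕ lit 1ℤ)) a b) b)

keyE : ℕ → Expr → Expr → Expr → Expr
keyE tag p q r = mulE (bound 3 2 0 0) (mulE (bound 3 1 0 0) (mulE (# 3) (lit (+ tag)) WE ⊕ p) WE ⊕ q) WE ⊕ r

-- x % 2 ^ (p + 1); without division, x subtractions are affordable since
-- 4 ^ K is still below the time bound.
modE : Expr → Expr → Expr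
modE p x = letE (powE (p ⊕ lit 1ℤ)) (λ m → iter (bound 1 0 0 1) x x (λ acc _ → ltE (var acc) (var m) (var acc) (var acc ⊖ var m)))

digitE : Expr → Expr → Expr → Expr → Expr
digitE p x a b = ltE (modE p x) (powE p) b a

module Code (r : ℕ) where

  NvE BE NBE : Expr
  NvE = mulE (bound 3 2 0 0) (mulE (bound 3 1 0 0) (mulE (# 3) (lit (+ 3)) WE) WE) WE
  BE  = lit (+ r) ⊕ mulE (bound 3 3 0 0) NvE (mulE (# 3) (lit (+ 3)) KE)
  NBE = mulE (bound 3 3 0 0) NvE BE

  -- Horner's scheme with the product as accumulator: after `q` bits it is the number they represent
  -- times `T`. The number of turns does not depend on the size of `T`.
  timesE : Expr → Expr → Expr
  timesE i e = letE e (λ T → letE (mulE (bound 3 3 0 0) i BE) (λ base →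
    iter (bound 10 4 1 0) BE (lit 0ℤ) (λ acc q →
      var acc ⊕ var acc ⊕ ifp (at (lit -1ℤ ⊖ (var base ⊕ var q))) (var T) (lit 0ℤ))))

  -- The table follows the random bits on the negative addresses; the index is a mixed-radix numeral
  -- with digits `k`, `L`, `v`, `x`.
  cellE : Expr → Expr → Expr → Expr → Expr
  cellE k L v x = lit -1ℤ ⊖ (NBE ⊕
    (mulE (bound 1 3 0 0) (mulE (bound 1 2 0 0) (mulE W¹ k KE ⊕ L) nE ⊕ v) (powE KE) ⊕ x))

  SE : Expr → Expr → Expr → Expr → Expr
  SE k L v x = ifp k
    (iter W¹ nE (lit 0ℤ) (λ acc u → var acc ⊕ letE (entE (var u) v) (λ w →
      ifp (var w) (ltE L (var w) (lit 0ℤ) (at (cellE (k ⊖ lit 1ℤ) (L ⊖ var w) (var u) x))) (lit 0ℤ))))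
    (ifp L (lit 0ℤ) (ltE v sE (lit 0ℤ) (ltE sE v (lit 0ℤ) (ifp x (lit 0ℤ) (lit 1ℤ)))))

  wedgeE : Expr → Expr → Expr → Expr → Expr → Expr
  wedgeE k L v x j = iter W¹ KE (lit 0ℤ) (λ acc p →
    digitE (var p) x
      (allowedE (χE v) (var p) (timesE (keyE 2 (χE v) j (var p)) (SE k L v (x ⊖ powE (var p)))) (lit 0ℤ) ⊖ var acc)
      (var acc))

  FE : Expr → Expr → Expr → Expr → Expr
  FE k L v x = timesE (keyE 0 k v (lit 0ℤ))
    (iter W¹ KE (lit 0ℤ) (λ acc j → var acc ⊕ ltE (var j) (βE (χE v))
      (timesE (keyE 1 v (var j) (lit 0ℤ)) (wedgeE k L v x (var j))) (lit 0ℤ)))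

  fill : Reg → Reg → Reg → Reg → Cmd
  fill k L v x = assign (cellE (var k) (var L) (var v) (var x)) (FE (var k) (var L) (var v) (var x))

  fillVertex : Reg → Reg → Reg → Cmd
  fillVertex k L v = for (bound 1 0 0 1) (powE KE) (fill k L v)

  fillLength : Reg → Reg → Cmd
  fillLength k L = for W¹ nE (fillVertex k L)

  fillLayer : Reg → Cmd
  fillLayer k = for W¹ KE (fillLength k)

  table : Cmd
  table = for W¹ KE fillLayer

  nonzeroE : Expr → Expr
  nonzeroE e = letE e (λ k → ifp (var k) (lit 1ℤ) (ifp (lit 0ℤ ⊖ var k) (lit 1ℤ) (lit 0ℤ)))

  -- `2 ^ (k + 1) - 1` is the binary number of the monomial e₀ ∧ ⋯ ∧ eₖ.
  answerE : Expr
  answerE = iter W¹ KE (lit 0ℤ) (λ acc k → iter W¹ KE (var acc) (λ acc′ L →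
    ifp (var acc′) (lit 1ℤ) (ltE (preE cE) (var k ⊕ lit (+ 2))
      (nonzeroE (at (cellE (var k) (var L) tE (powE (var k ⊕ lit 1ℤ) ⊖ lit 1ℤ)))) (lit 0ℤ))))

  sieve : Program
  sieve = randomize NBE ++ prog table 0 ++ code answerE 0

-- Monomials as binary numbers

val : ∀ {p} → Vec Bool p → ℕ
val         []      = 0
val {suc p} (b ∷ X) = (if b then 2 ^ p else 0) + val X

val< : ∀ {p} (X : Vec Bool p) → val X < 2 ^ p
val<         []          = s≤s z≤n
val< {suc p} (true ∷ X)  = subst (2 ^ p + val X <_) (double (2 ^ p)) (ℕₚ.+-monoʳ-< (2 ^ p) (val< X))
val< {suc p} (false ∷ X) = <-≤-trans (val< X) (m≤m+n (2 ^ p) _)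

val-injective : ∀ {p} (X Y : Vec Bool p) → val X ≡ val Y → X ≡ Y
val-injective []          []          e = refl
val-injective (true ∷ X)  (true ∷ Y)  e = cong (true ∷_) (val-injective X Y (ℕₚ.+-cancelˡ-≡ _ _ _ e))
val-injective (false ∷ X) (false ∷ Y) e = cong (false ∷_) (val-injective X Y e)
val-injective {suc p} (true ∷ X) (false ∷ Y) e =
  contradiction (subst (_< 2 ^ p) (sym e) (val< Y)) (ℕₚ.≤⇒≯ (m≤m+n _ _))
val-injective {suc p} (false ∷ X) (true ∷ Y) e =
  contradiction (subst (_< 2 ^ p) e (val< X)) (ℕₚ.≤⇒≯ (m≤m+n _ _))

infixl 7 _mod2^_

_mod2^_ : ℕ → ℕ → ℕ
x mod2^ p = _%_ x (2 ^ p) {{m^n≢0 2 p}}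

mod2^-< : ∀ x p → x mod2^ p < 2 ^ p
mod2^-< x p = DivMod.m%n<n x (2 ^ p) {{m^n≢0 2 p}}

mod2^-small : ∀ {x} p → x < 2 ^ p → x mod2^ p ≡ x
mod2^-small p = DivMod.m<n⇒m%n≡m {{m^n≢0 2 p}}

mod2^-suc : ∀ x p → x mod2^ suc p mod2^ p ≡ x mod2^ p
mod2^-suc x p = DivMod.m∣n⇒o%n%m≡o%m (2 ^ p) (2 ^ suc p) x {{m^n≢0 2 p}} {{m^n≢0 2 (suc p)}} (Div.divides 2 refl)

mod-∸ : ∀ {m n} .{{_ : NonZero n}} → n ≤ m → (m ∸ n) % n ≡ m % n
mod-∸ {m} {n} n≤m = trans (sym (DivMod.[m+n]%n≡m%n (m ∸ n) n)) (cong (_% n) (ℕₚ.m∸n+n≡m n≤m))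

digit : ℕ → ℕ → Bool
digit x p = 2 ^ p ≤ᵇ x mod2^ suc p

low : ∀ p → ℕ → Vec Bool p
low p x = monomial p (digit x)

val-low : ∀ p x → val (low p x) ≡ x mod2^ p
val-low zero    x = sym (DivMod.n%1≡0 x)
val-low (suc p) x with 2 ^ p ℕ.≤? x mod2^ suc p
... | yes h rewrite ≤ᵇ-true h = trans (cong (λ m → 2 ^ p + m) (trans (val-low p x) reduce)) (ℕₚ.m+[n∸m]≡n h)
  where
  y = x mod2^ suc p
  y∸< : y ∸ 2 ^ p < 2 ^ p
  y∸< = ℕₚ.+-cancelˡ-< (2 ^ p) _ _ (subst₂ _<_ (sym (ℕₚ.m+[n∸m]≡n h)) (sym (double (2 ^ p))) (mod2^-< x (suc p)))
  reduce : x mod2^ p ≡ y ∸ 2 ^ p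
  reduce = trans (sym (mod2^-suc x p)) (trans (sym (mod-∸ {{m^n≢0 2 p}} h)) (mod2^-small p y∸<))
... | no ¬h rewrite ≤ᵇ-false (ℕₚ.≰⇒> ¬h) = trans (val-low p x)
  (trans (sym (mod2^-suc x p)) (mod2^-small p (ℕₚ.≰⇒> ¬h)))

low-val : ∀ {p} (X : Vec Bool p) → low p (val X) ≡ X
low-val {p} X = val-injective _ X (trans (val-low p (val X)) (mod2^-small p (val< X)))

val-low< : ∀ {p x} → x < 2 ^ p → val (low p x) ≡ x
val-low< {p} {x} x< = trans (val-low p x) (mod2^-small p x<)

one-val : ∀ {p} (X : Vec Bool p) → one X ≡ bit (val X ≡ᵇ 0)
one-val []          = refl
one-val (false ∷ X) = one-val X
one-val {suc p} (true ∷ X) with 2 ^ p + val X | ≤-trans (m^n>0 2 p) (m≤m+n (2 ^ p) (val X))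
... | suc _ | _ = refl

val-initial : ∀ K k → k ≤ K → suc (val (monomial K (_<ᵇ k))) ≡ 2 ^ k
val-initial zero    zero    _ = refl
val-initial (suc K) k       h with k ℕ.≤? K
... | yes k≤K rewrite <ᵇ-false k≤K = val-initial K k k≤K
... | no  k≰K with ℕₚ.≤-antisym h (ℕₚ.≰⇒> k≰K)
...   | refl rewrite <ᵇ-true (n<1+n K) = trans (sym (+-suc (2 ^ K) _))
  (trans (cong (λ m → 2 ^ K + m) (trans (cong (suc ∘ val) (monomial-cong K (λ p p<K →
    trans (<ᵇ-true (m<n⇒m<1+n p<K)) (sym (<ᵇ-true p<K))))) (val-initial K K ≤-refl))) (double (2 ^ K)))

-- wedge a T at the monomial with number x, computed from the lowest
-- generator upwards; T is indexed by numbers.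
wedgeN : (ℕ → ℤ) → (ℕ → ℤ) → ℕ → ℕ → ℤ
wedgeN a T x zero    = 0ℤ
wedgeN a T x (suc p) = if digit x p then a p *ℤ T (x ∸ 2 ^ p) -ℤ wedgeN a T x p else wedgeN a T x p

-- The offset `o` is the value of the digits above `p` that `T` still sees.
wedgeN-wedge : ∀ a T x p o → o + val (low p x) ≡ x →
               wedgeN a T x p ≡ wedge a (λ Y → T (o + val Y)) (low p x)
wedgeN-wedge a T x zero    o e = refl
wedgeN-wedge a T x (suc p) o e with digit x p
... | false = wedgeN-wedge a T x p o e
... | true  = cong₂ (λ m w → a p *ℤ T m -ℤ w) lower
  (trans (wedgeN-wedge a T x p (o + 2 ^ p) (trans (+-assoc o (2 ^ p) _) e))
    (wedge-congʳ a (λ Y → cong T (+-assoc o (2 ^ p) (val Y))) (low p x)))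
  where
  lower : x ∸ 2 ^ p ≡ o + val (low p x)
  lower = trans (cong (_∸ 2 ^ p) (trans (sym e) (rearrange o (2 ^ p) (val (low p x))))) (ℕₚ.m+n∸n≡m _ (2 ^ p))
    where
    rearrange : ∀ a b c → a + (b + c) ≡ (a + c) + b
    rearrange = ℕ-Ring.solve-∀

-- Reading the instance

columns : ℤ → ℕ
columns (+ l)     = suc l
columns -[1+ _ ]  = 0

positive?-suc : ∀ {m} → 0 < m → positive? (+ m) ≡ true
positive?-suc (s≤s _) = refl

positive?-⊖ : ∀ m n → positive? (+ n -ℤ + m) ≡ (m <ᵇ n)
positive?-⊖ m n with m ℕ.<? n
... | yes m<n rewrite ℤₚ.m-n≡m⊖n n m | ℤₚ.⊖-≥ (<⇒≤ m<n) | <ᵇ-true m<n = positive?-suc (ℕₚ.m<n⇒0<n∸m m<n)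
... | no  m≮n rewrite ℤₚ.m-n≡m⊖n n m | ℤₚ.⊖-≤ (≮⇒≥ m≮n) | <ᵇ-false (≮⇒≥ m≮n) = negative (m ∸ n)
  where
  negative : ∀ k → positive? (-ℤ + k) ≡ false
  negative zero    = refl
  negative (suc _) = refl

∸-ℤ : ∀ {m n} → m ≤ n → + n -ℤ + m ≡ + (n ∸ m)
∸-ℤ {m} {n} m≤n = trans (ℤₚ.m-n≡m⊖n n m) (ℤₚ.⊖-≥ m≤n)

address : ∀ q → -1ℤ -ℤ + q ≡ -[1+ q ]
address zero    = refl
address (suc q) = refl

reduceBy : ℕ → ℕ → ℕ → ℕ
reduceBy m x zero    = x
reduceBy m x (suc i) = if reduceBy m x i <ᵇ m then reduceBy m x i else reduceBy m x i ∸ m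

-- Every subtraction lowers the value by at least 1, so `x` turns bring it below `m`, and none
-- changes the residue.
reduceBy-% : ∀ m {{_ : NonZero m}} x → reduceBy m x x ≡ x % m
reduceBy-% m x = trans (sym (DivMod.m<n⇒m%n≡m small)) (residue x)
  where
  residue : ∀ i → reduceBy m x i % m ≡ x % m
  residue zero    = refl
  residue (suc i) with reduceBy m x i ℕ.<? m
  ... | yes h rewrite <ᵇ-true h = residue i
  ... | no  h rewrite <ᵇ-false (≮⇒≥ h) = trans (mod-∸ (≮⇒≥ h)) (residue i)
  progress : ∀ i → reduceBy m x i < m ⊎ reduceBy m x i + i ≤ x
  progress zero    = inj₂ (≤-reflexive (+-identityʳ x))
  progress (suc i) with reduceBy m x i ℕ.<? m | progress i
  ... | yes h | _      rewrite <ᵇ-true h = inj₁ h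
  ... | no  h | inj₁ g = contradiction g h
  ... | no  h | inj₂ g rewrite <ᵇ-false (≮⇒≥ h) = inj₂ (≤-trans (≤-reflexive (+-suc _ i))
    (≤-trans (ℕₚ.+-monoˡ-≤ i (ℕₚ.∸-monoʳ-< {o = 0} (ℕ.>-nonZero⁻¹ m) (≮⇒≥ h))) g))
  small : reduceBy m x x < m
  small with progress x
  ... | inj₁ h = h
  ... | inj₂ h = subst (_< m) (sym (ℕₚ.n≤0⇒n≡0 (ℕₚ.+-cancelʳ-≤ x _ 0 h))) (ℕ.>-nonZero⁻¹ m)

nth-here : ∀ {m} (f : Fin m → ℤ) ys i → nth (tabulate f ++ ys) (toℕ i) ≡ f i
nth-here f ys Fin.zero    = refl
nth-here f ys (Fin.suc i) = nth-here (f ∘ Fin.suc) ys i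

nth-skip : ∀ {m} (f : Fin m → ℤ) ys q → nth (tabulate f ++ ys) (m + q) ≡ nth ys q
nth-skip {zero}  f ys q = refl
nth-skip {suc m} f ys q = nth-skip (f ∘ Fin.suc) ys q

nth-concat : ∀ {m n} (g : Fin m → Fin n → ℤ) u v → nth (concat (tabulate (λ u → tabulate (g u)))) (toℕ u * n + toℕ v) ≡ g u v
nth-concat         g Fin.zero    v = nth-here (g Fin.zero) _ v
nth-concat {n = n} g (Fin.suc u) v = trans
  (cong (nth (tabulate (g Fin.zero) ++ _)) (+-assoc n (toℕ u * n) (toℕ v)))
  (trans (nth-skip (g Fin.zero) _ _) (nth-concat (g ∘ Fin.suc) u v))

module Reading (I : Instance) where
  open Instance I public

  K : ℕ
  K = columns ℓ

  inp : ℕ → ℤ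
  inp = nth (encode I)

  lower upper : ℕ → ℤ
  lower i = inp (5 + i)
  upper i = inp (5 + c + i)

  chi : ℕ → ℕ
  chi v = ∣ inp (5 + c + c + v) ∣

  ent : ℕ → ℕ → ℕ
  ent u v = ∣ inp (5 + c + c + n + u * n + v) ∣

  -- If β i is negative then requiring one vertex of color i makes the instance infeasible.
  need cap : ℕ → ℕ
  need i = if positive? (0ℤ -ℤ upper i) then 1 else (if positive? (lower i) then ∣ lower i ∣ else 0)
  cap i  = if positive? (upper i) then ∣ upper i ∣ else 0

  lower-α : ∀ i → lower (toℕ i) ≡ α i
  lower-α i = nth-here α _ i

  upper-β : ∀ i → upper (toℕ i) ≡ β i
  upper-β i = trans (nth-skip α _ (toℕ i)) (nth-here β _ i)

  inp-χ : ∀ v → inp (5 + c + c + toℕ v) ≡ + toℕ (χ v)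
  inp-χ v = trans (cong (λ q → inp (5 + q)) (+-assoc c c (toℕ v)))
    (trans (nth-skip α _ (c + toℕ v)) (trans (nth-skip β _ (toℕ v)) (nth-here _ _ v)))

  chi-χ : ∀ v → chi (toℕ v) ≡ toℕ (χ v)
  chi-χ v = cong ∣_∣ (inp-χ v)

  weight? : Fin n → Fin n → ℕ
  weight? u v with T? (A u v)
  ... | yes a = w a
  ... | no  _ = 0

  private
    -- The matrix entries come from a function local to `encode`; the right-hand side is inferred,
    -- and the case distinction in `inp-w` evaluates it.
    entry-at : ∀ u v → inp (5 + c + c + n + toℕ u * n + toℕ v) ≡ _
    entry-at u v = trans (cong (λ q → inp (5 + q)) (trans (+-assoc (c + c + n) (toℕ u * n) (toℕ v))
      (trans (+-assoc (c + c) n _) (+-assoc c c _))))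
      (trans (nth-skip α _ (c + (n + (toℕ u * n + toℕ v)))) (trans (nth-skip β _ (n + (toℕ u * n + toℕ v)))
        (trans (nth-skip (λ v → + toℕ (χ v)) _ (toℕ u * n + toℕ v)) (nth-concat {n} {n} _ u v))))

  inp-w : ∀ u v → inp (5 + c + c + n + toℕ u * n + toℕ v) ≡ + weight? u v
  inp-w u v with T? (A u v) | entry-at u v
  ... | yes a | e = e
  ... | no  _ | e = e

  ent-w : ∀ u v → ent (toℕ u) (toℕ v) ≡ weight? u v
  ent-w u v = cong ∣_∣ (inp-w u v)

  on-range : ∀ {m} {P : ℕ → Set} → (∀ (i : Fin m) → P (toℕ i)) → ∀ {i} → i < m → P i
  on-range {P = P} f i<m = subst P (Finₚ.toℕ-fromℕ< i<m) (f (fromℕ< i<m))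

  chi-inp : ∀ {v} → v < n → inp (5 + c + c + v) ≡ + chi v
  chi-inp = on-range (λ v → trans (inp-χ v) (cong +_ (sym (chi-χ v))))

  chi<c : ∀ {v} → v < n → chi v < c
  chi<c = on-range (λ v → subst (_< c) (sym (chi-χ v)) (Finₚ.toℕ<n (χ v)))

  ent-inp : ∀ {u v} → u < n → v < n → inp (5 + c + c + n + u * n + v) ≡ + ent u v
  ent-inp {u} {v} u<n v<n = on-range {P = λ u → inp (5 + c + c + n + u * n + v) ≡ + ent u v}
    (λ u → on-range {P = λ v → inp (5 + c + c + n + toℕ u * n + v) ≡ + ent (toℕ u) v}
      (λ v → trans (inp-w u v) (cong +_ (sym (ent-w u v)))) v<n) u<n

  s<n : toℕ s < n
  s<n = Finₚ.toℕ<n s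

  t<n : toℕ t < n
  t<n = Finₚ.toℕ<n t

  open Sieve n c K (toℕ s) ent chi need cap public

-- Correctness of the expressions

module Correct (I : Instance) (r : ℕ) {{r≢0 : NonZero r}} (h : ℕ → Bool) where
  open Reading I hiding (w; A; α; β)
  open Code r

  instance
    Wd≢0 : NonZero Wd
    Wd≢0 = ℕ.>-nonZero (<-≤-trans (≤-<-trans z≤n s<n) (≤-trans (m≤n+m n K) (m≤m+n _ c)))

  sc : Scale
  sc = record { W = Wd ; r = r ; E = 2 ^ K ; E≢0 = m^n≢0 2 K }

  open Eval sc

  Nv B NB : ℕ
  Nv = 3 * Wd * Wd * Wd
  B  = r + Nv * (3 * K)
  NB = Nv * B

  z : ℕ → ℤ
  z i = horner B (λ q → bit (h (i * B + q)))

  open Weighted z using (F; S; wedge-a) renaming (y to y′; g to g′; b to b′; a to a′)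

  K≤W : K ≤ Wd
  K≤W = ≤-trans (m≤m+n K n) (m≤m+n _ c)
  n≤W : n ≤ Wd
  n≤W = ≤-trans (m≤n+m n K) (m≤m+n _ c)
  c≤W : c ≤ Wd
  c≤W = m≤n+m c (K + n)

  Inputs Bits : World → Set
  Inputs w = ∀ i → mem (proj₂ w) (+ i) ≡ inp i
  Bits w   = ∀ q → q < NB → mem (proj₂ w) -[1+ q ] ≡ bit (h q)

  Inputs-up : ∀ {v w} → v ⊑ w → Inputs v → Inputs w
  Inputs-up (_ , e) m i = trans (mems e (+ i)) (m i)

  Bits-up : ∀ {v w} → v ⊑ w → Bits v → Bits w
  Bits-up (_ , e) m q q< = trans (mems e -[1+ q ]) (m q q<)

  private
    variable
      u v w : World
      a b e x y : Expr
      V U : ℤ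
      i j k m p q L : ℕ

  deg≤ : ∀ c d {m} → m ≤ c * Wd ^ d → m ≤ ⟦ sc ⟧ (bound c d 0 0)
  deg≤ c d h = ≤-trans h (≤-reflexive (trans (ℕₚ.*-comm c (Wd ^ d)) (cong (_* c) (sym (ℕₚ.*-identityʳ (Wd ^ d))))))

  ≤W¹ : m ≤ Wd → m ≤ ⟦ sc ⟧ W¹
  ≤W¹ h = deg≤ 1 1 (≤-trans h (≤-reflexive (sym (trans (ℕₚ.*-identityˡ _) (ℕₚ.*-identityʳ Wd)))))

  ≤2^K : m ≤ 2 ^ K → m ≤ ⟦ sc ⟧ (bound 1 0 0 1)
  ≤2^K h = ≤-trans h (≤-reflexive (sym (simplify (2 ^ K))))
    where
    simplify : ∀ e → 1 * (1 * (e * 1)) * 1 ≡ e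
    simplify = ℕ-Ring.solve-∀

  ⇓-≡ : V ≡ U → w ⊢ e ⇓ V → w ⊢ e ⇓ U
  ⇓-≡ refl p = p

  ⇓-n : Inputs w → w ⊢ nE ⇓ + n
  ⇓-n m = ⇓-at ⇓-lit (m 0)

  ⇓-c : Inputs w → w ⊢ cE ⇓ + c
  ⇓-c m = ⇓-at ⇓-lit (m 1)

  ⇓-s : Inputs w → w ⊢ sE ⇓ + toℕ s
  ⇓-s m = ⇓-at ⇓-lit (m 2)

  ⇓-t : Inputs w → w ⊢ tE ⇓ + toℕ t
  ⇓-t m = ⇓-at ⇓-lit (m 3)

  ⇓-K : Inputs w → w ⊢ KE ⇓ + K
  ⇓-K {w} m = ⇓-ifp ℓ+1 (λ pos → ⇓-≡ (on ℓ pos) ℓ+1) (λ neg → ⇓-≡ (off ℓ neg) ⇓-lit)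
    where
    ℓ+1 : w ⊢ ℓE ⊕ lit (+ 1) ⇓ ℓ +ℤ + 1
    ℓ+1 = ⇓-⊕ (⇓-at ⇓-lit (m 4)) ⇓-lit
    on : ∀ ℓ → positive? (ℓ +ℤ + 1) ≡ true → ℓ +ℤ + 1 ≡ + columns ℓ
    on (+ l)          _ = cong +_ (+-comm l 1)
    on -[1+ zero ]    ()
    on -[1+ suc _ ]   ()
    off : ∀ ℓ → positive? (ℓ +ℤ + 1) ≡ false → 0ℤ ≡ + columns ℓ
    off (+ l) e rewrite +-comm l 1 = case e of λ ()
    off -[1+ _ ] _ = refl

  ⇓-W : Inputs w → w ⊢ WE ⇓ + Wd
  ⇓-W m = ⇓-⊕ (⇓-⊕ (⇓-K m) (⇓-n m)) (⇓-c m)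

  ⇓-mul : ∀ bd → m ≤ ⟦ sc ⟧ bd → w ⊢ x ⇓ + m → w ⊢ y ⇓ + k → w ⊢ mulE bd x y ⇓ + (m * k)
  ⇓-mul {k = k} bd m≤ px py = ⇓-iter m≤ (λ i → + (i * k)) px ⇓-lit
    (λ {i} _ le pa _ → ⇓-≡ (cong +_ (+-comm (i * k) k)) (⇓-⊕ pa (⇓-up le py)))

  ⇓-lt : w ⊢ x ⇓ + m → w ⊢ y ⇓ + k → (m < k → w ⊢ a ⇓ V) → (k ≤ m → w ⊢ b ⇓ V) → w ⊢ ltE x y a b ⇓ V
  ⇓-lt {m = m} {k = k} px py pa pb = ⇓-ifp (⇓-⊖ py px)
    (λ e → pa (<ᵇ⁻ (trans (sym (positive?-⊖ m k)) e)))
    (λ e → pb (≮⇒≥ (λ m<k → case trans (sym (<ᵇ-true m<k)) (trans (sym (positive?-⊖ m k)) e) of λ ())))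

  ⇓-pred : m ≤ k → w ⊢ x ⇓ + k → w ⊢ y ⇓ + m → w ⊢ x ⊖ y ⇓ + (k ∸ m)
  ⇓-pred m≤k px py = ⇓-≡ (∸-ℤ m≤k) (⇓-⊖ px py)

  ⇓-lower : Inputs w → w ⊢ x ⇓ + i → w ⊢ αE x ⇓ lower i
  ⇓-lower {i = i} m px = ⇓-at (⇓-⊕ ⇓-lit px) (m (5 + i))

  ⇓-upper : Inputs w → w ⊢ x ⇓ + i → w ⊢ βE x ⇓ upper i
  ⇓-upper {i = i} m px = ⇓-at (⇓-⊕ (⇓-⊕ ⇓-lit (⇓-c m)) px) (m (5 + c + i))

  ⇓-chi : Inputs w → i < n → w ⊢ x ⇓ + i → w ⊢ χE x ⇓ + chi i
  ⇓-chi {i = i} m i<n px = ⇓-at (⇓-⊕ (⇓-⊕ (⇓-⊕ ⇓-lit (⇓-c m)) (⇓-c m)) px)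
    (trans (m (5 + c + c + i)) (chi-inp i<n))

  ⇓-ent : Inputs w → i < n → j < n → w ⊢ x ⇓ + i → w ⊢ y ⇓ + j → w ⊢ entE x y ⇓ + ent i j
  ⇓-ent {i = i} {j} m i<n j<n px py = ⇓-at
    (⇓-⊕ (⇓-⊕ (⇓-⊕ (⇓-⊕ (⇓-⊕ ⇓-lit (⇓-c m)) (⇓-c m)) (⇓-n m))
      (⇓-mul W¹ (≤W¹ (≤-trans (<⇒≤ i<n) n≤W)) px (⇓-n m))) py)
    (trans (m (5 + c + c + n + i * n + j)) (ent-inp i<n j<n))

  ⇓-need : Inputs w → w ⊢ x ⇓ + i → w ⊢ needE x ⇓ + need i
  ⇓-need {i = i} m px = ⇓-ifp (⇓-⊖ ⇓-lit (⇓-upper m px))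
    (λ e → ⇓-≡ (cong (λ d → needed d (positive? (lower i))) (sym e)) ⇓-lit)
    (λ e → ⇓-ifp (⇓-lower m px)
      (λ e′ → ⇓-≡ (trans (abs (lower i) e′) (sym (cong₂ needed e e′))) (⇓-lower m px))
      (λ e′ → ⇓-≡ (sym (cong₂ needed e e′)) ⇓-lit))
    where
    needed : Bool → Bool → ℤ
    needed d d′ = + (if d then 1 else (if d′ then ∣ lower i ∣ else 0))
    abs : ∀ k → positive? k ≡ true → k ≡ + ∣ k ∣
    abs (+ _)    _ = refl

  ⇓-pre : Inputs w → i ≤ Wd → w ⊢ x ⇓ + i → w ⊢ preE x ⇓ + pre i
  ⇓-pre m i≤W px = ⇓-iter (≤W¹ i≤W) (λ i → + pre i) px ⇓-lit
    (λ _ le pa pj → ⇓-⊕ pa (⇓-need (Inputs-up le m) pj))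

  ⇓-pow : p ≤ Wd → w ⊢ x ⇓ + p → w ⊢ powE x ⇓ + (2 ^ p)
  ⇓-pow p≤W px = ⇓-iter (≤W¹ p≤W) (λ i → + (2 ^ i)) px ⇓-lit
    (λ {i} _ _ pa _ → ⇓-≡ (cong +_ (double (2 ^ i))) (⇓-⊕ pa pa))

  ⇓-allowed : Inputs w → i < c → w ⊢ x ⇓ + i → w ⊢ y ⇓ + p →
    (allowed i p ≡ true → w ⊢ a ⇓ V) → (allowed i p ≡ false → w ⊢ b ⇓ V) → w ⊢ allowedE x y a b ⇓ V
  ⇓-allowed {i = i} {p = p} m i<c px py pa pb =
    ⇓-lt (⇓-pre m c≤W (⇓-c m)) (p+1) (λ h → pa (cong (_∨ reserved i p) (≤ᵇ-true (below h))))
      (λ h → ⇓-lt (⇓-pre m (≤-trans (<⇒≤ i<c) c≤W) px) p+1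
        (λ h₁ → ⇓-lt py (⇓-pre m (≤-trans (≤-reflexive (+-comm i 1)) (≤-trans i<c c≤W)) (⇓-⊕ px ⇓-lit))
          (λ h₂ → pa (combine (≤ᵇ-false (above h)) (≤ᵇ-true (below h₁)) (<ᵇ-true (subst (λ j → p < pre j) (+-comm i 1) h₂))))
          (λ h₂ → pb (combine (≤ᵇ-false (above h)) (≤ᵇ-true (below h₁)) (<ᵇ-false (subst (λ j → pre j ≤ p) (+-comm i 1) h₂)))))
        (λ h₁ → pb (cong₂ (λ d d′ → d ∨ (d′ ∧ (p <ᵇ pre (suc i)))) (≤ᵇ-false (above h)) (≤ᵇ-false (above h₁)))))
    where
    p+1 = ⇓-⊕ py ⇓-lit
    below : ∀ {q} → q < p + 1 → q ≤ p
    below {q} h = ≤-pred (subst (q <_) (+-comm p 1) h)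
    above : ∀ {q} → p + 1 ≤ q → p < q
    above {q} h = subst (_≤ q) (+-comm p 1) h
    combine : ∀ {d₁ d₂} → (pre c ≤ᵇ p) ≡ false → (pre i ≤ᵇ p) ≡ d₁ → (p <ᵇ pre (suc i)) ≡ d₂ → allowed i p ≡ d₁ ∧ d₂
    combine e e₁ e₂ = cong₂ _∨_ e (cong₂ _∧_ e₁ e₂)

  extend-< : ∀ {M} → m < M → p < k → m * k + p < M * k
  extend-< {m} {p} {k} m<M p<k = <-≤-trans (ℕₚ.+-monoʳ-< (m * k) p<k)
    (≤-trans (≤-reflexive (+-comm (m * k) k)) (*-monoˡ-≤ k m<M))

  key< : ∀ {tag} → tag < 3 → p < Wd → q < Wd → k < Wd → key tag p q k < Nv
  key< t p q k = extend-< (extend-< (extend-< t p) q) k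

  ⇓-key : ∀ {tag} → tag < 3 → Inputs w → p < Wd → q < Wd → w ⊢ x ⇓ + p → w ⊢ y ⇓ + q → w ⊢ e ⇓ + k →
          w ⊢ keyE tag x y e ⇓ + key tag p q k
  ⇓-key {p = p} {q = q} {k = k} {tag = tag} tag<3 m p<W q<W px py pe =
    ⇓-⊕ {x = + (((tag * Wd + p) * Wd + q) * Wd)} {y = + k}
      (⇓-mul {m = (tag * Wd + p) * Wd + q} (bound 3 2 0 0) (deg≤ 3 2 (square (<⇒≤ (extend-< (extend-< tag<3 p<W) q<W))))
        (⇓-⊕ {x = + ((tag * Wd + p) * Wd)} {y = + q}
          (⇓-mul {m = tag * Wd + p} (bound 3 1 0 0) (deg≤ 3 1 (linear (<⇒≤ (extend-< tag<3 p<W))))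
            (⇓-⊕ {x = + (tag * Wd)} {y = + p}
              (⇓-mul {m = tag} (# 3) (≤-trans (<⇒≤ tag<3) (#≤ sc 3)) ⇓-lit (⇓-W m)) px)
            (⇓-W m)) py)
        (⇓-W m)) pe
    where
    linear : ∀ {m} → m ≤ 3 * Wd → m ≤ 3 * Wd ^ 1
    linear h = ≤-trans h (≤-reflexive (cong (3 *_) (sym (ℕₚ.*-identityʳ Wd))))
    square : ∀ {m} → m ≤ 3 * Wd * Wd → m ≤ 3 * Wd ^ 2
    square h = ≤-trans h (≤-reflexive (trans (ℕₚ.*-assoc 3 Wd Wd) (cong (λ k → 3 * (Wd * k)) (sym (ℕₚ.*-identityʳ Wd)))))

  Nv≤ : Nv ≤ ⟦ sc ⟧ (bound 3 3 0 0)
  Nv≤ = deg≤ 3 3 (≤-reflexive (cube Wd))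
    where
    cube : ∀ w → 3 * w * w * w ≡ 3 * (w * (w * (w * 1)))
    cube = ℕ-Ring.solve-∀

  ⇓-Nv : Inputs w → w ⊢ NvE ⇓ + Nv
  ⇓-Nv m = ⇓-mul (bound 3 2 0 0) (deg≤ 3 2 (≤-reflexive (square Wd)))
    (⇓-mul (bound 3 1 0 0) (deg≤ 3 1 (≤-reflexive (linear Wd))) (⇓-mul (# 3) (#≤ sc 3) ⇓-lit (⇓-W m)) (⇓-W m)) (⇓-W m)
    where
    linear : ∀ w → 3 * w ≡ 3 * (w * 1)
    linear = ℕ-Ring.solve-∀
    square : ∀ w → 3 * w * w ≡ 3 * (w * (w * 1))
    square = ℕ-Ring.solve-∀

  ⇓-B : Inputs w → w ⊢ BE ⇓ + B
  ⇓-B m = ⇓-⊕ ⇓-lit (⇓-mul (bound 3 3 0 0) Nv≤ (⇓-Nv m) (⇓-mul (# 3) (#≤ sc 3) ⇓-lit (⇓-K m)))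

  ⇓-NB : Inputs w → w ⊢ NBE ⇓ + NB
  ⇓-NB m = ⇓-mul (bound 3 3 0 0) Nv≤ (⇓-Nv m) (⇓-B m)

  B≤ : B ≤ ⟦ sc ⟧ (bound 10 4 1 0)
  B≤ = ⟦⊞⟧-≤ sc (bound 1 0 1 0) (bound 9 4 0 0) (≤-reflexive (sym (one-r r)))
    (deg≤ 9 4 (≤-trans (*-monoʳ-≤ Nv (*-monoʳ-≤ 3 K≤W)) (≤-reflexive (fourth Wd))))
    where
    one-r : ∀ r → 1 * (r * 1 * 1) * 1 ≡ r
    one-r = ℕ-Ring.solve-∀
    fourth : ∀ w → 3 * w * w * w * (3 * w) ≡ 9 * (w * (w * (w * (w * 1))))
    fourth = ℕ-Ring.solve-∀

  ⇓-times : Inputs w → Bits w → i < Nv → w ⊢ x ⇓ + i → w ⊢ e ⇓ U → w ⊢ timesE x e ⇓ z i *ℤ U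
  ⇓-times {i = i} {U = U} m bits i<N px pe = ⇓-let pe (λ le₁ pT →
    ⇓-let (⇓-mul (bound 3 3 0 0) (≤-trans (<⇒≤ i<N) Nv≤) (⇓-up le₁ px) (⇓-B (Inputs-up le₁ m))) (λ le₂ pbase →
      ⇓-iter B≤ (λ q → horner q bitAt *ℤ U) (⇓-B (Inputs-up (⊑-trans le₁ le₂) m)) ⇓-lit
        (λ {q} q<B le₃ pacc pq → ⇓-≡ (horner-step (horner q bitAt) U (h (i * B + q)))
          (⇓-⊕ (⇓-⊕ pacc pacc) (⇓-ifp
            (⇓-at (⇓-≡ (address (i * B + q)) (⇓-⊖ ⇓-lit (⇓-⊕ (⇓-up le₃ pbase) pq)))
              (Bits-up (⊑-trans le₁ (⊑-trans le₂ le₃)) bits (i * B + q) (extend-< i<N q<B)))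
            (λ e′ → ⇓-≡ (sym (cong (λ d → if d then U else 0ℤ) (bit-true (h (i * B + q)) e′)))
              (⇓-up (⊑-trans le₂ le₃) pT))
            (λ e′ → ⇓-≡ (sym (cong (λ d → if d then U else 0ℤ) (bit-false (h (i * B + q)) e′))) ⇓-lit))))))
    where
    bitAt : ℕ → ℤ
    bitAt q = bit (h (i * B + q))
    bit-true : ∀ d → positive? (bit d) ≡ true → d ≡ true
    bit-true true _ = refl
    bit-false : ∀ d → positive? (bit d) ≡ false → d ≡ false
    bit-false false _ = refl
    horner-step : ∀ H U d → H *ℤ U +ℤ H *ℤ U +ℤ (if d then U else 0ℤ) ≡ (H +ℤ H +ℤ bit d) *ℤ U
    horner-step H U true  = ring H U
      where
      ring : ∀ H U → H *ℤ U +ℤ H *ℤ U +ℤ U ≡ (H +ℤ H +ℤ + 1) *ℤ U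
      ring = ℤ-Ring.solve-∀
    horner-step H U false = ring H U
      where
      ring : ∀ H U → H *ℤ U +ℤ H *ℤ U +ℤ + 0 ≡ (H +ℤ H +ℤ + 0) *ℤ U
      ring = ℤ-Ring.solve-∀

  ⇓-mod : p < Wd → m < 2 ^ K → w ⊢ x ⇓ + p → w ⊢ y ⇓ + m → w ⊢ modE x y ⇓ + (m mod2^ suc p)
  ⇓-mod {p = p} {m = m} p<W m< px py = ⇓-let (⇓-pow (≤-trans (≤-reflexive (+-comm p 1)) p<W) (⇓-⊕ px ⇓-lit))
    (λ le pm → ⇓-≡ (cong +_ (trans (cong (λ k → reduceBy (2 ^ k) m m) (+-comm p 1)) (reduceBy-% (2 ^ suc p) {{m^n≢0 2 (suc p)}} m)))
      (⇓-iter (≤2^K (<⇒≤ m<)) (λ i → + reduceBy (2 ^ (p + 1)) m i) (⇓-up le py) (⇓-up le py)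
        (λ {i} _ le′ pa _ → ⇓-lt pa (⇓-up le′ pm)
          (λ h → ⇓-≡ (cong (next i) (sym (<ᵇ-true h))) pa)
          (λ h → ⇓-≡ (cong (next i) (sym (<ᵇ-false h))) (⇓-pred h pa (⇓-up le′ pm))))))
    where
    next : ℕ → Bool → ℤ
    next i d = + (if d then reduceBy (2 ^ (p + 1)) m i else reduceBy (2 ^ (p + 1)) m i ∸ 2 ^ (p + 1))

  ⇓-digit : p < Wd → m < 2 ^ K → w ⊢ x ⇓ + p → w ⊢ y ⇓ + m →
    (digit m p ≡ true → w ⊢ a ⇓ V) → (digit m p ≡ false → w ⊢ b ⇓ V) → w ⊢ digitE x y a b ⇓ V
  ⇓-digit p<W m< px py pa pb = ⇓-lt (⇓-mod p<W m< px py) (⇓-pow (<⇒≤ p<W) px)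
    (λ h → pb (≤ᵇ-false h)) (λ h → pa (≤ᵇ-true h))

  slotOf : ℕ → ℕ → ℕ → ℕ → ℕ
  slotOf k L v x = NB + (((k * K + L) * n + v) * 2 ^ K + x)

  ⇓-cell : Inputs w → k < K → L < K → i < n → w ⊢ x ⇓ + k → w ⊢ y ⇓ + L → w ⊢ a ⇓ + i → w ⊢ b ⇓ + m →
           w ⊢ cellE x y a b ⇓ -[1+ slotOf k L i m ]
  ⇓-cell {k = k} {L = L} {i = i} {m = m} inputs k<K L<K i<n px py pa pb = ⇓-≡ (address (slotOf k L i m))
    (⇓-⊖ ⇓-lit (⇓-⊕ (⇓-NB inputs) (⇓-⊕
      (⇓-mul {m = (k * K + L) * n + i} (bound 1 3 0 0) (deg≤ 1 3 (≤-trans (<⇒≤ (extend-< (extend-< k<K L<K) i<n))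
          (≤-trans (*-mono-≤ (*-mono-≤ K≤W K≤W) n≤W) (≤-reflexive (cube Wd)))))
        (⇓-⊕ (⇓-mul {m = k * K + L} (bound 1 2 0 0) (deg≤ 1 2 (≤-trans (<⇒≤ (extend-< k<K L<K))
            (≤-trans (*-mono-≤ K≤W K≤W) (≤-reflexive (square Wd)))))
          (⇓-⊕ (⇓-mul {m = k} W¹ (≤W¹ (≤-trans (<⇒≤ k<K) K≤W)) px (⇓-K inputs)) py) (⇓-n inputs)) pa)
        (⇓-pow K≤W (⇓-K inputs))) pb)))
    where
    cube : ∀ w → w * w * w ≡ 1 * (w * (w * (w * 1)))
    cube = ℕ-Ring.solve-∀
    square : ∀ w → w * w ≡ 1 * (w * (w * 1))
    square = ℕ-Ring.solve-∀

  Filled : ℕ → World → Set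
  Filled k w = ∀ {k′ L u x} → k′ < k → L < K → u < n → x < 2 ^ K →
               mem (proj₂ w) -[1+ slotOf k′ L u x ] ≡ F k′ L u (low K x)

  Filled-up : v ⊑ w → Filled k v → Filled k w
  Filled-up (_ , e) f k′<k L<K u<n x< = trans (mems e _) (f k′<k L<K u<n x<)

  ⇓-S : k < K → L < K → i < n → m < 2 ^ K → Inputs w → Filled k w →
        w ⊢ x ⇓ + k → w ⊢ y ⇓ + L → w ⊢ a ⇓ + i → w ⊢ b ⇓ + m → w ⊢ SE x y a b ⇓ S k L i (low K m)
  ⇓-S {k = zero} {L = L} {i = i} {m = m} k<K L<K i<n m< inputs filled px py pa pb =
    ⇓-ifp px (λ ()) (λ _ → ⇓-≡ (sym base) (⇓-ifp py
      (λ e → ⇓-≡ (cong (λ d → if d ∧ (i ≡ᵇ toℕ s) then here? else 0ℤ) (sym (zero? L e))) ⇓-lit)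
      (λ e → subst (λ L → _ ⊢ _ ⇓ (if (L ≡ᵇ 0) ∧ (i ≡ᵇ toℕ s) then here? else 0ℤ)) (sym (zero! L e))
        (⇓-lt pa (⇓-s inputs) (λ h → ⇓-≡ (sym (unequal (<⇒≢ h))) ⇓-lit)
        (λ h₁ → ⇓-lt (⇓-s inputs) pa (λ h → ⇓-≡ (sym (unequal (ℕₚ.>⇒≢ h))) ⇓-lit)
        (λ h₂ → ⇓-≡ (cong (λ d → if d then here? else 0ℤ) (sym (dec-true (i ℕ.≟ toℕ s) (ℕₚ.≤-antisym h₂ h₁))))
          (⇓-ifp pb (λ e → ⇓-≡ (cong bit (sym (zero? m e))) ⇓-lit)
            (λ e → ⇓-≡ (cong (λ m → bit (m ≡ᵇ 0)) (sym (zero! m e))) ⇓-lit))))))))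
    where
    here? = bit (m ≡ᵇ 0)
    base : S 0 L i (low K m) ≡ (if (L ≡ᵇ 0) ∧ (i ≡ᵇ toℕ s) then here? else 0ℤ)
    base = cong (λ k → if (L ≡ᵇ 0) ∧ (i ≡ᵇ toℕ s) then k else 0ℤ) (trans (one-val (low K m)) (cong (λ m → bit (m ≡ᵇ 0)) (val-low< {K} m<)))
    zero? : ∀ m → positive? (+ m) ≡ true → (m ≡ᵇ 0) ≡ false
    zero? (suc m) _ = refl
    zero! : ∀ m → positive? (+ m) ≡ false → m ≡ 0
    zero! zero _ = refl
    unequal : i ≢ toℕ s → (if (i ≡ᵇ toℕ s) then here? else 0ℤ) ≡ 0ℤ
    unequal ne = cong (λ d → if d then here? else 0ℤ) (≢⇒≡ᵇ ne)
  ⇓-S {k = suc k} {L = L} {i = i} {m = m} k<K L<K i<n m< inputs filled px py pa pb =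
    ⇓-ifp px (λ _ → ⇓-iter (≤W¹ n≤W) (λ u → sumTo u term) (⇓-n inputs) ⇓-lit
      (λ {u} u<n le pacc pu → ⇓-⊕ pacc (⇓-let
        (⇓-ent (Inputs-up le inputs) u<n i<n pu (⇓-up le pa))
        (λ le′ pw → let le″ = ⊑-trans le le′ in ⇓-ifp pw
          (λ e → ⇓-lt (⇓-up le″ py) pw
            (λ h → ⇓-≡ (sym (cong₂ (λ d d′ → if d ∧ d′ then prev u else 0ℤ) (pos (ent u i) e) (≤ᵇ-false h))) ⇓-lit)
            (λ h → ⇓-≡ (sym (cong₂ (λ d d′ → if d ∧ d′ then prev u else 0ℤ) (pos (ent u i) e) (≤ᵇ-true h)))
              (⇓-at (⇓-cell (Inputs-up le″ inputs) (ℕₚ.<-trans (n<1+n k) k<K) (≤-<-trans (ℕₚ.m∸n≤m L (ent u i)) L<K) u<n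
                  (⇓-pred (s≤s z≤n) (⇓-up le″ px) ⇓-lit) (⇓-pred h (⇓-up le″ py) pw) (⇓-up le′ pu) (⇓-up le″ pb))
                (Filled-up {k = suc k} le″ filled (n<1+n k) (≤-<-trans (ℕₚ.m∸n≤m L (ent u i)) L<K) u<n m<))))
          (λ e → ⇓-≡ (sym (cong (λ d → if d ∧ (ent u i ≤ᵇ L) then prev u else 0ℤ) (npos (ent u i) e))) ⇓-lit)))))
      (λ ())
    where
    prev term : ℕ → ℤ
    prev u = F k (L ∸ ent u i) u (low K m)
    term u = if (0 <ᵇ ent u i) ∧ (ent u i ≤ᵇ L) then prev u else 0ℤ
    pos : ∀ k → positive? (+ k) ≡ true → (0 <ᵇ k) ≡ true
    pos (suc _) _ = refl
    npos : ∀ k → positive? (+ k) ≡ false → (0 <ᵇ k) ≡ false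
    npos zero _ = refl

  ⇓-wedge : k < K → L < K → i < n → m < 2 ^ K → j < K → Inputs w → Bits w → Filled k w →
    w ⊢ x ⇓ + k → w ⊢ y ⇓ + L → w ⊢ a ⇓ + i → w ⊢ b ⇓ + m → w ⊢ e ⇓ + j →
    w ⊢ wedgeE x y a b e ⇓ wedge (b′ (chi i) j) (S k L i) (low K m)
  ⇓-wedge {k = k} {L = L} {i = i} {m = m} {j = j} {w = w} {e = e} k<K L<K i<n m< j<K inputs bits filled px py pa pb pe =
    ⇓-≡ numeric (⇓-iter (≤W¹ K≤W) (wedgeN (b′ (chi i) j) Tn m) (⇓-K inputs) ⇓-lit body)
    where
    Tn : ℕ → ℤ
    Tn x = S k L i (low K x)
    numeric : wedgeN (b′ (chi i) j) Tn m K ≡ wedge (b′ (chi i) j) (S k L i) (low K m)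
    numeric = trans (wedgeN-wedge _ Tn m K 0 (val-low< {K} m<)) (wedge-congʳ _ (λ Y → cong (S k L i) (low-val Y)) (low K m))
    body : ∀ {p} → p < K → ∀ {v} → w ⊑ v → ∀ {c q} → v ⊢ var c ⇓ wedgeN (b′ (chi i) j) Tn m p → v ⊢ var q ⇓ + p → v ⊢ _ ⇓ _
    body {p} p<K le pacc pp = ⇓-digit p<W m< pp (⇓-up le pb)
      (λ on → ⇓-≡ (cong branch (sym on))
        (⇓-⊖ (⇓-allowed (Inputs-up le inputs) (chi<c i<n) color pp
          (λ al → ⇓-≡ (cong guarded (sym al))
            (⇓-times (Inputs-up le inputs) (Bits-up le bits) (key< ≤-refl chi<W j<W p<W)
              (⇓-key ≤-refl (Inputs-up le inputs) chi<W j<W color (⇓-up le pe) pp)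
              (⇓-S k<K L<K i<n (≤-<-trans (ℕₚ.m∸n≤m m (2 ^ p)) m<) (Inputs-up le inputs) (Filled-up {k = k} le filled)
                (⇓-up le px) (⇓-up le py) (⇓-up le pa)
                (⇓-pred (fits on) (⇓-up le pb) (⇓-pow (<⇒≤ p<W) pp)))))
          (λ al → ⇓-≡ (cong guarded (sym al)) ⇓-lit))
          pacc))
      (λ off → ⇓-≡ (cong branch (sym off)) pacc)
      where
      rest = wedgeN (b′ (chi i) j) Tn m p
      branch guarded : Bool → ℤ
      branch d = if d then b′ (chi i) j p *ℤ Tn (m ∸ 2 ^ p) -ℤ rest else rest
      guarded d = (if d then z (key 2 (chi i) j p) else 0ℤ) *ℤ Tn (m ∸ 2 ^ p)
      p<W = <-≤-trans p<K K≤W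
      j<W = <-≤-trans j<K K≤W
      chi<W = <-≤-trans (chi<c i<n) c≤W
      color = ⇓-chi (Inputs-up le inputs) i<n (⇓-up le pa)
      fits : digit m p ≡ true → 2 ^ p ≤ m
      fits on = ≤-trans (≤ᵇ⁻ on) (DivMod.m%n≤m m (2 ^ suc p) {{m^n≢0 2 (suc p)}})

  ⇓-F : k < K → L < K → i < n → m < 2 ^ K → Inputs w → Bits w → Filled k w →
    w ⊢ x ⇓ + k → w ⊢ y ⇓ + L → w ⊢ a ⇓ + i → w ⊢ b ⇓ + m → w ⊢ FE x y a b ⇓ F k L i (low K m)
  ⇓-F {k = k} {L = L} {i = i} {m = m} k<K L<K i<n m< inputs bits filled px py pa pb =
    ⇓-times inputs bits (key< (s≤s z≤n) k<W i<W 0<W)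
      (⇓-key (s≤s z≤n) inputs k<W i<W px pa ⇓-lit)
      (⇓-≡ (sym (wedge-a i (S k L i) (low K m)))
        (⇓-iter (≤W¹ K≤W) (λ j → sumTo j term) (⇓-K inputs) ⇓-lit
          (λ {j} j<K le pacc pj → let m′ = Inputs-up le inputs ; j<W = <-≤-trans j<K K≤W in
            ⇓-⊕ pacc (⇓-ifp (⇓-⊖ (⇓-upper m′ (⇓-chi m′ i<n (⇓-up le pa))) pj)
              (λ e → ⇓-≡ (cong (guarded j) (sym (capped (upper (chi i)) e)))
                (⇓-times m′ (Bits-up le bits) (key< (s≤s (s≤s z≤n)) i<W j<W 0<W)
                  (⇓-key (s≤s (s≤s z≤n)) m′ i<W j<W (⇓-up le pa) pj ⇓-lit)
                  (⇓-wedge k<K L<K i<n m< j<K m′ (Bits-up le bits) (Filled-up {k = k} le filled)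
                    (⇓-up le px) (⇓-up le py) (⇓-up le pa) (⇓-up le pb) pj)))
              (λ e → ⇓-≡ (cong (guarded j) (sym (uncapped (upper (chi i)) e))) ⇓-lit)))))
    where
    term : ℕ → ℤ
    term j = g′ i j *ℤ wedge (b′ (chi i) j) (S k L i) (low K m)
    guarded : ℕ → Bool → ℤ
    guarded j d = (if d then z (key 1 i j 0) else 0ℤ) *ℤ wedge (b′ (chi i) j) (S k L i) (low K m)
    k<W = <-≤-trans k<K K≤W
    i<W = <-≤-trans i<n n≤W
    0<W = ≤-<-trans z≤n i<W
    capped : ∀ {j} u → positive? (u -ℤ + j) ≡ true → (j <ᵇ (if positive? u then ∣ u ∣ else 0)) ≡ true
    capped {j} (+ zero)    e rewrite positive?-⊖ j 0 = e
    capped {j} (+ suc u)   e rewrite positive?-⊖ j (suc u) = e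
    capped {zero}  -[1+ u ] ()
    capped {suc j} -[1+ u ] ()
    uncapped : ∀ {j} u → positive? (u -ℤ + j) ≡ false → (j <ᵇ (if positive? u then ∣ u ∣ else 0)) ≡ false
    uncapped {j} (+ zero)  e rewrite positive?-⊖ j 0 = e
    uncapped {j} (+ suc u) e rewrite positive?-⊖ j (suc u) = e
    uncapped {j} -[1+ u ]  e = refl

-- Correctness of the program

anyTo : ℕ → (ℕ → Bool) → Bool
anyTo zero    f = false
anyTo (suc n) f = anyTo n f ∨ f n

product-injective : ∀ {k m m′ p p′} → p < k → p′ < k → m * k + p ≡ m′ * k + p′ → m ≡ m′ × p ≡ p′
product-injective {k} {m} {m′} p< p′< e =
    trans (sym (quotient k m p<)) (trans (cong (λ x → x DivMod./ k) e) (quotient k m′ p′<))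
  , trans (sym (remainder k m p<)) (trans (cong (_% k) e) (remainder k m′ p′<))
  where
  instance
    k≢0 : NonZero k
    k≢0 = ℕ.>-nonZero (≤-<-trans z≤n p<)

run-[] : ∀ {m} (bs : Vec Bool m) σ → run bs ([] , σ) ≡ ([] , σ)
run-[] []       σ = refl
run-[] (b ∷ bs) σ = run-[] bs σ

⟶-run : ∀ {t m γ γ′} → γ ⟶[ t ] γ′ → (bs : Vec Bool (t + m)) → run bs γ ≡ run (Vec.drop t bs) γ′
⟶-run {t} {γ = γ} p bs = trans (cong (λ cs → run cs γ) (sym (Vecₚ.take++drop≡id t bs)))
  (trans (run-++ (Vec.take t bs) (Vec.drop t bs) γ) (cong (run (Vec.drop t bs)) (p (Vec.take t bs))))

Runs-halt : ∀ {p σ t Q} → Runs p σ t Q → (bs : Vec Bool t) → ∃[ τ ] (run bs (p , σ) ≡ ([] , τ) × Q τ)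
Runs-halt {p} {σ} {t} (runs m m≤t τ st q) bs with ℕₚ.m≤n⇒∃[o]m+o≡n m≤t
... | o , refl = τ , trans (⟶-run (subst (λ κ → (κ , σ) ⟶[ m ] ([] , τ)) (Listₚ.++-identityʳ p) (st [])) bs)
  (run-[] (Vec.drop m bs) τ) , q

module Sieving (I : Instance) (r : ℕ) {{r≢0 : NonZero r}} (h : ℕ → Bool) where
  open Reading I hiding (w; A; α; β)
  open Code r
  open Correct I r h
  open Eval sc
  open Commands sc
  open Weighted z using (F; S)

  -- With fewer than `pre c` vertices the monomial would lack reserved generators, and a nonzero
  -- coefficient would say nothing about the lower bounds.
  hit : ℕ → ℕ → Bool
  hit k L = (pre c ≤ᵇ suc k) ∧ not (isZero (F k L (toℕ t) (monomial K (_<ᵇ suc k))))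

  hits : ℕ → Bool
  hits k = anyTo K (hit k)

  ⇓-nonzero : ∀ {w e V} → w ⊢ e ⇓ V → w ⊢ nonzeroE e ⇓ bit (not (isZero V))
  ⇓-nonzero {V = V} pe = ⇓-let pe (λ _ pk → ⇓-ifp pk
    (λ e → ⇓-≡ (sym (cong (bit ∘ not) (isZero-no {V} (pos V e)))) ⇓-lit)
    (λ e → ⇓-ifp (⇓-⊖ ⇓-lit pk)
      (λ e′ → ⇓-≡ (sym (cong (bit ∘ not) (isZero-no {V} (neg V e′)))) ⇓-lit)
      (λ e′ → ⇓-≡ (sym (cong (bit ∘ not) (isZero⁺ {V} (nil V e e′)))) ⇓-lit)))
    where
    pos : ∀ V → positive? V ≡ true → V ≢ 0ℤ
    pos (+ suc _) _ ()
    neg : ∀ V → positive? (0ℤ -ℤ V) ≡ true → V ≢ 0ℤ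
    neg (+ zero)  ()
    neg (+ suc _) ()
    neg -[1+ _ ] _ ()
    nil : ∀ V → positive? V ≡ false → positive? (0ℤ -ℤ V) ≡ false → V ≡ 0ℤ
    nil (+ zero) _ _ = refl

  low-initial : ∀ k → k ≤ K → low K (2 ^ k ∸ 1) ≡ monomial K (_<ᵇ k)
  low-initial k k≤K = trans (cong (low K) (cong (_∸ 1) (sym (val-initial K k k≤K)))) (low-val (monomial K (_<ᵇ k)))

  2^k∸1< : ∀ k → k ≤ K → 2 ^ k ∸ 1 < 2 ^ K
  2^k∸1< k k≤K = subst (_< 2 ^ K) (cong (_∸ 1) (val-initial K k k≤K)) (val< (monomial K (_<ᵇ k)))

  ⇓-answer : ∀ {w} → Inputs w → Filled K w → w ⊢ answerE ⇓ bit (anyTo K hits)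
  ⇓-answer {w} inputs filled = ⇓-iter (≤W¹ K≤W) (λ k → bit (anyTo k hits)) (⇓-K inputs) ⇓-lit
    (λ {k} k<K {v} le pacc pk → ⇓-iter (≤W¹ K≤W) (λ L → bit (anyTo k hits ∨ anyTo L (hit k)))
      (⇓-K (Inputs-up le inputs)) (⇓-≡ (cong bit (sym (Boolₚ.∨-identityʳ _))) pacc)
      (λ {L} L<K le′ pacc′ pL → let le″ = ⊑-trans le le′ ; m = Inputs-up le″ inputs ; pk′ = ⇓-up le′ pk in
        ⇓-≡ (cong bit (Boolₚ.∨-assoc (anyTo k hits) (anyTo L (hit k)) (hit k L)))
        (⇓-ifp pacc′
          (λ e → ⇓-≡ (cong (λ d → bit (d ∨ hit k L)) (sym (on _ e))) ⇓-lit)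
          (λ e → ⇓-≡ (cong (λ d → bit (d ∨ hit k L)) (sym (off _ e)))
            (⇓-lt (⇓-pre m c≤W (⇓-c m)) (⇓-⊕ pk′ ⇓-lit)
              (λ g → ⇓-≡ (cong (conditional k L) (sym (≤ᵇ-true (below k g))))
                (⇓-nonzero (⇓-at (⇓-cell m k<K L<K t<n pk′ pL (⇓-t m)
                    (⇓-pred (m^n>0 2 (suc k)) (⇓-≡ (cong (λ j → + (2 ^ j)) (+-comm k 1))
                      (⇓-pow (≤-trans (≤-reflexive (+-comm k 1)) (≤-trans k<K K≤W)) (⇓-⊕ pk′ ⇓-lit))) ⇓-lit))
                  (trans (Filled-up {k = K} le″ filled k<K L<K t<n (2^k∸1< (suc k) k<K))
                    (cong (F k L (toℕ t)) (low-initial (suc k) k<K))))))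
              (λ g → ⇓-≡ (cong (conditional k L) (sym (≤ᵇ-false (above k g)))) ⇓-lit))))))
    where
    conditional : ℕ → ℕ → Bool → ℤ
    conditional k L d = bit (d ∧ not (isZero (F k L (toℕ t) (monomial K (_<ᵇ suc k)))))
    on : ∀ d → positive? (bit d) ≡ true → d ≡ true
    on true _ = refl
    off : ∀ d → positive? (bit d) ≡ false → d ≡ false
    off false _ = refl
    below : ∀ k {m} → m < k + 2 → m ≤ suc k
    below k {m} g = ≤-pred (subst (m <_) (+-comm k 2) g)
    above : ∀ k {m} → k + 2 ≤ m → suc k < m
    above k {m} g = subst (_≤ m) (+-comm k 2) g

  place : ℕ → ℕ → ℕ → ℕ → ℕ
  place k L v x = ((k * K + L) * n + v) * 2 ^ K + x

  -- The rank of a cell in the filling order is also its offset in memory, so one number `M` states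
  -- the progress of all four nested loops.
  record Done (M : ℕ) (mem : ℤ → ℤ) : Set where
    field
      inputs : ∀ i → mem (+ i) ≡ inp i
      bits   : ∀ q → q < NB → mem -[1+ q ] ≡ bit (h q)
      cells  : ∀ {k L u x} → k < K → L < K → u < n → x < 2 ^ K → place k L u x < M →
               mem -[1+ slotOf k L u x ] ≡ F k L u (low K x)
  open Done

  Done-resp : ∀ {M f g} → (∀ a → g a ≡ f a) → Done M f → Done M g
  Done-resp e d = record
    { inputs = λ i → trans (e _) (inputs d i)
    ; bits   = λ q q< → trans (e _) (bits d q q<)
    ; cells  = λ k< L< u< x< p → trans (e _) (cells d k< L< u< x< p) }

  Done-Filled : ∀ {M k w} → k ≤ K → Done M (mem (proj₂ w)) → k * K * n * 2 ^ K ≤ M → Filled k w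
  Done-Filled k≤K d k≤M k′<k L<K u<n x< = cells d (<-≤-trans k′<k k≤K) L<K u<n x<
    (<-≤-trans (extend-< (extend-< (extend-< k′<k L<K) u<n) x<) k≤M)

  -- Inputs have nonnegative addresses, bits lie before the offset `NB`, and distinct cells have
  -- distinct mixed-radix indices, so the assignment overwrites nothing that is still needed.
  Done-next : ∀ {k L v x f g} → k < K → L < K → v < n → x < 2 ^ K →
    g -[1+ slotOf k L v x ] ≡ F k L v (low K x) → (∀ a → a ≢ -[1+ slotOf k L v x ] → g a ≡ f a) →
    Done (place k L v x) f → Done (suc (place k L v x)) g
  Done-next {k} {L} {v} {x} {f} {g} k<K L<K v<n x< new old d = record
    { inputs = λ i → trans (old _ (λ ())) (inputs d i)
    ; bits   = λ q q< → trans (old _ (λ { refl → ℕₚ.<⇒≱ q< (m≤m+n NB _) })) (bits d q q<)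
    ; cells  = λ {k′} {L′} {u} {y} k′< L′< u< y< p → cell k′< L′< u< y< (ℕₚ.m≤n⇒m<n∨m≡n (≤-pred p)) }
    where
    cell : ∀ {k′ L′ u y} → k′ < K → L′ < K → u < n → y < 2 ^ K →
           place k′ L′ u y < place k L v x ⊎ place k′ L′ u y ≡ place k L v x →
           g -[1+ slotOf k′ L′ u y ] ≡ F k′ L′ u (low K y)
    cell k′< L′< u< y< (inj₁ p) = trans
      (old _ (λ e → <⇒≢ p (ℕₚ.+-cancelˡ-≡ NB _ _ (ℤₚ.-[1+-injective e))))
      (cells d k′< L′< u< y< p)
    cell {k′} {L′} {u} k′< L′< u< y< (inj₂ p)
      with product-injective {2 ^ K} {(k′ * K + L′) * n + u} {(k * K + L) * n + v} y< x< p
    ... | p₁ , refl with product-injective {n} {k′ * K + L′} {k * K + L} u< v<n p₁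
    ... | p₂ , refl with product-injective {K} {k′} {k} L′< L<K p₂
    ... | refl , refl = new

  Done-cong : ∀ {M N f} → M ≡ N → Done M f → Done N f
  Done-cong {f = f} e = subst (λ M → Done M f) e

  Executes-weaken : ∀ {c d σ P Q} → (∀ {τ} → P τ → Q τ) → Executes c d σ P → Executes c d σ Q
  result (Executes-weaken g e) = Runs-weaken ≤-refl (λ { (keep , p) → keep , g p }) (result e)

  Done-suc : ∀ m k {f} → Done (m * k + k) f → Done (suc m * k) f
  Done-suc m k = Done-cong (+-comm (m * k) k)

  Done-0 : ∀ m {f} → Done m f → Done (m + 0) f
  Done-0 m = Done-cong (sym (+-identityʳ m))

  -- Each of the four loops takes an even register for the turns left and the next odd one for its
  -- index; hence 1, 3, 5, 7 and depth 8.
  fill-spec : ∀ {k L v x σ} → k < K → L < K → v < n → x < 2 ^ K →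
    reg σ 1 ≡ + k → reg σ 3 ≡ + L → reg σ 5 ≡ + v → reg σ 7 ≡ + x → Done (place k L v x) (mem σ) →
    Executes (fill 1 3 5 7) 8 σ (λ τ → Done (place k L v (suc x)) (mem τ))
  fill-spec {k} {L} {v} {x} {σ} k<K L<K v<n x< rk rL rv rx d = Executes-weaken
    (λ { (new , old) → Done-cong (sym (+-suc (((k * K + L) * n + v) * 2 ^ K) x)) (Done-next k<K L<K v<n x< new old d) })
    (Executes-assign (⇓-cell (inputs d) k<K L<K v<n pk pL pv px)
      (⇓-F k<K L<K v<n x< (inputs d) (bits d) (Done-Filled {w = 8 , σ} (<⇒≤ k<K) d
        (≤-trans (*-monoˡ-≤ (2 ^ K) (≤-trans (*-monoˡ-≤ n (m≤m+n (k * K) L)) (m≤m+n ((k * K + L) * n) v))) (m≤m+n _ x)))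
        pk pL pv px))
    where
    pk : (8 , σ) ⊢ var 1 ⇓ + k
    pk = ⇓-var (m<m+n 1 {7} (s≤s z≤n)) rk
    pL : (8 , σ) ⊢ var 3 ⇓ + L
    pL = ⇓-var (m<m+n 3 {5} (s≤s z≤n)) rL
    pv : (8 , σ) ⊢ var 5 ⇓ + v
    pv = ⇓-var (m<m+n 5 {3} (s≤s z≤n)) rv
    px : (8 , σ) ⊢ var 7 ⇓ + x
    px = ⇓-var ≤-refl rx

  fillVertex-spec : ∀ {k L v σ} → k < K → L < K → v < n →
    reg σ 1 ≡ + k → reg σ 3 ≡ + L → reg σ 5 ≡ + v → Done (((k * K + L) * n + v) * 2 ^ K) (mem σ) →
    Executes (fillVertex 1 3 5) 6 σ (λ τ → Done (((k * K + L) * n + suc v) * 2 ^ K) (mem τ))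
  fillVertex-spec {k} {L} {v} {σ} k<K L<K v<n rk rL rv d = Executes-weaken
    (λ d′ → Done-cong (cong (_* 2 ^ K) (sym (+-suc ((k * K + L) * n) v))) (Done-suc ((k * K + L) * n + v) (2 ^ K) d′))
    (Executes-for (≤2^K ≤-refl) (⇓-pow K≤W (⇓-K (inputs d))) (λ x → Done (place k L v x)) Done-resp
      (Done-0 (((k * K + L) * n + v) * 2 ^ K) d)
      (λ x< keep rx d′ → fill-spec k<K L<K v<n x<
        (trans (keep 1 (m<m+n 1 {5} (s≤s z≤n))) rk) (trans (keep 3 (m<m+n 3 {3} (s≤s z≤n))) rL)
        (trans (keep 5 ≤-refl) rv) rx d′))

  fillLength-spec : ∀ {k L σ} → k < K → L < K →
    reg σ 1 ≡ + k → reg σ 3 ≡ + L → Done ((k * K + L) * n * 2 ^ K) (mem σ) →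
    Executes (fillLength 1 3) 4 σ (λ τ → Done ((k * K + suc L) * n * 2 ^ K) (mem τ))
  fillLength-spec {k} {L} {σ} k<K L<K rk rL d = Executes-weaken
    (λ d′ → Done-cong (cong (_* 2 ^ K) (trans (+-comm ((k * K + L) * n) n) (cong (_* n) (sym (+-suc (k * K) L))))) d′)
    (Executes-for (≤W¹ n≤W) (⇓-n (inputs d)) (λ v → Done (((k * K + L) * n + v) * 2 ^ K)) Done-resp
      (Done-cong (cong (_* 2 ^ K) (sym (+-identityʳ ((k * K + L) * n)))) d)
      (λ v<n keep rv d′ → fillVertex-spec k<K L<K v<n
        (trans (keep 1 (m<m+n 1 {3} (s≤s z≤n))) rk) (trans (keep 3 ≤-refl) rL) rv d′))

  fillLayer-spec : ∀ {k σ} → k < K → reg σ 1 ≡ + k → Done (k * K * n * 2 ^ K) (mem σ) →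
    Executes (fillLayer 1) 2 σ (λ τ → Done (suc k * K * n * 2 ^ K) (mem τ))
  fillLayer-spec {k} {σ} k<K rk d = Executes-weaken
    (λ d′ → Done-cong (cong (λ m → m * n * 2 ^ K) (+-comm (k * K) K)) d′)
    (Executes-for (≤W¹ K≤W) (⇓-K (inputs d)) (λ L → Done ((k * K + L) * n * 2 ^ K)) Done-resp
      (Done-cong (cong (λ m → m * n * 2 ^ K) (sym (+-identityʳ (k * K)))) d)
      (λ L<K keep rL d′ → fillLength-spec k<K L<K (trans (keep 1 ≤-refl) rk) rL d′))

  table-spec : ∀ {σ} → Done 0 (mem σ) → Executes table 0 σ (λ τ → Done (K * K * n * 2 ^ K) (mem τ))
  table-spec d = Executes-for (≤W¹ K≤W) (⇓-K (inputs d)) (λ k → Done (k * K * n * 2 ^ K)) Done-resp d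
    (λ k<K keep rk d′ → fillLayer-spec k<K rk d′)

  afterwards : ∀ {σ} → Done 0 (mem σ) →
    Runs (prog table 0 ++ code answerE 0) σ (⟦ sc ⟧ (time table 0) + ⟦ sc ⟧ (cost answerE 0))
      (λ τ → reg τ 0 ≡ bit (anyTo K hits))
  afterwards d = Runs-seq (result (table-spec d)) (λ { {τ} (_ , d′) →
    Runs-weaken ≤-refl proj₁
      (exec (⇓-answer {0 , τ} (inputs d′) (Done-Filled {w = 0 , τ} ≤-refl d′ ≤-refl)) ⊑-refl) })

countTrue-selected : ∀ s N M (f : Vec Bool N → Bool) →
  countTrue (s + (N * 6 + M)) (λ bs → f (tossed N (Vec.drop s bs))) ≡ 2 ^ (s + (N * 5 + M)) * countTrue N f
countTrue-selected s N M f = begin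
  countTrue (s + (N * 6 + M)) (λ bs → f (tossed N (Vec.drop s bs))) ≡⟨ countTrue-drop s (f ∘ tossed N) ⟩
  2 ^ s * countTrue (N * 6 + M) (f ∘ tossed N)                      ≡⟨ cong (2 ^ s *_) (countTrue-tossed N f) ⟩
  2 ^ s * (2 ^ (N * 5 + M) * countTrue N f)                         ≡⟨ sym (ℕₚ.*-assoc (2 ^ s) _ _) ⟩
  2 ^ s * 2 ^ (N * 5 + M) * countTrue N f
    ≡⟨ cong (_* countTrue N f) (sym (ℕₚ.^-distribˡ-+-* 2 s (N * 5 + M))) ⟩
  2 ^ (s + (N * 5 + M)) * countTrue N f ∎
  where open ≡-Reasoning

2^-selected : ∀ s N M → 2 ^ (s + (N * 6 + M)) ≡ 2 ^ (s + (N * 5 + M)) * 2 ^ N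
2^-selected s N M = trans (cong (2 ^_) (rearrange s N M)) (ℕₚ.^-distribˡ-+-* 2 (s + (N * 5 + M)) N)
  where
  rearrange : ∀ a b c → a + (b * 6 + c) ≡ a + (b * 5 + c) + b
  rearrange = ℕ-Ring.solve-∀

-- `counting` takes the same time for all coins, so the flips fall on fixed positions of `coins`.
-- Once the bits are stored, the continuation is deterministic, with a postcondition that may refer
-- to them.
randomize-then : ∀ {n N σ κ t M} {Q : Vec Bool N → Store → Set}
  (counting : Runs (code n 0) σ t (λ τ → reg τ 0 ≡ + N × τ ≈[ 0 ] σ)) →
  (∀ bs {τ} → (∀ a → mem τ (+ a) ≡ mem σ (+ a)) → (∀ q → q < N → mem τ -[1+ q ] ≡ bit (nthBit bs q)) →
    Runs κ τ M (Q bs)) →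
  (coins : Vec Bool (Runs.time counting + 1 + (N * 6 + suc M))) →
  ∃[ τ ] (run coins (randomize n ++ κ , σ) ≡ ([] , τ) × Q (tossed N (Vec.drop (Runs.time counting + 1) coins)) τ)
randomize-then {n} {N} {σ} {κ} {t} {M} (runs m _ σ₀ steps (reg0 , same)) continue coins
  with run-toss N (Vec.drop (m + 1) coins) κ {setReg 1 -1ℤ σ₀} 0 reg0 refl
... | τ , runs-to , pos , _ , bits
  with Runs-halt (continue (tossed N (Vec.drop (m + 1) coins)) (λ a → trans (pos a) (mems same (+ a))) bits)
         (Vec.tail (after-toss N (Vec.drop (m + 1) coins)))
... | υ , halts , q = υ , trans (⟶-run prepare coins) (trans runs-to halts) , q
  where
  prepare : (randomize n ++ κ , σ) ⟶[ m + 1 ] (toss ∷ κ , setReg 1 -1ℤ σ₀)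
  prepare = subst (λ p → (p , σ) ⟶[ m + 1 ] (toss ∷ κ , setReg 1 -1ℤ σ₀))
    (sym (Listₚ.++-assoc (code n 0) (const 1 -1ℤ ∷ toss ∷ []) κ))
    (⟶-trans (steps (const 1 -1ℤ ∷ toss ∷ κ)) (λ { (_ ∷ []) → refl }))

module Whole (I : Instance) (r : ℕ) {{r≢0 : NonZero r}} where
  open Reading I using (K; inp; Wd)
  open Code r

  private
    -- The sizes `NB`, `Nv` and `B` are evaluated before any bit is stored and depend on the input
    -- alone, so any bits will do here.
    blank : ℕ → Bool
    blank _ = false

  open Correct I r blank public using (sc; NB; Nv; B)
  open Eval sc

  abstract
    counting : Runs (code NBE 0) (initial I) (⟦ sc ⟧ (cost NBE 0)) (λ τ → reg τ 0 ≡ + NB × τ ≈[ 0 ] initial I)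
    counting = exec (Correct.⇓-NB I r blank {0 , initial I} (λ _ → refl)) ⊑-refl

  setup rest total : ℕ
  setup = Runs.time counting + 1
  rest  = ⟦ sc ⟧ (time table 0) + ⟦ sc ⟧ (cost answerE 0)
  total = setup + (NB * 6 + suc rest)

  drawn : Vec Bool total → Vec Bool NB
  drawn coins = tossed NB (Vec.drop setup coins)

  answer : Vec Bool NB → Bool
  answer bs = anyTo K (Sieving.hits I r (nthBit bs))

  run-sieve : ∀ coins → ∃[ τ ] (final sieve I coins ≡ ([] , τ) × reg τ 0 ≡ bit (answer (drawn coins)))
  run-sieve = randomize-then {n = NBE} {N = NB} {κ = prog table 0 ++ code answerE 0} {M = rest}
    {Q = λ bs τ → reg τ 0 ≡ bit (answer bs)} counting (λ bs pos bits →
    Sieving.afterwards I r (nthBit bs) (record { inputs = pos ; bits = bits ; cells = λ _ _ _ _ () }))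

-- Walks and probabilities

anyTo⁻ : ∀ n f → anyTo n f ≡ true → ∃[ i ] (i < n × f i ≡ true)
anyTo⁻ (suc n) f e with anyTo n f in eq
... | true  = let i , i<n , p = anyTo⁻ n f eq in i , m<n⇒m<1+n i<n , p
... | false = n , n<1+n n , e

anyTo⁺ : ∀ {n f i} → i < n → f i ≡ true → anyTo n f ≡ true
anyTo⁺ {suc n} {f} {i} i<1+n e with i ℕ.≟ n
... | yes refl rewrite e = Boolₚ.∨-zeroʳ (anyTo n f)
... | no  i≢n  = cong (_∨ f n) (anyTo⁺ (ℕₚ.≤∧≢⇒< (≤-pred i<1+n) i≢n) e)

module Walks (I : Instance) where
  open Reading I

  names : ∀ {u v} → Walk I u v → List ℕ
  names p = map toℕ (vertices I p)

  colorCount-count : ∀ i {u v} (p : Walk I u v) → colorCount I i p ≡ count (toℕ i) (names p)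
  colorCount-count i p = go (vertices I p)
    where
    go : ∀ vs → length (filter (λ v → χ v Fin.≟ i) vs) ≡ count (toℕ i) (map toℕ vs)
    go []       = refl
    go (v ∷ vs) with χ v Fin.≟ i
    ... | yes refl rewrite chi-χ v | ≡ᵇ-refl (toℕ (χ v)) = cong suc (go vs)
    ... | no  χ≢i  rewrite chi-χ v | ≢⇒≡ᵇ (χ≢i ∘ Finₚ.toℕ-injective) = go vs

  count-↭ : ∀ i {us vs} → us ↭ vs → count i us ≡ count i vs
  count-↭ i Perm.refl         = refl
  count-↭ i (prep v p)        = cong (λ m → (if chi v ≡ᵇ i then 1 else 0) + m) (count-↭ i p)
  count-↭ i (swap u v p)      = trans (cong (λ m → (if chi u ≡ᵇ i then 1 else 0) + ((if chi v ≡ᵇ i then 1 else 0) + m)) (count-↭ i p))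
    (exchange (if chi u ≡ᵇ i then 1 else 0) (if chi v ≡ᵇ i then 1 else 0) _)
    where
    exchange : ∀ a b c → a + (b + c) ≡ b + (a + c)
    exchange = ℕ-Ring.solve-∀
  count-↭ i (Perm.trans p q)  = trans (count-↭ i p) (count-↭ i q)

  Unique-↭ : ∀ {us vs : List ℕ} → us ↭ vs → Unique us → Unique vs
  Unique-↭ p = PermSₚ.Unique-resp-↭ (Perm.↭⇒↭ₛ p)

  vertices-snoc : ∀ {u v x} (p : Walk I u v) (a : T (A v x)) → vertices I (p ◅◅ a ◅ []ʷ) ≡ vertices I p ∷ʳ x
  vertices-snoc []ʷ       a = refl
  vertices-snoc {u} (_ ◅ p) a = cong (u ∷_) (vertices-snoc p a)

  pathLength-snoc : ∀ {u v x} (p : Walk I u v) (a : T (A v x)) → pathLength I (p ◅◅ a ◅ []ʷ) ≡ pathLength I p + w a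
  pathLength-snoc []ʷ       a = +-identityʳ (w a)
  pathLength-snoc (b ◅ p) a = trans (cong (λ m → w b + m) (pathLength-snoc p a)) (sym (+-assoc (w b) _ (w a)))

  arc : ∀ {u v} → 0 < ent (toℕ u) (toℕ v) → ∃[ a ] ent (toℕ u) (toℕ v) ≡ w {u} {v} a
  arc {u} {v} pos rewrite ent-w u v with T? (A u v)
  ... | yes a = a , refl
  arc {u} {v} () | no _

  ent-arc : ∀ {u v} (a : T (A u v)) → ent (toℕ u) (toℕ v) ≡ w a
  ent-arc {u} {v} a rewrite ent-w u v with T? (A u v)
  ... | yes a′ = cong w (Boolₚ.T-irrelevant a′ a)
  ... | no ¬a  = contradiction a ¬a

  -- A permutation is enough in place of the reversal, as distinctness and color counts are
  -- invariant under it.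
  Route⇒Walk : ∀ {L v vs} → Route L (v ∷ vs) → ∃[ x ] (toℕ x ≡ v × (∃[ p ] (pathLength I {s} {x} p ≡ L × names p ↭ v ∷ vs)))
  Route⇒Walk start = s , refl , []ʷ , refl , ↭-refl
  Route⇒Walk (extend {v = v} r u<n v<n pos) with Route⇒Walk r
  ... | x , refl , p , refl , perm with subst (λ v → 0 < ent (toℕ x) v) (sym (Finₚ.toℕ-fromℕ< v<n)) pos
  ... | pos′ with arc {x} {fromℕ< v<n} pos′
  ... | a , e = fromℕ< v<n , Finₚ.toℕ-fromℕ< v<n , p ◅◅ a ◅ []ʷ
    , trans (pathLength-snoc p a) (cong (λ m → pathLength I p + m) (trans (sym e) (cong (ent (toℕ x)) (Finₚ.toℕ-fromℕ< v<n))))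
    , ↭-trans (Perm.↭-reflexive (trans (cong (map toℕ) (vertices-snoc p a)) (trans (Listₚ.map-++ toℕ (vertices I p) _)
        (cong (λ m → names p ∷ʳ m) (Finₚ.toℕ-fromℕ< v<n)))))
      (↭-trans (↭-sym (Permₚ.∷↭∷ʳ v (names p))) (prep v perm))

  Walk⇒Route : ∀ {u v} (p : Walk I u v) {L us} → Route L (toℕ u ∷ us) →
               ∃[ vs ] (Route (L + pathLength I p) (toℕ v ∷ vs) × toℕ v ∷ vs ↭ names p ++ us)
  Walk⇒Route []ʷ {us = us} r = us , subst (λ L → Route L _) (sym (+-identityʳ _)) r , ↭-refl
  Walk⇒Route {u} {v} (_◅_ {j = x} a p) {L} {us} r
    with Walk⇒Route p (subst (λ m → Route (L + m) (toℕ x ∷ toℕ u ∷ us)) (ent-arc a)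
           (extend r (Finₚ.toℕ<n u) (Finₚ.toℕ<n x) (subst (0 <_) (sym (ent-arc a)) (w≥1 a))))
  ... | vs , r′ , perm = vs , subst (λ m → Route m (toℕ v ∷ vs)) (+-assoc L (w a) _) r′
    , ↭-trans perm (Permₚ.shift (toℕ u) (names p) us)

  -- Every arc has length at least 1. This bounds the vertices by `K`, hence the layers of the table
  -- and the generators.
  Route-length : ∀ {L v vs} → Route L (v ∷ vs) → length vs ≤ L
  Route-length start = z≤n
  Route-length (extend {L} {u} {us} {v} r _ _ pos) = ≤-trans (s≤s (Route-length r))
    (≤-trans (≤-reflexive (+-comm 1 L)) (ℕₚ.+-monoʳ-≤ L pos))

  Route-< : ∀ {L v vs} → Route L (v ∷ vs) → All (_< n) (v ∷ vs)
  Route-< start              = s<n ∷ []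
  Route-< (extend r _ v<n _) = v<n ∷ Route-< r

  InBounds : ℕ → Fin c → Set
  InBounds m i = α i ℤ.≤ + m × + m ℤ.≤ β i

  fair⇒bounds : ∀ m i → need (toℕ i) ≤ m → m ≤ cap (toℕ i) → InBounds m i
  fair⇒bounds m i lo hi rewrite lower-α i | upper-β i = go (α i) (β i) lo hi
    where
    go : ∀ a b → (if positive? (0ℤ -ℤ b) then 1 else (if positive? a then ∣ a ∣ else 0)) ≤ m →
         m ≤ (if positive? b then ∣ b ∣ else 0) → a ℤ.≤ + m × + m ℤ.≤ b
    go a         -[1+ b ]  lo hi = contradiction (≤-trans lo hi) ℕₚ.1+n≰n
    go (+ zero)  (+ zero)  lo hi = ℤ.+≤+ z≤n , ℤ.+≤+ hi
    go (+ suc a) (+ zero)  lo hi = ℤ.+≤+ lo , ℤ.+≤+ hi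
    go -[1+ a ]  (+ zero)  lo hi = ℤ.-≤+ , ℤ.+≤+ hi
    go (+ zero)  (+ suc b) lo hi = ℤ.+≤+ z≤n , ℤ.+≤+ hi
    go (+ suc a) (+ suc b) lo hi = ℤ.+≤+ lo , ℤ.+≤+ hi
    go -[1+ a ]  (+ suc b) lo hi = ℤ.-≤+ , ℤ.+≤+ hi

  bounds⇒fair : ∀ m i → InBounds m i → need (toℕ i) ≤ m × m ≤ cap (toℕ i)
  bounds⇒fair m i (lo , hi) rewrite lower-α i | upper-β i = go (α i) (β i) lo hi
    where
    go : ∀ a b → a ℤ.≤ + m → + m ℤ.≤ b → (if positive? (0ℤ -ℤ b) then 1 else (if positive? a then ∣ a ∣ else 0)) ≤ m ×
         m ≤ (if positive? b then ∣ b ∣ else 0)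
    go (+ zero)  (+ zero)  lo           (ℤ.+≤+ hi) = z≤n , hi
    go (+ suc a) (+ zero)  (ℤ.+≤+ lo) (ℤ.+≤+ hi) = lo , hi
    go -[1+ a ]  (+ zero)  lo           (ℤ.+≤+ hi) = z≤n , hi
    go (+ zero)  (+ suc b) lo           (ℤ.+≤+ hi) = z≤n , hi
    go (+ suc a) (+ suc b) (ℤ.+≤+ lo) (ℤ.+≤+ hi) = lo , hi
    go -[1+ a ]  (+ suc b) lo           (ℤ.+≤+ hi) = z≤n , hi

  L<K⇒≤ℓ : ∀ {L} → L < K → + L ℤ.≤ ℓ
  L<K⇒≤ℓ = go ℓ
    where
    go : ∀ l {L} → L < columns l → + L ℤ.≤ l
    go (+ l) (s≤s h) = ℤ.+≤+ h

  ≤ℓ⇒L<K : ∀ {L} → + L ℤ.≤ ℓ → L < K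
  ≤ℓ⇒L<K = go ℓ
    where
    go : ∀ l {L} → + L ℤ.≤ l → L < columns l
    go (+ l) (ℤ.+≤+ h) = s≤s h

  route⇒yes : ∀ {L vs} → L < K → Route L (toℕ t ∷ vs) → Unique (toℕ t ∷ vs) → Fair (toℕ t ∷ vs) → IsYes I
  route⇒yes L<K r u fair with Route⇒Walk r
  ... | x , x≡t , p , refl , perm with Finₚ.toℕ-injective x≡t
  ... | refl = p , Uniqueₚ.map⁻ (Unique-↭ (↭-sym perm) u) , L<K⇒≤ℓ L<K , λ i →
    let lo , hi = fair (toℕ i) (Finₚ.toℕ<n i)
        same = trans (colorCount-count i p) (count-↭ (toℕ i) perm)
    in fair⇒bounds (colorCount I i p) i (subst (need (toℕ i) ≤_) (sym same) lo) (subst (_≤ cap (toℕ i)) (sym same) hi)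

  yes⇒route : IsYes I → ∃[ L ] ∃[ vs ] (L < K × Route L (toℕ t ∷ vs) × Unique (toℕ t ∷ vs) × Fair (toℕ t ∷ vs))
  yes⇒route (p , path , len , bounds) with Walk⇒Route p start
  ... | vs , r , perm = pathLength I p , vs , ≤ℓ⇒L<K len , r
    , Unique-↭ (↭-sym perm′) (Uniqueₚ.map⁺ Finₚ.toℕ-injective path)
    , λ i i<c → on-range {P = λ i → need i ≤ count i (toℕ t ∷ vs) × count i (toℕ t ∷ vs) ≤ cap i} (λ i →
        subst (λ m → need (toℕ i) ≤ m × m ≤ cap (toℕ i)) (trans (colorCount-count i p) (sym (count-↭ (toℕ i) perm′)))
          (bounds⇒fair (colorCount I i p) i (bounds i))) i<c
    where
    perm′ : toℕ t ∷ vs ↭ names p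
    perm′ = subst (toℕ t ∷ vs ↭_) (Listₚ.++-identityʳ (names p)) perm

module Analysis (I : Instance) (r : ℕ) {{r≢0 : NonZero r}} where
  open Reading I
  open Walks I
  open Whole I r

  never-wrong : ¬ IsYes I → ∀ bs → answer bs ≡ false
  never-wrong no-path bs with answer bs in eq
  ... | false = refl
  ... | true with anyTo⁻ K _ eq
  ...   | k , k<K , eqₖ with anyTo⁻ K _ eqₖ
  ...   | L , L<K , hit = ⊥-elim (Weighted.sound (numbers B bs) k L (toℕ t) t<n k<K (≤ᵇ⁻ (proj₁ split)) nonzero
    (λ { (vs , route , unique , fair) → no-path (route⇒yes L<K route unique fair) }))
    where
    split = ∧-split {pre c ≤ᵇ suc k} hit
    nonzero : Weighted.F (numbers B bs) k L (toℕ t) (monomial K (_<ᵇ suc k)) ≢ 0ℤ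
    nonzero e = case trans (sym (proj₂ split)) (cong not (isZero⁺ e)) of λ ()

  -- A wrong no forces all tested coefficients to vanish, in particular the one for the step count
  -- and length of one fixed feasible path, to which `few-failures` applies.
  mostly-right : IsYes I → countTrue NB (not ∘ answer) * 2 ^ r ≤ 2 ^ NB
  mostly-right yes-instance with yes⇒route yes-instance
  ... | L , vs , L<K , route , unique , fair
    with complete n c K (toℕ s) ent chi need cap s<n chi<c route (Route-< route) unique
           (≤-trans (s≤s (Route-length route)) L<K) fair
  ... | pre≤ , z , outside , nonzero = ≤-trans (*-monoˡ-≤ (2 ^ r) missed)
    (few-failures Nv (3 * K) r {f} {z} (MPoly-≤ (*-monoʳ-≤ 3 k<K)
      (SievePoly.F-MPoly n c K (toℕ s) ent chi need cap (length vs) L (toℕ t) X)) outside nonzero)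
    where
    k<K : length vs < K
    k<K = ≤-trans (s≤s (Route-length route)) L<K
    X = monomial K (_<ᵇ suc (length vs))
    f : Assignment → ℤ
    f z = Weighted.F z (length vs) L (toℕ t) X
    found : ∀ bs → f (numbers B bs) ≢ 0ℤ → answer bs ≡ true
    found bs nz = anyTo⁺ k<K (anyTo⁺ L<K (cong₂ _∧_ (≤ᵇ-true pre≤) (cong not (isZero-no nz))))
    missed : countTrue NB (not ∘ answer) ≤ countTrue NB (isZero ∘ f ∘ numbers B)
    missed = ≤-trans (countTrue-⊎ NB {g = isZero ∘ f ∘ numbers B} {h = λ _ → false} miss)
      (≤-reflexive (trans (cong (λ m → countTrue NB (isZero ∘ f ∘ numbers B) + m) (countTrue-false NB (λ _ → refl))) (+-identityʳ _)))
      where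
      miss : ∀ bs → not (answer bs) ≡ true → isZero (f (numbers B bs)) ≡ true ⊎ false ≡ true
      miss bs e with f (numbers B bs) ℤ.≟ 0ℤ
      ... | yes p = inj₁ refl
      ... | no  p = case trans (sym e) (cong not (found bs p)) of λ ()

-- The time bound and the theorem

^-distribʳ-* : ∀ m n o → (m * n) ^ o ≡ m ^ o * n ^ o
^-distribʳ-* m n zero    = refl
^-distribʳ-* m n (suc o) = trans (cong (m * n *_) (^-distribʳ-* m n o)) (shuffle m n (m ^ o) (n ^ o))
  where
  shuffle : ∀ a b c d → a * b * (c * d) ≡ a * c * (b * d)
  shuffle = ℕ-Ring.solve-∀

-- Bernoulli's inequality  1 + q / 4 ≤ (5 / 4) ^ q.
bernoulli : ∀ q → (q + 4) * 4 ^ q ≤ 4 * 5 ^ q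
bernoulli zero    = ≤-refl
bernoulli (suc q) = begin
  (suc q + 4) * (4 * 4 ^ q)                ≤⟨ m≤m+n _ (q * 4 ^ q) ⟩
  (suc q + 4) * (4 * 4 ^ q) + q * 4 ^ q    ≡⟨ collect q (4 ^ q) ⟩
  5 * ((q + 4) * 4 ^ q)                    ≤⟨ *-monoʳ-≤ 5 (bernoulli q) ⟩
  5 * (4 * 5 ^ q)                          ≡⟨ swap-factors (5 ^ q) ⟩
  4 * (5 * 5 ^ q)                          ∎
  where
  open ℕₚ.≤-Reasoning
  collect : ∀ q p → (suc q + 4) * (4 * p) + q * p ≡ 5 * ((q + 4) * p)
  collect = ℕ-Ring.solve-∀
  swap-factors : ∀ p → 5 * (4 * p) ≡ 4 * (5 * p)
  swap-factors = ℕ-Ring.solve-∀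

-- With `l = s + q * e` and `s < e` one has `suc l ≤ e * (q + 4)`; the rest is the e-th power of
-- Bernoulli's inequality.
poly≤exp : ∀ e {{_ : NonZero e}} l → suc l ^ e * 4 ^ l ≤ (4 * e) ^ e * 5 ^ l
poly≤exp e l = begin
  suc l ^ e * 4 ^ l                                  ≤⟨ *-monoˡ-≤ (4 ^ l) (ℕₚ.^-monoˡ-≤ e l<) ⟩
  (e * (q + 4)) ^ e * 4 ^ l                          ≡⟨ cong₂ _*_ (^-distribʳ-* e (q + 4) e) (cong (4 ^_) l≡) ⟩
  e ^ e * (q + 4) ^ e * 4 ^ (s + q * e)              ≡⟨ cong (e ^ e * (q + 4) ^ e *_) (ℕₚ.^-distribˡ-+-* 4 s (q * e)) ⟩
  e ^ e * (q + 4) ^ e * (4 ^ s * 4 ^ (q * e))        ≡⟨ cong (λ p → e ^ e * (q + 4) ^ e * (4 ^ s * p)) (sym (ℕₚ.^-*-assoc 4 q e)) ⟩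
  e ^ e * (q + 4) ^ e * (4 ^ s * (4 ^ q) ^ e)        ≡⟨ regroup (e ^ e) ((q + 4) ^ e) (4 ^ s) ((4 ^ q) ^ e) ⟩
  e ^ e * 4 ^ s * ((q + 4) ^ e * (4 ^ q) ^ e)        ≡⟨ cong (e ^ e * 4 ^ s *_) (sym (^-distribʳ-* (q + 4) (4 ^ q) e)) ⟩
  e ^ e * 4 ^ s * ((q + 4) * 4 ^ q) ^ e              ≤⟨ *-mono-≤ (*-monoʳ-≤ (e ^ e) (ℕₚ.^-monoˡ-≤ s (ℕₚ.n≤1+n 4)))
                                                          (ℕₚ.^-monoˡ-≤ e (bernoulli q)) ⟩
  e ^ e * 5 ^ s * (4 * 5 ^ q) ^ e                    ≡⟨ cong (e ^ e * 5 ^ s *_) (trans (^-distribʳ-* 4 (5 ^ q) e) (cong (4 ^ e *_) (ℕₚ.^-*-assoc 5 q e))) ⟩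
  e ^ e * 5 ^ s * (4 ^ e * 5 ^ (q * e))              ≡⟨ regroup′ (e ^ e) (5 ^ s) (4 ^ e) (5 ^ (q * e)) ⟩
  4 ^ e * e ^ e * (5 ^ s * 5 ^ (q * e))              ≡⟨ cong₂ _*_ (sym (^-distribʳ-* 4 e e))
                                                          (trans (sym (ℕₚ.^-distribˡ-+-* 5 s (q * e))) (cong (5 ^_) (sym l≡))) ⟩
  (4 * e) ^ e * 5 ^ l                                ∎
  where
  open ℕₚ.≤-Reasoning
  q = l DivMod./ e
  s = l % e
  l≡ : l ≡ s + q * e
  l≡ = DivMod.m≡m%n+[m/n]*n l e
  l< : suc l ≤ e * (q + 4)
  l< = begin
    suc l           ≡⟨ cong suc l≡ ⟩
    suc s + q * e   ≤⟨ ℕₚ.+-monoˡ-≤ (q * e) (DivMod.m%n<n l e) ⟩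
    e + q * e       ≡⟨ ℕₚ.*-comm (suc q) e ⟩
    e * suc q       ≤⟨ *-monoʳ-≤ e (≤-trans (m≤m+n (suc q) 3) (≤-reflexive (sym (+-suc q 3)))) ⟩
    e * (q + 4)     ∎
  regroup : ∀ a b c d → a * b * (c * d) ≡ a * c * (b * d)
  regroup = ℕ-Ring.solve-∀
  regroup′ : ∀ a b c d → a * b * (c * d) ≡ c * a * (b * d)
  regroup′ = ℕ-Ring.solve-∀

-- `3 ^ e` comes from `W ≤ 3 * (suc l * N)`, 4 from squaring `2 ^ K ≤ 2 * 2 ^ l`, and `(4 * e) ^ e`
-- from trading the power of `suc l` for base 5.
constant : ℕ → ℕ → ℕ
constant e c₀ = c₀ * (3 ^ e * 4 * (4 * e) ^ e)

time-arithmetic : ∀ e {{_ : NonZero e}} c₀ {W K l N} r → W ≤ 3 * (suc l * N) → K ≤ suc l →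
  W ^ e * (r ^ 1 * (2 ^ K) ^ 2) * c₀ * 1000 ^ l ≤ constant e c₀ * 5181 ^ l * r * N ^ e
time-arithmetic e c₀ {W} {K} {l} {N} r W≤ K≤ = begin
  W ^ e * (r ^ 1 * (2 ^ K) ^ 2) * c₀ * 1000 ^ l
    ≤⟨ *-monoˡ-≤ (1000 ^ l) (*-monoˡ-≤ c₀ (*-mono-≤ W^e (*-monoʳ-≤ (r ^ 1) power))) ⟩
  3 ^ e * (suc l ^ e * N ^ e) * (r ^ 1 * (4 * 4 ^ l)) * c₀ * 1000 ^ l
    ≡⟨ arrange (3 ^ e) (suc l ^ e) (N ^ e) r (4 ^ l) c₀ (1000 ^ l) ⟩
  c₀ * (3 ^ e * 4) * r * N ^ e * (suc l ^ e * 4 ^ l * 1000 ^ l)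
    ≤⟨ *-monoʳ-≤ (c₀ * (3 ^ e * 4) * r * N ^ e) (*-monoˡ-≤ (1000 ^ l) (poly≤exp e l)) ⟩
  c₀ * (3 ^ e * 4) * r * N ^ e * ((4 * e) ^ e * 5 ^ l * 1000 ^ l)
    ≡⟨ cong (c₀ * (3 ^ e * 4) * r * N ^ e *_) (trans (ℕₚ.*-assoc ((4 * e) ^ e) (5 ^ l) (1000 ^ l))
         (cong ((4 * e) ^ e *_) (sym (^-distribʳ-* 5 1000 l)))) ⟩
  c₀ * (3 ^ e * 4) * r * N ^ e * ((4 * e) ^ e * 5000 ^ l)
    ≤⟨ *-monoʳ-≤ (c₀ * (3 ^ e * 4) * r * N ^ e) (*-monoʳ-≤ ((4 * e) ^ e) (ℕₚ.^-monoˡ-≤ l (m≤m+n 5000 181))) ⟩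
  c₀ * (3 ^ e * 4) * r * N ^ e * ((4 * e) ^ e * 5181 ^ l)
    ≡⟨ arrange′ c₀ (3 ^ e * 4) r (N ^ e) ((4 * e) ^ e) (5181 ^ l) ⟩
  c₀ * (3 ^ e * 4 * (4 * e) ^ e) * 5181 ^ l * r * N ^ e ∎
  where
  open ℕₚ.≤-Reasoning
  W^e : W ^ e ≤ 3 ^ e * (suc l ^ e * N ^ e)
  W^e = begin
    W ^ e                        ≤⟨ ℕₚ.^-monoˡ-≤ e W≤ ⟩
    (3 * (suc l * N)) ^ e        ≡⟨ ^-distribʳ-* 3 (suc l * N) e ⟩
    3 ^ e * (suc l * N) ^ e      ≡⟨ cong (3 ^ e *_) (^-distribʳ-* (suc l) N e) ⟩
    3 ^ e * (suc l ^ e * N ^ e)  ∎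
  power : (2 ^ K) ^ 2 ≤ 4 * 4 ^ l
  power = begin
    (2 ^ K) ^ 2           ≤⟨ ℕₚ.^-monoˡ-≤ 2 (ℕₚ.^-monoʳ-≤ 2 K≤) ⟩
    (2 * 2 ^ l) ^ 2       ≡⟨ square (2 ^ l) ⟩
    4 * (2 ^ l * 2 ^ l)   ≡⟨ cong (4 *_) (sym (^-distribʳ-* 2 2 l)) ⟩
    4 * 4 ^ l             ∎
    where
    square : ∀ p → 2 * p * (2 * p * 1) ≡ 4 * (p * p)
    square = ℕ-Ring.solve-∀
  arrange : ∀ t s n r f c k → t * (s * n) * (r * 1 * (4 * f)) * c * k ≡ c * (t * 4) * r * n * (s * f * k)
  arrange = ℕ-Ring.solve-∀
  arrange′ : ∀ c t r n p f → c * t * r * n * (p * f) ≡ c * (t * p) * f * r * n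
  arrange′ = ℕ-Ring.solve-∀

-- The cost of the whole program does not depend on r, as literals cost 1.
whole : Bound
whole = (cost (Code.NBE 0) 0 ⊞ # 1) ⊞ (bound 30 7 1 0 ⊠ # 6 ⊞ (# 1 ⊞ (time (Code.table 0) 0 ⊞ cost (Code.answerE 0) 0)))

module Timing (I : Instance) (r : ℕ) {{r≢0 : NonZero r}} where
  open Reading I
  open Whole I r

  total≤ : total ≤ ⟦ sc ⟧ whole
  total≤ = ⟦⊞⟧-≤ sc (cost (Code.NBE r) 0 ⊞ # 1) (bound 30 7 1 0 ⊠ # 6 ⊞ (# 1 ⊞ (time (Code.table r) 0 ⊞ cost (Code.answerE r) 0)))
    (⟦⊞⟧-≤ sc (cost (Code.NBE r) 0) (# 1) (Runs.time≤t counting) (#≤ sc 1))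
    (⟦⊞⟧-≤ sc (bound 30 7 1 0 ⊠ # 6) (# 1 ⊞ (time (Code.table r) 0 ⊞ cost (Code.answerE r) 0))
      (⟦⊠⟧-≤ sc (bound 30 7 1 0) (# 6)
        (⟦⊠⟧-≤ sc (bound 3 3 0 0) (bound 10 4 1 0) (Correct.Nv≤ I r (λ _ → false)) (Correct.B≤ I r (λ _ → false)))
        (#≤ sc 6))
      (⟦⊞⟧-≤ sc (# 1) (time (Code.table r) 0 ⊞ cost (Code.answerE r) 0) (#≤ sc 1)
        (⟦⊞⟧ sc (time (Code.table r) 0) (cost (Code.answerE r) 0))))

  K≤ : K ≤ suc ∣ ℓ ℤ.⊔ 0ℤ ∣
  K≤ = go ℓ
    where
    go : ∀ l → columns l ≤ suc ∣ l ℤ.⊔ 0ℤ ∣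
    go (+ l)    = s≤s (ℕₚ.m≤m⊔n l 0)
    go -[1+ _ ] = z≤n

  W≤ : Wd ≤ 3 * (suc ∣ ℓ ℤ.⊔ 0ℤ ∣ * (n ⊔ c))
  W≤ = begin
    K + n + c                         ≤⟨ +-mono-≤ (+-mono-≤ K≤ (ℕₚ.m≤m⊔n n c)) (ℕₚ.m≤n⊔m n c) ⟩
    k + N + N                         ≤⟨ +-mono-≤ (+-mono-≤ (ℕₚ.m≤m*n k N) (ℕₚ.m≤n*m N k)) (ℕₚ.m≤n*m N k) ⟩
    k * N + k * N + k * N             ≡⟨ triple (k * N) ⟩
    3 * (k * N)                       ∎
    where
    open ℕₚ.≤-Reasoning
    k = suc ∣ ℓ ℤ.⊔ 0ℤ ∣
    N = n ⊔ c
    instance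
      N≢0 : NonZero N
      N≢0 = ℕ.>-nonZero (<-≤-trans (≤-<-trans z≤n s<n) (ℕₚ.m≤m⊔n n c))
    triple : ∀ m → m + m + m ≡ 3 * m
    triple = ℕ-Ring.solve-∀

  -- 12 is the degree of `whole`: three for the table loops over `k`, `L`, `v`, three for the inner
  -- loops over `j`, `p`, `u`, and six for recomputing `NBE` in every cell address.
  in-time : total * 1000 ^ ∣ ℓ ℤ.⊔ 0ℤ ∣ ≤
            constant 12 (Bound.coef whole) * 5181 ^ ∣ ℓ ℤ.⊔ 0ℤ ∣ * r * (n ⊔ c) ^ 12
  in-time = ≤-trans (*-monoˡ-≤ (1000 ^ ∣ ℓ ℤ.⊔ 0ℤ ∣) total≤)
    (time-arithmetic 12 (Bound.coef whole) {Wd} {K} {∣ ℓ ℤ.⊔ 0ℤ ∣} {n ⊔ c} r W≤ K≤)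

n≤2^⌈log₂n⌉ : ∀ n → n ≤ 2 ^ ⌈log₂ n ⌉
n≤2^⌈log₂n⌉ = ℕInduction.<-rec (λ n → n ≤ 2 ^ ⌈log₂ n ⌉) go
  where
  open ℕₚ.≤-Reasoning
  go : ∀ n → (∀ {m} → m < n → m ≤ 2 ^ ⌈log₂ m ⌉) → n ≤ 2 ^ ⌈log₂ n ⌉
  go zero          ih = z≤n
  go (suc zero)    ih = m^n>0 2 ⌈log₂ 1 ⌉
  go n@(suc (suc m)) ih = begin
    n                                ≡⟨ sym (ℕₚ.⌊n/2⌋+⌈n/2⌉≡n n) ⟩
    ℕ.⌊ n /2⌋ + ℕ.⌈ n /2⌉            ≤⟨ ℕₚ.+-monoˡ-≤ ℕ.⌈ n /2⌉ (ℕₚ.⌊n/2⌋≤⌈n/2⌉ n) ⟩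
    ℕ.⌈ n /2⌉ + ℕ.⌈ n /2⌉            ≡⟨ double ℕ.⌈ n /2⌉ ⟩
    2 * ℕ.⌈ n /2⌉                    ≤⟨ *-monoʳ-≤ 2 (ih (ℕₚ.⌈n/2⌉<n m)) ⟩
    2 * 2 ^ ⌈log₂ ℕ.⌈ n /2⌉ ⌉        ≡⟨ cong (λ k → 2 ^ suc k) (Log.⌈log₂⌈n/2⌉⌉≡⌈log₂n⌉∸1 n) ⟩
    2 ^ suc (⌈log₂ n ⌉ ∸ 1)          ≡⟨ cong (2 ^_) (ℕₚ.m+[n∸m]≡n (Log.⌈log₂⌉-mono-≤ {2} {n} (s≤s (s≤s z≤n)))) ⟩
    2 ^ ⌈log₂ n ⌉                    ∎

-- This is `x ≤ ⌈ x ⌉` for `x = 1 / δ` with `δ = suc a / suc d`, cleared of denominators; the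
-- ceiling is by definition minus the floor of `- x`.
ceiling-bound : ∀ d a → suc d ≤ ∣ -ℤ (-[1+ d ] ℤ./ + suc a) ∣ * suc a
ceiling-bound d a = ℤ.drop‿+≤+ (begin
  + suc d                                  ≡⟨ cong -ℤ_ (ℤDivMod.a≡a%n+[a/n]*n -[1+ d ] (+ suc a)) ⟩
  -ℤ (+ s +ℤ q *ℤ + suc a)                 ≡⟨ distribute (+ s) q (+ suc a) ⟩
  (-ℤ q) *ℤ + suc a -ℤ + s                 ≤⟨ ℤₚ.i-j≤i ((-ℤ q) *ℤ + suc a) (+ s) ⟩
  (-ℤ q) *ℤ + suc a                        ≤⟨ ℤₚ.*-monoʳ-≤-nonNeg (+ suc a) (below (-ℤ q)) ⟩
  + ∣ -ℤ q ∣ *ℤ + suc a                    ≡⟨ sym (ℤₚ.pos-* ∣ -ℤ q ∣ (suc a)) ⟩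
  + (∣ -ℤ q ∣ * suc a)                     ∎)
  where
  open ℤₚ.≤-Reasoning
  q = -[1+ d ] ℤ./ + suc a
  s = -[1+ d ] ℤ.% + suc a
  distribute : ∀ s q a → -ℤ (s +ℤ q *ℤ a) ≡ (-ℤ q) *ℤ a -ℤ s
  distribute = ℤ-Ring.solve-∀
  below : ∀ i → i ℤ.≤ + ∣ i ∣
  below (+ _)    = ℤₚ.≤-refl
  below -[1+ _ ] = ℤ.-≤+

logInv≢0 : ∀ δ .{{_ : Positive δ}} → NonZero (logInv δ)
logInv≢0 δ = ℕ.>-nonZero (ℕₚ.m≤m⊔n 1 ⌈log₂ ∣ ℚ.ceiling ((ℚ.1/ δ) {{ℚₚ.pos⇒nonZero δ}}) ∣ ⌉)

logInv-bound : ∀ {a d} .{pr : Coprime (suc a) (suc d)} .{{_ : Positive (ℚ.mkℚ (+ suc a) d pr)}} →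
               suc d ≤ 2 ^ logInv (ℚ.mkℚ (+ suc a) d pr) * suc a
logInv-bound {a} {d} = ≤-trans (ceiling-bound d a) (*-monoˡ-≤ (suc a)
  (≤-trans (n≤2^⌈log₂n⌉ ceil) (ℕₚ.^-monoʳ-≤ 2 (ℕₚ.m≤n⊔m 1 ⌈log₂ ceil ⌉))))
  where ceil = ∣ -ℤ (-[1+ d ] ℤ./ + suc a) ∣

-- `Y` and `Z` count successes and failures: the failure rate `Z / M` is at most `2 ^ - logInv δ`,
-- hence at most `δ`.
1-δ≤ : ∀ δ .{{_ : Positive δ}} {Y Z M} {{M≢0 : NonZero M}} → Y + Z ≡ M → Z * 2 ^ logInv δ ≤ M →
       1ℚ - δ ℚ.≤ (+ Y) ℚ./ M
1-δ≤ δ@(ℚ.mkℚ (+ suc a) d pr) {Y} {Z} {suc m} Y+Z few = ℚₚ.toℚᵘ-cancel-≤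
  (ℚᵘₚ.≤-respˡ-≃ (ℚᵘₚ.≃-sym left) (ℚᵘₚ.≤-respʳ-≃ (ℚᵘₚ.≃-sym right) (ℚᵘ.*≤* cross)))
  where
  M = suc m
  left : ℚ.toℚᵘ (1ℚ - δ) ℚᵘ.≃ ℚᵘ.1ℚᵘ ℚᵘ.+ (ℚᵘ.- ℚᵘ.mkℚᵘ (+ suc a) d)
  left = ℚᵘₚ.≃-trans (ℚₚ.toℚᵘ-homo-+ 1ℚ (ℚ.- δ)) (ℚᵘₚ.+-congʳ ℚᵘ.1ℚᵘ (ℚₚ.toℚᵘ-homo‿- δ))
  right : ℚ.toℚᵘ ((+ Y) ℚ./ M) ℚᵘ.≃ ℚᵘ.mkℚᵘ (+ Y) m
  right = ℚₚ.toℚᵘ-fromℚᵘ (ℚᵘ.mkℚᵘ (+ Y) m)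
  scaled : suc d * M ≤ Y * suc d + suc a * M
  scaled = begin
    suc d * M                                       ≡⟨ cong (suc d *_) (sym Y+Z) ⟩
    suc d * (Y + Z)                                 ≡⟨ trans (ℕₚ.*-distribˡ-+ (suc d) Y Z) (cong (_+ suc d * Z) (ℕₚ.*-comm (suc d) Y)) ⟩
    Y * suc d + suc d * Z                           ≤⟨ ℕₚ.+-monoʳ-≤ (Y * suc d) (*-monoˡ-≤ Z (logInv-bound {a} {d} {pr})) ⟩
    Y * suc d + 2 ^ logInv δ * suc a * Z            ≡⟨ cong (λ k → Y * suc d + k) (rotate (2 ^ logInv δ) (suc a) Z) ⟩
    Y * suc d + suc a * (Z * 2 ^ logInv δ)          ≤⟨ ℕₚ.+-monoʳ-≤ (Y * suc d) (*-monoʳ-≤ (suc a) few) ⟩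
    Y * suc d + suc a * M                           ∎
    where
    open ℕₚ.≤-Reasoning
    rotate : ∀ p a z → p * a * z ≡ a * (z * p)
    rotate = ℕ-Ring.solve-∀
  cross : (ℚᵘ.↥ (ℚᵘ.1ℚᵘ ℚᵘ.+ (ℚᵘ.- ℚᵘ.mkℚᵘ (+ suc a) d))) *ℤ + M ℤ.≤ + Y *ℤ (ℚᵘ.↧ (ℚᵘ.1ℚᵘ ℚᵘ.+ (ℚᵘ.- ℚᵘ.mkℚᵘ (+ suc a) d)))
  cross = begin
    (+ 1 *ℤ + suc d +ℤ -[1+ a ] *ℤ + 1) *ℤ + M    ≡⟨ expand (+ suc d) (+ suc a) (+ M) ⟩
    + suc d *ℤ + M -ℤ + suc a *ℤ + M              ≡⟨ cong₂ _-ℤ_ (sym (ℤₚ.pos-* (suc d) M)) (sym (ℤₚ.pos-* (suc a) M)) ⟩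
    + (suc d * M) -ℤ + (suc a * M)                ≤⟨ ℤₚ.+-monoˡ-≤ (-ℤ + (suc a * M)) (ℤ.+≤+ scaled) ⟩
    + (Y * suc d + suc a * M) -ℤ + (suc a * M)    ≡⟨ cancel (+ (Y * suc d)) (+ (suc a * M)) ⟩
    + (Y * suc d)                                 ≡⟨ cong (λ k → + (Y * k)) (sym (ℕₚ.*-identityˡ (suc d))) ⟩
    + (Y * (1 * suc d))                           ≡⟨ ℤₚ.pos-* Y (1 * suc d) ⟩
    + Y *ℤ + (1 * suc d)                          ∎
    where
    open ℤₚ.≤-Reasoning
    expand : ∀ d a m → (+ 1 *ℤ d +ℤ (-ℤ a) *ℤ + 1) *ℤ m ≡ d *ℤ m -ℤ a *ℤ m
    expand = ℤ-Ring.solve-∀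
    cancel : ∀ y a → (y +ℤ a) -ℤ a ≡ y
    cancel = ℤ-Ring.solve-∀

saysYes-bit : ∀ {p τ b} → reg τ 0 ≡ bit b → saysYes (p , τ) ≡ b
saysYes-bit {b = true}  e rewrite e = refl
saysYes-bit {b = false} e rewrite e = refl

countTrue-not : ∀ m (f : Vec Bool m → Bool) → countTrue m f + countTrue m (not ∘ f) ≡ 2 ^ m
countTrue-not zero f with f []
... | true  = refl
... | false = refl
countTrue-not (suc m) f = trans
  (interchange (countTrue m (f ∘ (true ∷_))) (countTrue m (f ∘ (false ∷_))) _ _)
  (trans (cong₂ _+_ (countTrue-not m (f ∘ (true ∷_))) (countTrue-not m (f ∘ (false ∷_)))) (double (2 ^ m)))
  where
  interchange : ∀ a b c d → (a + b) + (c + d) ≡ (a + c) + (b + d)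
  interchange = ℕ-Ring.solve-∀

Pr-bound : ∀ δ .{{_ : Positive δ}} m (f : Vec Bool m → Bool) →
           countTrue m (not ∘ f) * 2 ^ logInv δ ≤ 2 ^ m → 1ℚ - δ ℚ.≤ Pr m f
Pr-bound δ m f = 1-δ≤ δ {countTrue m f} {countTrue m (not ∘ f)} {2 ^ m} {{M≢0 = m^n≢0 2 m}} (countTrue-not m f)

abstract
  C₀ : ℕ
  C₀ = constant 12 (Bound.coef whole)

  in-time : ∀ I r {{_ : NonZero r}} → let open Instance I in
    Whole.total I r * 1000 ^ ∣ ℓ ℤ.⊔ 0ℤ ∣ ≤ C₀ * 5181 ^ ∣ ℓ ℤ.⊔ 0ℤ ∣ * r * (n ⊔ c) ^ 12
  in-time I r = Timing.in-time I r

theorem13 : ∃[ C ] ∃[ d ]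
    ((ε : ℚ) .{{_ : Positive ε}} →
    ∃[ P ] ((I : Instance) →
    ∃[ m ] (TimeBound C d ε I m
    × HaltsWithin P I m
    × (¬ IsYes I → (coins : Vec Bool m) → saysYes (final P I coins) ≡ false)
    × (IsYes I → 1ℚ - ε ℚ.≤ Pr m (λ coins → saysYes (final P I coins))))))
theorem13 = C₀ , 12 , λ δ → Code.sieve (logInv δ) , λ I → correct δ I
  where
  correct : ∀ δ .{{_ : Positive δ}} I → let P = Code.sieve (logInv δ) in ∃[ m ]
    (TimeBound C₀ 12 δ I m × HaltsWithin P I m
    × (¬ IsYes I → (coins : Vec Bool m) → saysYes (final P I coins) ≡ false)
    × (IsYes I → 1ℚ - δ ℚ.≤ Pr m (λ coins → saysYes (final P I coins))))
  correct δ I = total , in-time I r , halts , (λ no coins → trans (says coins) (never-wrong no (drawn coins))) , likely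
    where
    r = logInv δ
    instance
      r≢0 : NonZero r
      r≢0 = logInv≢0 δ
    open Whole I r
    open Analysis I r
    halts : HaltsWithin (Code.sieve r) I total
    halts coins = cong proj₁ (proj₁ (proj₂ (run-sieve coins)))
    says : ∀ coins → saysYes (final (Code.sieve r) I coins) ≡ answer (drawn coins)
    says coins = trans (cong saysYes (proj₁ (proj₂ (run-sieve coins))))
      (saysYes-bit {[]} {proj₁ (run-sieve coins)} (proj₂ (proj₂ (run-sieve coins))))
    likely : IsYes I → 1ℚ - δ ℚ.≤ Pr total (λ coins → saysYes (final (Code.sieve r) I coins))
    likely yes-instance = Pr-bound δ total event few
      where
      event = λ coins → saysYes (final (Code.sieve r) I coins)
      -- The number of coins without influence on the answer; their factor `2 ^ q` appears on both
      -- sides.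
      q = setup + (NB * 5 + suc rest)
      few : countTrue total (not ∘ event) * 2 ^ r ≤ 2 ^ total
      few = begin
        countTrue total (not ∘ event) * 2 ^ r
          ≡⟨ cong (_* 2 ^ r) (countTrue-cong total (λ coins → cong not (says coins))) ⟩
        countTrue total (λ coins → not (answer (drawn coins))) * 2 ^ r
          ≡⟨ cong (_* 2 ^ r) (countTrue-selected setup NB (suc rest) (not ∘ answer)) ⟩
        2 ^ q * countTrue NB (not ∘ answer) * 2 ^ r
          ≡⟨ ℕₚ.*-assoc (2 ^ q) _ _ ⟩
        2 ^ q * (countTrue NB (not ∘ answer) * 2 ^ r)
          ≤⟨ *-monoʳ-≤ (2 ^ q) (mostly-right yes-instance) ⟩
        2 ^ q * 2 ^ NB
          ≡⟨ sym (2^-selected setup NB (suc rest)) ⟩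
        2 ^ total ∎
        where open ℕₚ.≤-Reasoning
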